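{- If $G$ is a non-planar ribbon graph, then there are vertices $v, v'$ of $G$ such that the actions $\beta_v$ and $\beta_{v'}$ of $\operatorname{Pic}^0(G)$ on $S(G)$ are different.
   Context: A graph means a finite connected multigraph without loop edges; a ribbon graph is a graph with a cyclic ordering of the edges around each vertex. A ribbon graph is planar if it can be embedded in $\mathbb{R}^2$ without crossings so that the cyclic orderings are those induced by the counterclockwise orientation of the plane (equivalently, the closed orientable surface determined by the ribbon structure has genus $0$); otherwise it is non-planar. $S(G)$ is the set of spanning trees. Divisors are formal integer combinations of vertices. For $f : V(G) \to \mathbb{Z}$, $\Delta f = \sum_{u} \big(\sum_{\text{edges } uw} (f(u)-f(w))\big)(u)$; $D \sim D'$ if $D - D' = \Delta f$ for some $f$. $\operatorname{Pic}^d(G)$ is the set of linear equivalence classes of degree-$d$ divisors; $\operatorname{Pic}^0(G)$ is a group. The genus is $g = |E(G)|-|V(G)|+1$. For a spanning tree $T$ with non-tree edges $e_1,\dots,e_g$, a $T$-break divisor is $\sum_i (v_i)$ with $v_i$ an endpoint of $e_i$; $B(G)$ is the set of all such (over all $T$). Every class in $\operatorname{Pic}^g(G)$ contains exactly one element of $B(G)$, and $\operatorname{Pic}^0(G)$ acts on $B(G)$ by $\gamma \cdot D :=$ the unique break divisor linearly equivalent to $D + \gamma$. Bernardi map: for a vertex $v$, an edge $e$ incident to $v$, and a spanning tree $T$, the tour starts at $v$ and examines edges at $v$ in cyclic order starting with $e$; at a current vertex $u$, an examined edge $f \notin T$ is "cut through" from $u$ and the next edge at $u$ is examined, while an examined edge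 $f \in T$ is walked along to its other endpoint $u'$, after which the edges at $u'$ are examined in cyclic order starting with the edge after $f$. The tour ends when each tree edge has been traversed in both directions. For $f \notin T$, $\eta_{(v,e)}(f)$ is the endpoint from which $f$ is first cut through, and $\beta_{(v,e)}(T) = \sum_{f \notin T} (\eta_{(v,e)}(f))$; $\beta_{(v,e)} : S(G) \to B(G)$ is a bijection. The action $\beta_v$ is $\gamma \cdot T := \beta_{(v,e)}^{ -1}(\gamma \cdot \beta_{(v,e)}(T))$ for any edge $e$ incident to $v$ (independent of $e$). -}

module Defs where

open import Data.Bool.Base using (Bool; true; false; not; if_then_else_)
import Data.Bool.Properties as Bool
open import Data.Fin.Base using (Fin)
import Data.Fin.Properties as Fin
open import Data.Fin.Subset using (Subset; _∈_)
open import Data.Fin.Subset.Properties using (_∈?_)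
open import Data.Integer.Base using (ℤ; +_; 0ℤ; _+_; _-_; _*_; -_)
open import Data.Integer.Properties using (+-inverseʳ; neg-distrib-+)
open import Data.Integer.Tactic.RingSolver using (solve-∀)
open import Data.List.Base as List
  using (List; []; _∷_; map; filter; foldr; length; allFin; cartesianProduct; deduplicate; mapMaybe; find)
open import Data.List.Properties using (map-cong)
open import Data.List.Relation.Unary.All using (All)
open import Data.List.Relation.Unary.Any using (any?)
import Data.List.Membership.Propositional as Membership
open import Data.List.Relation.Unary.Unique.Propositional using (Unique)
open import Data.Maybe.Base using (Maybe)
open import Data.Nat.Base using (ℕ; zero; suc; NonZero; _⊔_)
open import Data.Nat.GeneralisedArithmetic using (iterate)
open import Data.Product.Base using (Σ; Σ-syntax; ∃-syntax; _×_; _,_; proj₁)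
import Data.Product.Properties as Product
open import Level using (0ℓ)
open import Relation.Binary.Bundles using (Setoid)
import Relation.Binary.Construct.On as On
open import Relation.Binary.Definitions using (DecidableEquality; Decidable)
open import Relation.Binary.PropositionalEquality
  using (_≡_; _≢_; refl; sym; trans; cong; cong₂)
open import Relation.Binary.Structures using (IsEquivalence)
open import Relation.Nullary.Decidable using (does; ¬?)
open import Relation.Nullary.Negation using (¬_)

------------------------------------------------------------------------
-- Graphs

-- The two endpoints of e are  end e false  and  end e true ; the labels only
-- distinguish the two ends of e.
record Multigraph : Set where
  field
    #V  : ℕ
    #E  : ℕ
    end : Fin #E → Bool → Fin #V

  Vertex = Fin #V
  Edge   = Fin #E

  -- The dart (e , b) is the end of e at  end e b , oriented away from that
  -- vertex.
  Dart = Edge × Bool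

  edge : Dart → Edge
  edge = proj₁

  tail : Dart → Vertex
  tail (e , b) = end e b

  flip : Dart → Dart
  flip (e , b) = e , not b

  head : Dart → Vertex
  head d = tail (flip d)

  darts : List Dart
  darts = cartesianProduct (allFin #E) (false ∷ true ∷ [])

  _≟ᴰ_ : DecidableEquality Dart
  _≟ᴰ_ = Product.≡-dec Fin._≟_ Bool._≟_

module _ (M : Multigraph) where
  open Multigraph M

  data Walk : Vertex → List Dart → Vertex → Set where
    []  : ∀ {v} → Walk v [] v
    _∷_ : ∀ d {ds v} → Walk (head d) ds v → Walk (tail d) (d ∷ ds) v

  Connected : Set
  Connected = ∀ u v → ∃[ ds ] Walk u ds v

  record Cycle (ds : List Dart) : Set where
    field
      nonEmpty         : ds ≢ []
      basepoint        : Vertex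
      closed           : Walk basepoint ds basepoint
      distinctEdges    : Unique (map edge ds)
      distinctVertices : Unique (map tail ds)

  record SpanningTree : Set where
    field
      edges     : Subset #E
      connected : ∀ u v → ∃[ ds ] (Walk u ds v × All (λ d → edge d ∈ edges) ds)
      acyclic   : ∀ ds → Cycle ds → ¬ All (λ d → edge d ∈ edges) ds

record Graph : Set where
  field
    multigraph : Multigraph

  open Multigraph multigraph public

  field
    nonEmpty  : NonZero #V
    loopless  : ∀ e → end e false ≢ end e true
    connected : Connected multigraph

record RibbonGraph : Set where
  field
    graph : Graph

  open Graph graph public

  -- On each finite set of darts at a vertex, transitivity of  next  forces it
  -- to be a permutation with a single cycle.
  field
    next      : Dart → Dart
    next-tail : ∀ d → tail (next d) ≡ tail d
    cyclic    : ∀ d d′ → tail d ≡ tail d′ → ∃[ k ] iterate next d k ≡ d′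

------------------------------------------------------------------------
-- Divisors and the Picard group

sumℤ : List ℤ → ℤ
sumℤ = foldr _+_ 0ℤ

private
  module _ {A : Set} where

    sum-zero : ∀ (xs : List A) → sumℤ (map (λ _ → 0ℤ) xs) ≡ 0ℤ
    sum-zero []       = refl
    sum-zero (_ ∷ xs) = cong (_+_ 0ℤ) (sum-zero xs)

    sum-neg : ∀ (h : A → ℤ) xs →
              sumℤ (map (λ x → - h x) xs) ≡ - sumℤ (map h xs)
    sum-neg h []       = refl
    sum-neg h (x ∷ xs) = trans (cong (_+_ (- h x)) (sum-neg h xs))
                               (sym (neg-distrib-+ (h x) _))

    sum-+ : ∀ (h k : A → ℤ) xs →
            sumℤ (map (λ x → h x + k x) xs) ≡ sumℤ (map h xs) + sumℤ (map k xs)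
    sum-+ h k []       = refl
    sum-+ h k (x ∷ xs) = trans (cong (_+_ (h x + k x)) (sum-+ h k xs))
                               (swap (h x) (k x) _ _)
      where
      swap : ∀ a b c d → (a + b) + (c + d) ≡ (a + c) + (b + d)
      swap = solve-∀

  sub-neg : ∀ a b → (- a) - (- b) ≡ - (a - b)
  sub-neg = solve-∀

  sub-+ : ∀ a b c d → (a + b) - (c + d) ≡ (a - c) + (b - d)
  sub-+ = solve-∀

  sub-swap : ∀ a b → b - a ≡ - (a - b)
  sub-swap = solve-∀

  sub-trans : ∀ a b c → a - c ≡ (a - b) + (b - c)
  sub-trans = solve-∀

module _ (G : Graph) where
  open Graph G

  Divisor : Set
  Divisor = Vertex → ℤ

  infixl 6 _⊕_
  _⊕_ : Divisor → Divisor → Divisor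
  (D ⊕ D′) u = D u + D′ u

  -- (v₁) + … + (vₖ) for the list v₁ ∷ … ∷ vₖ ∷ [].
  formalSum : List Vertex → Divisor
  formalSum vs u = + length (filter (Fin._≟ u) vs)

  deg : Divisor → ℤ
  deg D = sumℤ (map D (allFin #V))

  Δ : (Vertex → ℤ) → Divisor
  Δ f u = sumℤ (map (λ d → f u - f (head d)) (filter (λ d → tail d Fin.≟ u) darts))

  infix 4 _∼_
  _∼_ : Divisor → Divisor → Set
  D ∼ D′ = ∃[ f ] ∀ u → D u - D′ u ≡ Δ f u

  ∼-isEquivalence : IsEquivalence _∼_
  ∼-isEquivalence = record
    { refl  = λ {D} → (λ _ → 0ℤ) , λ u →
        trans (+-inverseʳ (D u)) (sym (sum-zero (at u)))
    ; sym   = λ {D} {D′} (f , p) → (λ u → - f u) , λ u →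
        trans (sub-swap (D u) (D′ u)) (trans (cong -_ (p u)) (sym (Δ-neg f u)))
    ; trans = λ {D} {D′} {D″} (f , p) (g , q) → (λ u → f u + g u) , λ u →
        trans (sub-trans (D u) (D′ u) (D″ u))
              (trans (cong₂ _+_ (p u) (q u)) (sym (Δ-+ f g u)))
    }
    where
    at : Vertex → List Dart
    at u = filter (λ d → tail d Fin.≟ u) darts

    Δ-neg : ∀ f u → Δ (λ w → - f w) u ≡ - Δ f u
    Δ-neg f u =
      trans (cong sumℤ (map-cong (λ d → sub-neg (f u) (f (head d))) (at u)))
            (sum-neg _ (at u))

    Δ-+ : ∀ f g u → Δ (λ w → f w + g w) u ≡ Δ f u + Δ g u
    Δ-+ f g u =
      trans (cong sumℤ (map-cong (λ d → sub-+ (f u) (g u) (f (head d)) (g (head d))) (at u)))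
            (sum-+ _ _ (at u))

  ∼-setoid : Setoid 0ℓ 0ℓ
  ∼-setoid = record { isEquivalence = ∼-isEquivalence }

  -- There are no quotient types: Pic k is the set of divisors of degree k
  -- together with linear equivalence as its equality.
  Pic : ℤ → Setoid 0ℓ 0ℓ
  Pic k = On.setoid {B = Σ Divisor (λ D → deg D ≡ k)} ∼-setoid proj₁

  Pic⁰ : Set
  Pic⁰ = Setoid.Carrier (Pic 0ℤ)

  nonTreeEdges : SpanningTree multigraph → List Edge
  nonTreeEdges T = filter (λ e → ¬? (e ∈? SpanningTree.edges T)) (allFin #E)

  -- The values of the choice of endpoints on edges of T are irrelevant.
  IsBreakDivisorOf : SpanningTree multigraph → Divisor → Set
  IsBreakDivisorOf T D =
    Σ[ side ∈ (Edge → Bool) ] ∀ u → D u ≡ formalSum (map (λ e → end e (side e)) (nonTreeEdges T)) u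

  IsBreakDivisor : Divisor → Set
  IsBreakDivisor D = ∃[ T ] IsBreakDivisorOf T D

  -- γ · D = D′ for the action of Pic⁰ on B(G), given by its graph: D′ is a
  -- break divisor in the class of D + γ.  The relation depends only on the
  -- class of γ, and D′ exists and is unique because each class of degree g
  -- contains exactly one break divisor.
  infix 4 _·_↦_
  _·_↦_ : Pic⁰ → Divisor → Divisor → Set
  (γ , _) · D ↦ D′ = IsBreakDivisor D′ × D′ ∼ D ⊕ γ

------------------------------------------------------------------------
-- Planarity, the Bernardi process and the Bernardi action

module _ (R : RibbonGraph) where
  open RibbonGraph R

  -- Orbits of  nextOnFace  are the boundary walks of the faces of the closed
  -- orientable surface determined by R.
  nextOnFace : Dart → Dart
  nextOnFace d = next (flip d)

  sameFace? : Decidable (λ d d′ → d′ Membership.∈ List.iterate nextOnFace d (length darts))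
  sameFace? d d′ = any? (d′ ≟ᴰ_) (List.iterate nextOnFace d (length darts))

  -- A single vertex without edges lies on the sphere with one face, whose
  -- boundary has no darts; this is the only case in which 1 ⊔_ matters.
  #F : ℕ
  #F = 1 ⊔ length (deduplicate sameFace? darts)

  eulerCharacteristic : ℤ
  eulerCharacteristic = + #V - + #E + + #F

  HasSurfaceGenus : ℕ → Set
  HasSurfaceGenus h = eulerCharacteristic ≡ + 2 - + 2 * + h

  Planar : Set
  Planar = HasSurfaceGenus 0

  NonPlanar : Set
  NonPlanar = ¬ Planar

  module Tour (T : SpanningTree multigraph) where
    open SpanningTree T using (edges)

    -- The dart (e , b) as a state of the tour: the walker is at  end e b  and
    -- examines e.  A tree edge is walked along, any other edge is cut through.
    step : Dart → Dart
    step d = if does (edge d ∈? edges) then next (flip d) else next d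

    -- The second argument lists the tree darts not yet traversed; the tour
    -- ends when there are none.
    tourFrom : ℕ → List Dart → Dart → List Dart
    tourFrom zero    _        _ = []
    tourFrom (suc k) []       _ = []
    tourFrom (suc k) (t ∷ ts) d =
      d ∷ tourFrom k (filter (λ x → ¬? (x ≟ᴰ d)) (t ∷ ts)) (step d)

    -- The bound on the number of steps never cuts the tour short: for a spanning
    -- tree, step permutes the darts in a single cycle.
    tour : Dart → List Dart
    tour = tourFrom (length darts) (filter (λ d → edge d ∈? edges) darts)

    -- The dart of f from which f is first examined; for f outside T this is
    -- where f is first cut through, and it always exists.
    firstCut : Dart → Edge → Maybe Dart
    firstCut d f = find (λ x → edge x Fin.≟ f) (tour d)

  -- The pair (v , e) is encoded by the dart of e with tail v.
  β : Dart → SpanningTree multigraph → Divisor graph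
  β d T = formalSum graph (map tail (mapMaybe (Tour.firstCut T d) (nonTreeEdges graph T)))

  -- γ · T = T′ for the action β_v, given by its graph; any dart d at v yields
  -- the same relation.
  BernardiAction : Vertex → Pic⁰ graph → SpanningTree multigraph → SpanningTree multigraph → Set
  BernardiAction v γ T T′ = ∃[ d ] (tail d ≡ v × _·_↦_ graph γ (β d T) (β d T′))

  -- Some γ and T have γ · T = T′ for the first action but γ · T ≠ T′ for the
  -- second.
  DifferentActions : Vertex → Vertex → Set
  DifferentActions v v′ =
    ∃[ γ ] ∃[ T ] ∃[ T′ ] (BernardiAction v γ T T′ × ¬ BernardiAction v′ γ T T′)

{-# OPTIONS --safe #-}

-- Fix a spanning tree T. The Bernardi tour is a cyclic order on the darts, and moving its start from d to the next
-- dart at tail d changes β_d(T) by (head d) - (tail d), up to linear equivalence and independently of T. Hence the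
-- actions at tail d and head d compare T with a tree through the edge of d equally only if
-- β_{flip d}(T) - β_d(T) is equivalent to (head d) - (tail d). For d outside T the two sides differ by
-- X = Σ (f₊) - (f₋) over the chords f crossing d on the tour, a difference of two T-break divisors, so that X ∼ 0
-- forces X = 0. If X = 0 for all chords d, then crossing chords are parallel, because darts at two distinct
-- vertices do not alternate on the tour; and parallel chords do not cross, by infinite descent along their common
-- tail. But if no chords cross, then undoing the transpositions (d  flip d) one chord at a time splits the tour
-- into g + 1 faces, and R is planar.

module Submission where

open import Defs
open import Data.Product.Base using (∃-syntax)

open import Data.Bool.Base using (Bool; true; false; not; if_then_else_)
import Data.Bool.Properties as Bool
open import Data.Empty using (⊥; ⊥-elim)
open import Data.Fin.Base as Fin using (Fin)
import Data.Fin.Properties as Fin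
open import Data.Fin.Subset as Subset using (Subset)
open import Data.Fin.Subset.Properties using (_∈?_)
open import Data.Integer.Base as ℤ using (ℤ; 0ℤ; 1ℤ; _+_; _-_; _*_; -_; -[1+_])
import Data.Integer.Properties as ℤ
open import Data.Integer.Tactic.RingSolver using (solve-∀)
open import Data.List.Base as List
  using (List; []; _∷_; _++_; length; map; filter; allFin; cartesianProduct; deduplicate; mapMaybe)
open import Data.List.Membership.Propositional using (_∈_; _∉_; find; lose)
open import Data.List.Membership.Propositional.Properties
  using (∈-∃++; ∈-++⁺ˡ; ∈-++⁺ʳ; ∈-++⁻; ∈-allFin; ∈-filter⁺; ∈-filter⁻; ∈-cartesianProduct⁺)
import Data.List.Membership.DecPropositional as DecMembership
open import Data.List.Properties
  using (length-++; length-tabulate; length-map; map-∘; ++-assoc; ∷-injectiveˡ; ∷-injectiveʳ)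
open import Data.List.Relation.Binary.Disjoint.Propositional using (Disjoint)
open import Data.List.Relation.Binary.Permutation.Propositional.Properties using (↭-length; ++-comm)
open import Data.List.Relation.Unary.All as All using (All; []; _∷_)
import Data.List.Relation.Unary.All.Properties as All
open import Data.List.Relation.Unary.AllPairs as AllPairs using (AllPairs; []; _∷_)
import Data.List.Relation.Unary.AllPairs.Properties as AllPairs
open import Data.List.Relation.Unary.Any as Any using (Any; here; there; any?)
import Data.List.Relation.Unary.Any.Properties as Any
open import Data.List.Relation.Unary.Unique.Propositional using (Unique)
import Data.List.Relation.Unary.Unique.Propositional.Properties as Unique
open import Data.Maybe.Base using (just; maybe′)
open import Data.Nat.Base as ℕ using (ℕ; zero; suc; _≤_; _<_; _⊔_; z≤n; s≤s; z<s)
import Data.Nat.Properties as ℕ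
open import Data.Nat.GeneralisedArithmetic using (iterate)
open import Data.Product.Base using (Σ-syntax; ∃₂; _×_; _,_; proj₁; proj₂)
open import Data.Sum.Base as Sum using (_⊎_; inj₁; inj₂)
open import Data.Vec.Base using (tabulate)
open import Data.Vec.Properties using (lookup⇒[]=; []=⇒lookup; lookup∘tabulate)
open import Function.Base using (_∘_)
import Relation.Binary.Definitions as Binary
open import Relation.Binary.Definitions using (DecidableEquality; tri<; tri≈; tri>)
open import Relation.Binary.PropositionalEquality hiding ([_])
import Relation.Binary.Reasoning.Setoid as SetoidReasoning
open import Relation.Binary.Structures using (IsEquivalence)
open import Relation.Nullary using (Dec; yes; no; does; ¬_; ¬?; _×-dec_; _⊎-dec_)
open import Relation.Nullary.Decidable using (map′; dec-true; dec-false)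
open import Relation.Unary using (Decidable)

-- Finite sums of integers

-- The two vertices are the ends of one chord `d`. The second tree `T′` is any spanning tree through
-- `edge d`, and `γ` is the difference of the divisors of `T′` and `T` for the start `d`, so that
-- the action at `tail d` takes `T` to `T′`. For `T′` the relation between the starts `d` and
-- `flip d` holds because its tour walks along `d`; if the action at `head d` agreed, the relation
-- would pass to `T`. That X does not vanish is detected by one coefficient: some `x` crosses `d`
-- while no chord at `tail x` crosses `d` in the opposite direction, so the coefficient of X at
-- `tail x` is negative. The absence of such pairs is weaker than X = 0 for all chords, yet it
-- suffices for the descent; being decidable, it lets the pair be found by a search through the
-- darts. The Euler characteristic also requires the number of tree edges: it comes from the same
-- splitting, applied to the tree edges, which turns the tour into the cycles of `next`.

∑ : {A : Set} → List A → (A → ℤ) → ℤ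
∑ xs f = sumℤ (map f xs)

module _ {A : Set} where

  ∑-cong : ∀ {f g : A → ℤ} xs → (∀ x → f x ≡ g x) → ∑ xs f ≡ ∑ xs g
  ∑-cong []       f≗g = refl
  ∑-cong (x ∷ xs) f≗g = cong₂ _+_ (f≗g x) (∑-cong xs f≗g)

  ∑-+ : ∀ (f g : A → ℤ) xs → ∑ xs (λ x → f x + g x) ≡ ∑ xs f + ∑ xs g
  ∑-+ f g []       = refl
  ∑-+ f g (x ∷ xs) = trans (cong ((f x + g x) +_) (∑-+ f g xs)) (rearrange (f x) (g x) _ _)
    where
    rearrange : ∀ a b c d → (a + b) + (c + d) ≡ (a + c) + (b + d)
    rearrange = solve-∀

  ∑-- : ∀ (f g : A → ℤ) xs → ∑ xs (λ x → f x - g x) ≡ ∑ xs f - ∑ xs g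
  ∑-- f g []       = refl
  ∑-- f g (x ∷ xs) = trans (cong ((f x - g x) +_) (∑-- f g xs)) (rearrange (f x) (g x) _ _)
    where
    rearrange : ∀ a b c d → (a - b) + (c - d) ≡ (a + c) - (b + d)
    rearrange = solve-∀

  ∑-*ˡ : ∀ c (f : A → ℤ) xs → ∑ xs (λ x → c * f x) ≡ c * ∑ xs f
  ∑-*ˡ c f []       = sym (ℤ.*-zeroʳ c)
  ∑-*ˡ c f (x ∷ xs) = trans (cong (c * f x +_) (∑-*ˡ c f xs)) (sym (ℤ.*-distribˡ-+ c (f x) _))

  ∑-0 : ∀ {f : A → ℤ} xs → (∀ {x} → x ∈ xs → f x ≡ 0ℤ) → ∑ xs f ≡ 0ℤ
  ∑-0 []       f≗0 = refl
  ∑-0 (x ∷ xs) f≗0 = cong₂ _+_ (f≗0 (here refl)) (∑-0 xs (f≗0 ∘ there))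

  ∑-filter : ∀ {P : A → Set} (P? : Decidable P) (f : A → ℤ) xs →
             ∑ (filter P? xs) f ≡ ∑ xs (λ x → if does (P? x) then f x else 0ℤ)
  ∑-filter P? f []       = refl
  ∑-filter P? f (x ∷ xs) with does (P? x)
  ... | true  = cong (f x +_) (∑-filter P? f xs)
  ... | false = trans (∑-filter P? f xs) (sym (ℤ.+-identityˡ _))

  ∑-pick : ∀ {f : A → ℤ} {xs a} → Unique xs → a ∈ xs →
           (∀ x → x ≢ a → f x ≡ 0ℤ) → ∑ xs f ≡ f a
  ∑-pick {f} {x ∷ xs} (x∉xs ∷ _) (here refl) f≗0 =
    trans (cong (f x +_) (∑-0 xs λ y∈xs → f≗0 _ λ y≡x → All.lookup x∉xs y∈xs (sym y≡x)))
          (ℤ.+-identityʳ (f x))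
  ∑-pick {f} {x ∷ xs} (x∉xs ∷ xs!) (there a∈xs) f≗0 =
    trans (cong₂ _+_ (f≗0 x (All.lookup x∉xs a∈xs)) (∑-pick xs! a∈xs f≗0)) (ℤ.+-identityˡ _)

  ∑-mono-≤ : ∀ {f g : A → ℤ} xs → (∀ x → f x ℤ.≤ g x) → ∑ xs f ℤ.≤ ∑ xs g
  ∑-mono-≤ []       f≤g = ℤ.≤-refl
  ∑-mono-≤ (x ∷ xs) f≤g = ℤ.+-mono-≤ (f≤g x) (∑-mono-≤ xs f≤g)

  ∑-mono-< : ∀ {f g : A → ℤ} {xs a} → (∀ x → f x ℤ.≤ g x) → a ∈ xs → f a ℤ.< g a →
             ∑ xs f ℤ.< ∑ xs g
  ∑-mono-< {xs = _ ∷ xs} f≤g (here refl)  fa<ga = ℤ.+-mono-<-≤ fa<ga (∑-mono-≤ xs f≤g)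
  ∑-mono-< {xs = x ∷ xs} f≤g (there a∈xs) fa<ga = ℤ.+-mono-≤-< (f≤g x) (∑-mono-< f≤g a∈xs fa<ga)

  ∑-× : ∀ (f : A × Bool → ℤ) xs →
        ∑ (cartesianProduct xs (false ∷ true ∷ [])) f ≡ ∑ xs (λ x → f (x , false) + f (x , true))
  ∑-× f []       = refl
  ∑-× f (x ∷ xs) = trans (cong (λ s → f (x , false) + (f (x , true) + s)) (∑-× f xs))
                         (sym (ℤ.+-assoc (f (x , false)) _ _))

  ∑-1 : ∀ (xs : List A) → ∑ xs (λ _ → 1ℤ) ≡ ℤ.+ length xs
  ∑-1 []       = refl
  ∑-1 (x ∷ xs) = cong (1ℤ +_) (∑-1 xs)

∑-swap : ∀ {A B : Set} (f : A → B → ℤ) xs ys →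
         ∑ xs (λ x → ∑ ys (f x)) ≡ ∑ ys (λ y → ∑ xs (λ x → f x y))
∑-swap f []       ys = sym (∑-0 ys (λ _ → refl))
∑-swap f (x ∷ xs) ys = trans (cong (∑ ys (f x) +_) (∑-swap f xs ys)) (sym (∑-+ (f x) _ ys))

δ : ∀ {n} → Fin n → Fin n → ℤ
δ v u = if does (v Fin.≟ u) then 1ℤ else 0ℤ

δ-≡ : ∀ {n} (v : Fin n) → δ v v ≡ 1ℤ
δ-≡ v with v Fin.≟ v
... | yes _  = refl
... | no v≢v = ⊥-elim (v≢v refl)

δ-≢ : ∀ {n} {v u : Fin n} → v ≢ u → δ v u ≡ 0ℤ
δ-≢ {v = v} {u} v≢u with v Fin.≟ u
... | yes v≡u = ⊥-elim (v≢u v≡u)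
... | no _    = refl

-- Cycles of a self-map

module _ {A : Set} (f : A → A) where

  -- The end point is the image of the last element and is not itself listed.
  data Arc : A → List A → A → Set where
    []  : ∀ {x} → Arc x [] x
    _∷_ : ∀ x {xs z} → Arc (f x) xs z → Arc x (x ∷ xs) z

module _ {A : Set} {f : A → A} where

  arc-++ : ∀ {x y z xs ys} → Arc f x xs y → Arc f y ys z → Arc f x (xs ++ ys) z
  arc-++ []      q = q
  arc-++ (x ∷ p) q = x ∷ arc-++ p q

  arc-split : ∀ {x z} xs {y ys} → Arc f x (xs ++ y ∷ ys) z → Arc f x xs y × Arc f (f y) ys z
  arc-split []       (_ ∷ p) = [] , p
  arc-split (_ ∷ xs) (x ∷ p) with q , r ← arc-split xs p = x ∷ q , r

  arc-rotate : ∀ {x} xs {y ys} → Arc f x (xs ++ y ∷ ys) x → Arc f y (y ∷ ys ++ xs) y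
  arc-rotate xs {y} p with q , r ← arc-split xs p = y ∷ arc-++ r q

  arc-cong : ∀ {g : A → A} {x xs z} → All (λ y → f y ≡ g y) xs → Arc f x xs z → Arc g x xs z
  arc-cong []           []      = []
  arc-cong {g} {z = z} (fx≡gx ∷ q) (_∷_ x {xs} p) = x ∷ subst (λ y → Arc g y xs z) fx≡gx (arc-cong q p)

  arc-closed : ∀ {x xs z y} → Arc f x xs z → y ∈ xs → f y ∈ xs ⊎ f y ≡ z
  arc-closed (x ∷ [])          (here refl) = inj₂ refl
  arc-closed (x ∷ (.(f x) ∷ p)) (here refl) = inj₁ (there (here refl))
  arc-closed (x ∷ p) (there y∈xs) with arc-closed p y∈xs
  ... | inj₁ fy∈xs = inj₁ (there fy∈xs)
  ... | inj₂ fy≡z  = inj₂ fy≡z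

  cycle-closed : ∀ {x xs y} → Arc f x xs x → y ∈ xs → f y ∈ xs
  cycle-closed p y∈xs with arc-closed p y∈xs
  ... | inj₁ fy∈xs = fy∈xs
  cycle-closed (x ∷ p) y∈xs | inj₂ refl = here refl

  iterate-∈ : ∀ {x xs y} → Arc f x xs x → y ∈ xs → ∀ k → iterate f y k ∈ xs
  iterate-∈ p y∈xs zero    = y∈xs
  iterate-∈ p y∈xs (suc k) = iterate-∈ p (cycle-closed p y∈xs) k

  iterates-∈ : ∀ {x xs y z} → Arc f x xs x → y ∈ xs → ∀ k → z ∈ List.iterate f y k → z ∈ xs
  iterates-∈ p y∈xs (suc k) (here refl) = y∈xs
  iterates-∈ p y∈xs (suc k) (there z∈) = iterates-∈ p (cycle-closed p y∈xs) k z∈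

  arc⇒iterates : ∀ {x xs z y} k → Arc f x xs z → length xs ≤ k → y ∈ xs → y ∈ List.iterate f x k
  arc⇒iterates (suc k) (x ∷ p) (s≤s l) (here refl) = here refl
  arc⇒iterates (suc k) (x ∷ p) (s≤s l) (there y∈)  = there (arc⇒iterates k p l y∈)

  iterate-+ : ∀ x m n → iterate f x (m ℕ.+ n) ≡ iterate f (iterate f x m) n
  iterate-+ x zero    n = refl
  iterate-+ x (suc m) n = iterate-+ (f x) m n

  iterate-injective : (∀ {x y} → f x ≡ f y → x ≡ y) → ∀ k {x y} → iterate f x k ≡ iterate f y k → x ≡ y
  iterate-injective inj zero    eq = eq
  iterate-injective inj (suc k) eq = inj (iterate-injective inj k eq)

  -- A cycle is closed under `f`, so one that misses `x` contains no point from which `x` is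
  -- reached.
  arc-avoids : ∀ {x y xs z zs} → Arc f y xs x → All (x ≢_) zs → Arc f z zs z → y ∉ zs
  arc-avoids []      x∉zs q y∈zs = All.lookup x∉zs y∈zs refl
  arc-avoids (y ∷ p) x∉zs q y∈zs = arc-avoids p x∉zs q (cycle-closed q y∈zs)

  -- A repetition would close a cycle before the arc reaches `x`, which `arc-avoids` forbids.
  arc-unique : ∀ {x y xs} → Arc f y xs x → All (x ≢_) xs → Unique xs
  arc-unique     []             _            = []
  arc-unique {x} (_∷_ y {xs} p) (x≢y ∷ x∉xs) = All.tabulate y∉xs ∷ arc-unique p x∉xs
    where
    y∉xs : ∀ {z} → z ∈ xs → y ≢ z
    y∉xs z∈xs refl with ys , _ , refl ← ∈-∃++ z∈xs =
      arc-avoids (y ∷ p) (x≢y ∷ All.++⁻ˡ ys x∉xs) (y ∷ proj₁ (arc-split ys p)) (here refl)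

  -- Cutting the iteration at the first return makes the list free of repetitions; `k` bounds the
  -- search for that return.
  ∃-orbit : DecidableEquality A → ∀ {x} k → iterate f x (suc k) ≡ x →
            ∃[ xs ] Arc f x (x ∷ xs) x × Unique (x ∷ xs)
  ∃-orbit _≟_ {x} k fᵏx≡x = let xs , p , x∉xs = first-return (f x) k fᵏx≡x in
    xs , x ∷ p , x∉xs ∷ arc-unique p x∉xs
    where
    first-return : ∀ y k → iterate f y k ≡ x → ∃[ xs ] Arc f y xs x × All (x ≢_) xs
    first-return y k eq with x ≟ y
    first-return y k       eq | yes refl = [] , [] , []
    first-return y zero    eq | no x≢y = ⊥-elim (x≢y (sym eq))
    first-return y (suc k) eq | no x≢y with xs , p , x∉xs ← first-return (f y) k eq =
      y ∷ xs , y ∷ p , x≢y ∷ x∉xs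

module _ {A : Set} {n} (code : A → Fin n) (code-inj : ∀ {x y} → code x ≡ code y → x ≡ y)
         {f : A → A} (f-inj : ∀ {x y} → f x ≡ f y → x ≡ y) where

  -- The injection `code` expresses finiteness: two iterates coincide by the pigeonhole principle,
  -- and injectivity of `f` cancels the initial steps that they share.
  periodic : ∀ x → ∃[ k ] iterate f x (suc k) ≡ x
  periodic x with i , j , i<j , eq ← Fin.pigeonhole (ℕ.n<1+n n) (λ i → code (iterate f x (Fin.toℕ i)))
             with k , i+k≡j ← ℕ.m≤n⇒∃[o]m+o≡n i<j = k , sym (iterate-injective f-inj (Fin.toℕ i)
    (trans (code-inj eq) (trans (cong (iterate f x) (trans (sym i+k≡j) (cong suc (ℕ.+-comm (Fin.toℕ i) k))))
                                (iterate-+ {f = f} x (suc k) (Fin.toℕ i)))))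

allPairs-split : {A : Set} {R : A → A → Set} → ∀ xs {ys} → AllPairs R (xs ++ ys) →
                 AllPairs R xs × AllPairs R ys × All (λ x → All (R x) ys) xs
allPairs-split []       ps       = [] , ps , []
allPairs-split (x ∷ xs) (p ∷ ps) with qs , rs , ss ← allPairs-split xs ps =
  All.++⁻ˡ xs p ∷ qs , rs , All.++⁻ʳ xs p ∷ ss

-- Cyclic orders

-- The cyclic order induced by `<`: some rotation of the triple is increasing.
Cyc : ℕ → ℕ → ℕ → Set
Cyc a b c = (a < b × b < c) ⊎ (b < c × c < a) ⊎ (c < a × a < b)

cyc-rot : ∀ {a b c} → Cyc a b c → Cyc b c a
cyc-rot (inj₁ (p , q))        = inj₂ (inj₂ (p , q))
cyc-rot (inj₂ (inj₁ (p , q))) = inj₁ (p , q)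
cyc-rot (inj₂ (inj₂ (p , q))) = inj₂ (inj₁ (p , q))

cyc-asym : ∀ {a b c} → Cyc a b c → ¬ Cyc a c b
cyc-asym (inj₁ (p , q))        (inj₁ (r , s))        = ℕ.<-asym q s
cyc-asym (inj₁ (p , q))        (inj₂ (inj₁ (r , s))) = ℕ.<-asym p s
cyc-asym (inj₁ (p , q))        (inj₂ (inj₂ (r , s))) = ℕ.<-asym p r
cyc-asym (inj₂ (inj₁ (p , q))) (inj₁ (r , s))        = ℕ.<-asym p s
cyc-asym (inj₂ (inj₁ (p , q))) (inj₂ (inj₁ (r , s))) = ℕ.<-asym p r
cyc-asym (inj₂ (inj₁ (p , q))) (inj₂ (inj₂ (r , s))) = ℕ.<-asym q s
cyc-asym (inj₂ (inj₂ (p , q))) (inj₁ (r , s))        = ℕ.<-asym p r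
cyc-asym (inj₂ (inj₂ (p , q))) (inj₂ (inj₁ (r , s))) = ℕ.<-asym q s
cyc-asym (inj₂ (inj₂ (p , q))) (inj₂ (inj₂ (r , s))) = ℕ.<-asym p s

cyc-trans : ∀ {a b c d} → Cyc a b c → Cyc a c d → Cyc a b d
cyc-trans (inj₁ (p , q))        (inj₁ (r , s))        = inj₁ (p , ℕ.<-trans q s)
cyc-trans (inj₁ (p , q))        (inj₂ (inj₁ (r , s))) = ⊥-elim (ℕ.<-asym (ℕ.<-trans p q) (ℕ.<-trans r s))
cyc-trans (inj₁ (p , q))        (inj₂ (inj₂ (r , s))) = inj₂ (inj₂ (r , p))
cyc-trans (inj₂ (inj₁ (p , q))) (inj₁ (r , s))        = ⊥-elim (ℕ.<-asym q r)
cyc-trans (inj₂ (inj₁ (p , q))) (inj₂ (inj₁ (r , s))) = inj₂ (inj₁ (ℕ.<-trans p r , s))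
cyc-trans (inj₂ (inj₁ (p , q))) (inj₂ (inj₂ (r , s))) = ⊥-elim (ℕ.<-asym q s)
cyc-trans (inj₂ (inj₂ (p , q))) (inj₁ (r , s))        = ⊥-elim (ℕ.<-asym p r)
cyc-trans (inj₂ (inj₂ (p , q))) (inj₂ (inj₁ (r , s))) = inj₂ (inj₂ (s , q))
cyc-trans (inj₂ (inj₂ (p , q))) (inj₂ (inj₂ (r , s))) = ⊥-elim (ℕ.<-asym p s)

cyc-total : ∀ {a b c} → a ≢ b → b ≢ c → a ≢ c → Cyc a b c ⊎ Cyc a c b
cyc-total {a} {b} {c} a≢b b≢c a≢c with ℕ.<-cmp a b | ℕ.<-cmp b c | ℕ.<-cmp a c
... | tri≈ _ p _ | _ | _ = ⊥-elim (a≢b p)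
... | tri< _ _ _ | tri≈ _ p _ | _ = ⊥-elim (b≢c p)
... | tri> _ _ _ | tri≈ _ p _ | _ = ⊥-elim (b≢c p)
... | tri< _ _ _ | tri< _ _ _ | tri≈ _ p _ = ⊥-elim (a≢c p)
... | tri< _ _ _ | tri> _ _ _ | tri≈ _ p _ = ⊥-elim (a≢c p)
... | tri> _ _ _ | tri< _ _ _ | tri≈ _ p _ = ⊥-elim (a≢c p)
... | tri> _ _ _ | tri> _ _ _ | tri≈ _ p _ = ⊥-elim (a≢c p)
... | tri< p _ _ | tri< q _ _ | tri< _ _ _ = inj₁ (inj₁ (p , q))
... | tri< p _ _ | tri< q _ _ | tri> _ _ r = inj₁ (inj₁ (p , q))
... | tri< p _ _ | tri> _ _ q | tri< r _ _ = inj₂ (inj₁ (r , q))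
... | tri< p _ _ | tri> _ _ q | tri> _ _ r = inj₁ (inj₂ (inj₂ (r , p)))
... | tri> _ _ p | tri< q _ _ | tri< r _ _ = inj₂ (inj₂ (inj₂ (p , r)))
... | tri> _ _ p | tri< q _ _ | tri> _ _ r = inj₁ (inj₂ (inj₁ (q , r)))
... | tri> _ _ p | tri> _ _ q | tri< r _ _ = inj₂ (inj₁ (r , q))
... | tri> _ _ p | tri> _ _ q | tri> _ _ r = inj₂ (inj₂ (inj₁ (q , p)))

cyc? : ∀ a b c → Dec (Cyc a b c)
cyc? a b c = (a ℕ.<? b ×-dec b ℕ.<? c) ⊎-dec (b ℕ.<? c ×-dec c ℕ.<? a) ⊎-dec (c ℕ.<? a ×-dec a ℕ.<? b)

cyc-irrefl : ∀ {a b} → ¬ Cyc a b b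
cyc-irrefl (inj₁ (_ , q))        = ℕ.<-irrefl refl q
cyc-irrefl (inj₂ (inj₁ (p , _))) = ℕ.<-irrefl refl p
cyc-irrefl (inj₂ (inj₂ (p , q))) = ℕ.<-asym p q

module CyclicOrder {A : Set} (pos : A → ℕ) (pos-injective : ∀ {x y} → pos x ≡ pos y → x ≡ y) where

  -- A record rather than a synonym for Cyc, so that a, b and c can be inferred from its type
  record [_,_,_] (a b c : A) : Set where
    constructor cyc
    field increasing : Cyc (pos a) (pos b) (pos c)

  [_,_,_]? : ∀ a b c → Dec [ a , b , c ]
  [ a , b , c ]? = map′ cyc [_,_,_].increasing (cyc? (pos a) (pos b) (pos c))

  rot : ∀ {a b c} → [ a , b , c ] → [ b , c , a ]
  rot (cyc p) = cyc (cyc-rot p)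

  asym : ∀ {a b c} → [ a , b , c ] → ¬ [ a , c , b ]
  asym (cyc p) (cyc q) = cyc-asym p q

  total : ∀ {a b c} → a ≢ b → b ≢ c → a ≢ c → [ a , b , c ] ⊎ [ a , c , b ]
  total a≢b b≢c a≢c = Sum.map cyc cyc (cyc-total (a≢b ∘ pos-injective) (b≢c ∘ pos-injective) (a≢c ∘ pos-injective))

  ≢₂₃ : ∀ {a b c} → [ a , b , c ] → b ≢ c
  ≢₂₃ (cyc p) refl = cyc-irrefl p

  ≢₁₂ : ∀ {a b c} → [ a , b , c ] → a ≢ b
  ≢₁₂ p = ≢₂₃ (rot (rot p))

  ≢₁₃ : ∀ {a b c} → [ a , b , c ] → a ≢ c
  ≢₁₃ p = ≢₂₃ (rot p) ∘ sym

  -- The two hypotheses place `a`, `b`, `c`, `d` in this cyclic order; `abd` and `bcd` are named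
  -- after the two further triples that follow.
  abd : ∀ {a b c d} → [ a , b , c ] → [ a , c , d ] → [ a , b , d ]
  abd (cyc p) (cyc q) = cyc (cyc-trans p q)

  bcd : ∀ {a b c d} → [ a , b , c ] → [ a , c , d ] → [ b , c , d ]
  bcd p q = rot (rot (abd (rot q) (rot (rot p))))

  Sorted : List A → Set
  Sorted = AllPairs (λ x y → pos x < pos y)

  -- Cutting the circle open at `y` makes the cyclic order linear. Pairs within `ys`, within `xs`
  -- and across the old end are covered by the three clauses of `Cyc`.
  sorted-rotate : ∀ xs {y ys} → Sorted (xs ++ y ∷ ys) → AllPairs [ y ,_,_] (ys ++ xs)
  sorted-rotate xs {y} {ys} s with ss , y< ∷ ts , us ← allPairs-split xs s = AllPairs.++⁺
    (strengthenˡ (λ p q → cyc (inj₁ (p , q))) y< ts)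
    (strengthenʳ (λ p q → cyc (inj₂ (inj₁ (q , p)))) (All.map All.head us) ss)
    (All.map (λ y<b → All.map (λ a< → cyc (inj₂ (inj₂ (All.head a< , y<b)))) us) y<)
    where
    strengthenˡ : ∀ {P : A → Set} {R S : A → A → Set} → (∀ {a b} → P a → R a b → S a b) →
                    ∀ {xs} → All P xs → AllPairs R xs → AllPairs S xs
    strengthenˡ f []       []       = []
    strengthenˡ f (p ∷ ps) (r ∷ rs) = All.map (f p) r ∷ strengthenˡ f ps rs
    strengthenʳ : ∀ {P : A → Set} {R S : A → A → Set} → (∀ {a b} → P b → R a b → S a b) →
                    ∀ {xs} → All P xs → AllPairs R xs → AllPairs S xs
    strengthenʳ f []       []       = []
    strengthenʳ f (p ∷ ps) (r ∷ rs) = All.zipWith (λ (p , q) → f p q) (ps , r) ∷ strengthenʳ f ps rs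

module Darts (M : Multigraph) where
  open Multigraph M

  flip-flip : ∀ d → flip (flip d) ≡ d
  flip-flip (e , b) = cong (e ,_) (Bool.not-involutive b)

  flip-≢ : ∀ {d} → flip d ≢ d
  flip-≢ {e , false} ()
  flip-≢ {e , true}  ()

  dart-cases : ∀ x d → edge x ≡ edge d → x ≡ d ⊎ x ≡ flip d
  dart-cases (e , false) (.e , false) refl = inj₁ refl
  dart-cases (e , false) (.e , true)  refl = inj₂ refl
  dart-cases (e , true)  (.e , false) refl = inj₂ refl
  dart-cases (e , true)  (.e , true)  refl = inj₁ refl

-- Replacing and counting entries of lists

module _ {A : Set} {C C₁ C₂ : A} where

  all-replace : ∀ {P : A → Set} xs {ys} → All P (xs ++ C ∷ ys) → P C₁ → P C₂ → All P (xs ++ C₁ ∷ C₂ ∷ ys)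
  all-replace xs ps p₁ p₂ = All.++⁺ (All.++⁻ˡ xs ps) (p₁ ∷ p₂ ∷ All.tail (All.++⁻ʳ xs ps))

  any-replace : ∀ {P : A → Set} xs {ys} → Any P (xs ++ C ∷ ys) → (P C → P C₁ ⊎ P C₂) →
                Any P (xs ++ C₁ ∷ C₂ ∷ ys)
  any-replace xs p f with Any.++⁻ xs p
  ... | inj₁ p           = Any.++⁺ˡ p
  ... | inj₂ (there p)   = Any.++⁺ʳ xs (there (there p))
  ... | inj₂ (here p) with f p
  ...   | inj₁ p₁ = Any.++⁺ʳ xs (here p₁)
  ...   | inj₂ p₂ = Any.++⁺ʳ xs (there (here p₂))

  allPairs-replace : ∀ {R : A → A → Set} xs {ys} → AllPairs R (xs ++ C ∷ ys) → R C₁ C₂ →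
                     (∀ {D} → R D C → R D C₁ × R D C₂) → (∀ {D} → R C D → R C₁ D × R C₂ D) →
                     AllPairs R (xs ++ C₁ ∷ C₂ ∷ ys)
  allPairs-replace xs ps r fˡ fʳ with qs , q ∷ rs , ss ← allPairs-split xs ps =
    AllPairs.++⁺ qs ((r ∷ All.map (proj₁ ∘ fʳ) q) ∷ All.map (proj₂ ∘ fʳ) q ∷ rs)
      (All.map (λ s → proj₁ (fˡ (All.head s)) ∷ proj₂ (fˡ (All.head s)) ∷ All.tail s) ss)

any-split : ∀ {A : Set} {P : A → Set} {xs} → Any P xs → ∃[ as ] ∃[ x ] ∃[ bs ] P x × xs ≡ as ++ x ∷ bs
any-split (here p)  = [] , _ , _ , p , refl
any-split (there p) with as , x , bs , q , refl ← any-split p = _ ∷ as , x , bs , q , refl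

any-drop : ∀ {A : Set} {P : A → Set} as {x bs} → Any P (as ++ x ∷ bs) → ¬ P x → Any P (as ++ bs)
any-drop as p ¬Px with Any.++⁻ as p
... | inj₁ p         = Any.++⁺ˡ p
... | inj₂ (here p)  = ⊥-elim (¬Px p)
... | inj₂ (there p) = Any.++⁺ʳ as p

-- Pigeonhole principle for a relation: different entries of `xs` have no common partner, so the
-- partner of the head can be deleted from `ys` without depriving the tail.
relation⇒length≤ : ∀ {A B : Set} (R : A → B → Set) {xs : List A} (ys : List B) →
                   All (λ x → Any (R x) ys) xs →
                   AllPairs (λ x x′ → ∀ {y} → R x y → ¬ R x′ y) xs → length xs ≤ length ys
relation⇒length≤ R ys []       []       = z≤n
relation⇒length≤ R ys (p ∷ ps) (q ∷ qs) with as , y , bs , Rxy , refl ← any-split p = begin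
  suc _                       ≤⟨ s≤s (relation⇒length≤ R (as ++ bs) (All.zipWith (λ (a , b) → any-drop as a (b Rxy)) (ps , q)) qs) ⟩
  suc (length (as ++ bs))     ≡⟨ cong suc (length-++ as) ⟩
  suc (length as ℕ.+ length bs) ≡⟨ ℕ.+-suc (length as) (length bs) ⟨
  length as ℕ.+ suc (length bs) ≡⟨ length-++ as ⟨
  length (as ++ y ∷ bs)       ∎
  where open ℕ.≤-Reasoning

two-split : ∀ {A : Set} {a b : A} {xs} → a ∈ xs → b ∈ xs → a ≢ b →
            (∃[ ps ] ∃[ qs ] ∃[ rs ] xs ≡ ps ++ a ∷ qs ++ b ∷ rs) ⊎
            (∃[ ps ] ∃[ qs ] ∃[ rs ] xs ≡ ps ++ b ∷ qs ++ a ∷ rs)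
two-split (here refl) (here refl) a≢b = ⊥-elim (a≢b refl)
two-split (here refl) (there b∈)  a≢b with qs , rs , refl ← ∈-∃++ b∈ = inj₁ ([] , qs , rs , refl)
two-split (there a∈)  (here refl) a≢b with qs , rs , refl ← ∈-∃++ a∈ = inj₂ ([] , qs , rs , refl)
two-split (there a∈)  (there b∈)  a≢b with two-split a∈ b∈ a≢b
... | inj₁ (ps , qs , rs , refl) = inj₁ (_ ∷ ps , qs , rs , refl)
... | inj₂ (ps , qs , rs , refl) = inj₂ (_ ∷ ps , qs , rs , refl)

-- Splitting cycles by transpositions

module Splitting (M : Multigraph) (pos : Multigraph.Dart M → ℕ)
                 (pos-injective : ∀ {x y} → pos x ≡ pos y → x ≡ y) where

  open Multigraph M
  open Darts M
  open CyclicOrder pos pos-injective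

  swap : Edge → Dart → Dart
  swap e d = if does (e Fin.≟ edge d) then flip d else d

  swap-≡ : ∀ d → swap (edge d) d ≡ flip d
  swap-≡ d with edge d Fin.≟ edge d
  ... | yes _  = refl
  ... | no e≢e = ⊥-elim (e≢e refl)

  swap-≢ : ∀ {e} d → e ≢ edge d → swap e d ≡ d
  swap-≢ {e} d e≢ with e Fin.≟ edge d
  ... | yes e≡ = ⊥-elim (e≢ e≡)
  ... | no _   = refl

  swaps : List Edge → (Dart → Dart) → Dart → Dart
  swaps []       f = f
  swaps (e ∷ es) f = swaps es (f ∘ swap e)

  swaps-∉ : ∀ es f {d} → edge d ∉ es → swaps es f d ≡ f d
  swaps-∉ []       f     d∉ = refl
  swaps-∉ (e ∷ es) f {d} d∉ = trans (swaps-∉ es (f ∘ swap e) (d∉ ∘ there))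
                                    (cong f (swap-≢ d (λ e≡ → d∉ (here (sym e≡)))))

  swaps-∈ : ∀ es f {d} → Unique es → edge d ∈ es → swaps es f d ≡ f (flip d)
  swaps-∈ (_ ∷ es) f {d} (e∉ ∷ _)   (here refl) =
    trans (swaps-∉ es _ (λ d∈ → All.lookup e∉ d∈ refl)) (cong f (swap-≡ d))
  swaps-∈ (e ∷ es) f {d} (e∉ ∷ es!) (there d∈)  =
    trans (swaps-∈ es _ es! d∈) (cong f (swap-≢ (flip d) (All.lookup e∉ d∈)))

  -- With the darts placed on a circle by `pos` and each edge drawn as a chord between its two
  -- darts, no two chords intersect.
  NonCrossing : List Edge → Set
  NonCrossing es = ∀ d x → edge d ∈ es → edge x ∈ es → edge d ≢ edge x →
                   ¬ ([ d , x , flip d ] × [ flip d , flip x , d ])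

  sorted-≢ : ∀ xs {y ys} → Sorted (xs ++ y ∷ ys) → (∀ {x} → x ∈ xs → x ≢ y) × (∀ {x} → x ∈ ys → x ≢ y)
  sorted-≢ xs s with _ , y< ∷ _ , xs< ← allPairs-split xs s =
    (λ { x∈ refl → ℕ.<-irrefl refl (All.head (All.lookup xs< x∈)) }) ,
    (λ { x∈ refl → ℕ.<-irrefl refl (All.lookup y< x∈) })

  IsCycle : (Dart → Dart) → List Dart → Set
  IsCycle f C = ∃[ x ] Arc f x C x × ∃[ y ] y ∈ C

  -- Invariant of the splitting, where `es` lists the edges still to be swapped. By `paired` each
  -- further transposition meets both its darts on one cycle, so that it splits this cycle and
  -- merges nothing; `sorted` ties the order of listing to the cyclic order in which crossing is
  -- expressed.
  record Decomposition (f : Dart → Dart) (es : List Edge) (Cs : List (List Dart)) : Set where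
    field
      cycles   : All (IsCycle f) Cs
      sorted   : All Sorted Cs
      complete : ∀ x → Any (x ∈_) Cs
      disjoint : AllPairs Disjoint Cs
      paired   : ∀ {x} → edge x ∈ es → All (λ C → x ∈ C → flip x ∈ C) Cs

  isCycle-swap : ∀ {f d C} → d ∉ C → flip d ∉ C → IsCycle f C → IsCycle (f ∘ swap (edge d)) C
  isCycle-swap {f} {d} {C} d∉ fd∉ (x , p , y) = x , arc-cong (All.tabulate same) p , y
    where
    same : ∀ {z} → z ∈ C → f z ≡ f (swap (edge d) z)
    same {z} z∈ = cong f (sym (swap-≢ z λ eq → case-⊥ (dart-cases z d (sym eq))))
      where
      case-⊥ : ¬ (z ≡ d ⊎ z ≡ flip d)
      case-⊥ (inj₁ refl) = d∉ z∈
      case-⊥ (inj₂ refl) = fd∉ z∈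

  -- Composing a permutation with the transposition of d and flip d splits a cycle through both.
  module SplitCycle {f : Dart → Dart} {d : Dart} {ps qs rs : List Dart} where

    C C₁ C₂ : List Dart
    C  = ps ++ d ∷ qs ++ flip d ∷ rs
    C₁ = ps ++ d ∷ rs
    C₂ = qs ++ flip d ∷ []

    f′ : Dart → Dart
    f′ = f ∘ swap (edge d)

    C₁⊆C : ∀ {x} → x ∈ C₁ → x ∈ C
    C₁⊆C x∈ with ∈-++⁻ ps x∈
    ... | inj₁ x∈ps         = ∈-++⁺ˡ x∈ps
    ... | inj₂ (here x≡)    = ∈-++⁺ʳ ps (here x≡)
    ... | inj₂ (there x∈rs) = ∈-++⁺ʳ ps (there (∈-++⁺ʳ qs (there x∈rs)))

    C₂⊆C : ∀ {x} → x ∈ C₂ → x ∈ C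
    C₂⊆C x∈ with ∈-++⁻ qs x∈
    ... | inj₁ x∈qs       = ∈-++⁺ʳ ps (there (∈-++⁺ˡ x∈qs))
    ... | inj₂ (here x≡)  = ∈-++⁺ʳ ps (there (∈-++⁺ʳ qs (here x≡)))

    C⊆C₁∪C₂ : ∀ {x} → x ∈ C → x ∈ C₁ ⊎ x ∈ C₂
    C⊆C₁∪C₂ x∈ with ∈-++⁻ ps x∈
    ... | inj₁ x∈ps      = inj₁ (∈-++⁺ˡ x∈ps)
    ... | inj₂ (here x≡) = inj₁ (∈-++⁺ʳ ps (here x≡))
    ... | inj₂ (there x∈′) with ∈-++⁻ qs x∈′
    ...   | inj₁ x∈qs         = inj₂ (∈-++⁺ˡ x∈qs)
    ...   | inj₂ (here x≡)    = inj₂ (∈-++⁺ʳ qs (here x≡))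
    ...   | inj₂ (there x∈rs) = inj₁ (∈-++⁺ʳ ps (there x∈rs))

    module _ (s : Sorted C) where

      C₁-sorted : Sorted C₁
      C₁-sorted with sp , d< ∷ sq , p< ← allPairs-split ps s with _ , _ ∷ sr , _ ← allPairs-split qs sq =
        AllPairs.++⁺ sp (All.tail (All.++⁻ʳ qs d<) ∷ sr)
          (All.map (λ x< → All.head x< ∷ All.tail (All.++⁻ʳ qs (All.tail x<))) p<)

      C₂-sorted : Sorted C₂
      C₂-sorted with _ , _ ∷ sq , _ ← allPairs-split ps s with sq′ , _ , q< ← allPairs-split qs sq =
        AllPairs.++⁺ sq′ ([] ∷ []) (All.map (λ x< → All.head x< ∷ []) q<)

      around-d : AllPairs [ d ,_,_] ((qs ++ flip d ∷ rs) ++ ps)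
      around-d = sorted-rotate ps s

      -- The two new cycles occupy the two arcs into which `d` and `flip d` divide the circle.
      C₂-between : ∀ {x} → x ∈ C₂ → x ≡ flip d ⊎ [ d , x , flip d ]
      C₂-between x∈ with ∈-++⁻ qs x∈
      ... | inj₂ (here x≡) = inj₁ x≡
      ... | inj₁ x∈qs with a , _ , _ ← allPairs-split (qs ++ flip d ∷ rs) around-d
                      with _ , _ , q ← allPairs-split qs a = inj₂ (All.head (All.lookup q x∈qs))

      C₁-between : ∀ {x} → x ∈ C₁ → x ≡ d ⊎ [ flip d , x , d ]
      C₁-between x∈ with a , _ , q ← allPairs-split (qs ++ flip d ∷ rs) around-d
                    with ∈-++⁻ ps x∈
      ... | inj₂ (here x≡)    = inj₁ x≡
      ... | inj₁ x∈ps         = inj₂ (rot (All.lookup (All.lookup q (∈-++⁺ʳ qs (here refl))) x∈ps))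
      ... | inj₂ (there x∈rs) with _ , r ∷ _ , _ ← allPairs-split qs a = inj₂ (rot (All.lookup r x∈rs))

      C₁-C₂-disjoint : Disjoint C₁ C₂
      C₁-C₂-disjoint (x∈₁ , x∈₂) with C₁-between x∈₁ | C₂-between x∈₂
      ... | inj₁ refl | inj₁ eq = flip-≢ (sym eq)
      ... | inj₁ refl | inj₂ p  = ≢₁₂ p refl
      ... | inj₂ p    | inj₁ eq = ≢₁₂ p (sym eq)
      ... | inj₂ p    | inj₂ q  = asym p (rot (rot q))

      private
        d∈C₁ : d ∈ C₁
        d∈C₁ = ∈-++⁺ʳ ps (here refl)

        fd∈C₂ : flip d ∈ C₂
        fd∈C₂ = ∈-++⁺ʳ qs (here refl)

        unchanged : ∀ {ys} → (∀ {x} → x ∈ ys → x ≢ d × x ≢ flip d) → All (λ x → f x ≡ f′ x) ys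
        unchanged {ys} avoid = All.tabulate λ {x} x∈ → cong f (sym (swap-≢ x λ eq → go x∈ (dart-cases x d (sym eq))))
          where
          go : ∀ {x} → x ∈ ys → ¬ (x ≡ d ⊎ x ≡ flip d)
          go x∈ (inj₁ eq) = proj₁ (avoid x∈) eq
          go x∈ (inj₂ eq) = proj₂ (avoid x∈) eq

        C₁-avoids : ∀ {x} → x ∈ C₁ → x ≢ flip d
        C₁-avoids x∈ refl = C₁-C₂-disjoint (x∈ , fd∈C₂)

        C₂-avoids : ∀ {x} → x ∈ C₂ → x ≢ d
        C₂-avoids x∈ refl = C₁-C₂-disjoint (d∈C₁ , x∈)

        f′-d : f (flip d) ≡ f′ d
        f′-d = cong f (sym (swap-≡ d))

        f′-fd : f d ≡ f′ (flip d)
        f′-fd = cong f (sym (trans (swap-≡ (flip d)) (flip-flip d)))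

      C₁-cycle : IsCycle f C → IsCycle f′ C₁
      C₁-cycle (x , p , _) with a , b ← arc-split ps p with _ , c ← arc-split qs b =
        x , arc-++ (arc-cong (unchanged λ x∈ → proj₁ (sorted-≢ ps C₁-sorted) x∈ , C₁-avoids (∈-++⁺ˡ x∈)) a)
                   (d ∷ subst (λ y → Arc f′ y rs x) f′-d
                          (arc-cong (unchanged λ x∈ → proj₂ (sorted-≢ ps C₁-sorted) x∈
                                                    , C₁-avoids (∈-++⁺ʳ ps (there x∈))) c))
          , d , d∈C₁

      C₂-cycle : IsCycle f C → IsCycle f′ C₂
      C₂-cycle (x , p , _) with _ , b ← arc-split ps p with c , _ ← arc-split qs b =
        -- After the swap, `d` and `flip d` exchange successors, so the second cycle begins at the
        -- old successor of `d`.
        f d , arc-++ (arc-cong (unchanged λ x∈ → C₂-avoids (∈-++⁺ˡ x∈) , proj₁ (sorted-≢ qs C₂-sorted) x∈) c)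
                     (flip d ∷ subst (λ y → Arc f′ y [] (f d)) f′-fd [])
            , flip d , fd∈C₂

  split-cycle : ∀ {f es d} ps qs rs Xs Ys → let Cs = Xs ++ (ps ++ d ∷ qs ++ flip d ∷ rs) ∷ Ys in
                Decomposition f (edge d ∷ es) Cs → NonCrossing (edge d ∷ es) → edge d ∉ es →
                Decomposition (f ∘ swap (edge d)) es (Xs ++ (ps ++ d ∷ rs) ∷ (qs ++ flip d ∷ []) ∷ Ys)
  split-cycle {f} {es} {d} ps qs rs Xs Ys D nc d∉es = record
    { cycles   = let cX , cCY = All.++⁻ Xs cycles in
        All.++⁺ (All.zipWith (λ (dj , c) → isCycle-swap (λ d∈ → dj (d∈ , d∈C)) (λ fd∈ → dj (fd∈ , fd∈C)) c)
                             (All.map All.head X-CY , cX))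
                (C₁-cycle (All.head cCY) ∷ C₂-cycle (All.head cCY) ∷
                 All.zipWith (λ (dj , c) → isCycle-swap (λ d∈ → dj (d∈C , d∈)) (λ fd∈ → dj (fd∈C , fd∈)) c)
                             (C-Y , All.tail cCY))
    ; sorted   = all-replace Xs sorted (C₁-sorted sC) (C₂-sorted sC)
    ; complete = λ x → any-replace Xs (complete x) C⊆C₁∪C₂
    ; disjoint = allPairs-replace Xs disjoint (C₁-C₂-disjoint sC)
        (λ dj → (λ (p , q) → dj (p , C₁⊆C q)) , (λ (p , q) → dj (p , C₂⊆C q)))
        (λ dj → (λ (p , q) → dj (C₁⊆C p , q)) , (λ (p , q) → dj (C₂⊆C p , q)))
    ; paired   = λ x∈es → all-replace Xs (paired (there x∈es)) (paired₁ x∈es) (paired₂ x∈es)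
    }
    where
    open Decomposition D
    open module S = SplitCycle {f} {d} {ps} {qs} {rs} hiding (C₁-cycle; C₂-cycle)

    sC : Sorted C
    sC = All.head (All.++⁻ʳ Xs sorted)

    C₁-cycle = S.C₁-cycle sC
    C₂-cycle = S.C₂-cycle sC

    C-Y : All (Disjoint C) Ys
    C-Y with _ , q ∷ _ , _ ← allPairs-split Xs disjoint = q

    X-CY : All (λ X → All (Disjoint X) (C ∷ Ys)) Xs
    X-CY with _ , _ , q ← allPairs-split Xs disjoint = q

    d∈C : d ∈ C
    d∈C = C₁⊆C (∈-++⁺ʳ ps (here refl))

    fd∈C : flip d ∈ C
    fd∈C = C₂⊆C (∈-++⁺ʳ qs (here refl))

    ≢-edge : ∀ x → edge x ∈ es → edge d ≢ edge x
    ≢-edge _ x∈es refl = d∉es x∈es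

    -- An edge with one dart on each piece would cross `edge d`.
    separated : ∀ {x} → edge x ∈ es → ¬ (x ∈ C₂ × flip x ∈ C₁)
    separated {x} x∈es (x∈ , fx∈) with C₂-between sC x∈ | C₁-between sC fx∈
    ... | inj₁ refl | _         = ≢-edge x x∈es refl
    ... | inj₂ _    | inj₁ refl = ≢-edge x x∈es refl
    ... | inj₂ p    | inj₂ q    = nc d _ (here refl) (there x∈es) (≢-edge x x∈es) (p , q)

    paired₁ : ∀ {x} → edge x ∈ es → x ∈ C₁ → flip x ∈ C₁
    paired₁ {x} x∈es x∈ with C⊆C₁∪C₂ (All.head (All.++⁻ʳ Xs (paired {x} (there x∈es))) (C₁⊆C x∈))
    ... | inj₁ fx∈ = fx∈
    ... | inj₂ fx∈ = ⊥-elim (separated {flip x} x∈es (fx∈ , subst (_∈ C₁) (sym (flip-flip x)) x∈))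

    paired₂ : ∀ {x} → edge x ∈ es → x ∈ C₂ → flip x ∈ C₂
    paired₂ {x} x∈es x∈ with C⊆C₁∪C₂ (All.head (All.++⁻ʳ Xs (paired {x} (there x∈es))) (C₂⊆C x∈))
    ... | inj₁ fx∈ = ⊥-elim (separated {x} x∈es (x∈ , fx∈))
    ... | inj₂ fx∈ = fx∈

  length-replace : ∀ {A : Set} (xs : List A) {c c₁ c₂ ys} →
                   length (xs ++ c₁ ∷ c₂ ∷ ys) ≡ suc (length (xs ++ c ∷ ys))
  length-replace []       = refl
  length-replace (x ∷ xs) = cong suc (length-replace xs)

  -- Each transposition replaces one cycle by two, and noncrossing keeps the two darts of every
  -- remaining edge together.
  decompose : ∀ {f} es {Cs} → Decomposition f es Cs → NonCrossing es → Unique es →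
              ∃[ Cs′ ] Decomposition (swaps es f) [] Cs′ × length Cs′ ≡ length es ℕ.+ length Cs
  decompose []       {Cs} D nc _ = Cs , D , refl
  decompose {f} (e ∷ es) D nc (e∉es ∷ es!)
    with Xs , C , Ys , d∈C , refl ← any-split (Decomposition.complete D (e , false)) =
    go (two-split d∈C (All.head (All.++⁻ʳ Xs (Decomposition.paired D (here refl))) d∈C) (λ ()))
    where
    Splits : Dart → Set
    Splits d = ∃[ ps ] ∃[ qs ] ∃[ rs ] C ≡ ps ++ d ∷ qs ++ flip d ∷ rs

    Result : Set
    Result = ∃[ Cs′ ] Decomposition (swaps es (f ∘ swap e)) [] Cs′ × length Cs′ ≡ suc (length es ℕ.+ length (Xs ++ C ∷ Ys))

    continue : ∀ (d : Dart) → edge d ≡ e → Splits d → Result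
    continue d refl (ps , qs , rs , refl)
      with Cs′ , D′ , l ← decompose es (split-cycle ps qs rs Xs Ys D nc (λ e∈ → All.lookup e∉es e∈ refl))
                            (λ d x d∈ x∈ → nc d x (there d∈) (there x∈)) es! =
      Cs′ , D′ , trans l (trans (cong (length es ℕ.+_) (length-replace Xs)) (ℕ.+-suc (length es) _))

    go : Splits (e , false) ⊎ Splits (e , true) → Result
    go (inj₁ split) = continue (e , false) refl split
    go (inj₂ split) = continue (e , true) refl split

-- Forests and cuts

module Walks (M : Multigraph) where
  open Multigraph M
  open Darts M

  Conn : (Edge → Set) → Vertex → Vertex → Set
  Conn P u v = ∃[ ds ] Walk M u ds v × All (P ∘ edge) ds

  walk-++ : ∀ {u v w as bs} → Walk M u as v → Walk M v bs w → Walk M u (as ++ bs) w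
  walk-++ []      q = q
  walk-++ (d ∷ p) q = d ∷ walk-++ p q

  walk-split : ∀ {u v} as {d bs} → Walk M u (as ++ d ∷ bs) v → Walk M u as (tail d) × Walk M (head d) bs v
  walk-split []       (_ ∷ p) = [] , p
  walk-split (_ ∷ as) (x ∷ p) with q , r ← walk-split as p = x ∷ q , r

  walk-start : ∀ {u v ds} → Walk M u ds v → u ≡ v ⊎ (∃[ y ] y ∈ ds × tail y ≡ u)
  walk-start []      = inj₁ refl
  walk-start (y ∷ _) = inj₂ (y , here refl , refl)

  walk-next : ∀ {u v ds x} → Walk M u ds v → x ∈ ds → head x ≡ v ⊎ (∃[ y ] y ∈ ds × tail y ≡ head x)
  walk-next {v = v} {x = x} p x∈ with as , bs , refl ← ∈-∃++ x∈ = go (walk-start (proj₂ (walk-split as p)))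
    where
    go : head x ≡ v ⊎ (∃[ y ] y ∈ bs × tail y ≡ head x) → head x ≡ v ⊎ (∃[ y ] y ∈ as ++ x ∷ bs × tail y ≡ head x)
    go (inj₁ eq)            = inj₁ eq
    go (inj₂ (y , y∈ , eq)) = inj₂ (y , ∈-++⁺ʳ as (there y∈) , eq)

  conn-trans : ∀ {P u v w} → Conn P u v → Conn P v w → Conn P u w
  conn-trans (_ , p , ps) (_ , q , qs) = _ , walk-++ p q , All.++⁺ ps qs

  conn-map : ∀ {P Q : Edge → Set} {u v} → (∀ {e} → P e → Q e) → Conn P u v → Conn Q u v
  conn-map f (_ , p , ps) = _ , p , All.map f ps

  conn-dart : ∀ {P : Edge → Set} d → P (edge d) → Conn P (tail d) (head d)
  conn-dart d Pd = _ , d ∷ [] , Pd ∷ []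

  conn-invariant : ∀ {A : Set} (P : Edge → Set) (lab : Vertex → A) →
                   (∀ d → P (edge d) → lab (tail d) ≡ lab (head d)) → ∀ {u v} → Conn P u v → lab u ≡ lab v
  conn-invariant P lab inv (_ , []    , [])      = refl
  conn-invariant P lab inv (_ , d ∷ p , Pd ∷ ps) = trans (inv d Pd) (conn-invariant P lab inv (_ , p , ps))

  Distinct : {A : Set} → (Dart → A) → List Dart → Set
  Distinct f = AllPairs (λ x y → f x ≢ f y)

  record SimplePath (P : Edge → Set) (u v : Vertex) : Set where
    field
      path          : List Dart
      walk          : Walk M u path v
      along         : All (P ∘ edge) path
      distinctEdges : Distinct edge path
      distinctTails : Distinct tail path
      avoidsEnd     : All (λ x → tail x ≢ v) path

  -- Loop erasure: when a dart is put in front of a simple path, the path is emptied if the dart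
  -- starts at the end vertex, and it is cut back to its own visit of `tail d` if there is one.
  simplify : ∀ {P u v} → Conn P u v → SimplePath P u v
  simplify (_ , [] , []) = record
    { path = [] ; walk = [] ; along = [] ; distinctEdges = [] ; distinctTails = [] ; avoidsEnd = [] }
  simplify {P} {_} {v} (_ , d ∷ p , Pd ∷ ps) = extend (simplify (_ , p , ps))
    where
    extend : SimplePath P (head d) v → SimplePath P (tail d) v
    extend sp with tail d Fin.≟ v | any? (λ x → tail x Fin.≟ tail d) (SimplePath.path sp)
    ... | yes refl | _ = record
      { path = [] ; walk = [] ; along = [] ; distinctEdges = [] ; distinctTails = [] ; avoidsEnd = [] }
    ... | no d≢v | no d∉ = record
      { path          = d ∷ path
      ; walk          = d ∷ walk
      ; along         = Pd ∷ along
      ; distinctEdges = All.tabulate new-edge ∷ distinctEdges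
      ; distinctTails = All.tabulate (λ x∈ eq → d∉ (Any.map (λ { refl → sym eq }) x∈)) ∷ distinctTails
      ; avoidsEnd     = d≢v ∷ avoidsEnd
      }
      where
      open SimplePath sp
      -- A path containing `flip d` would go on from `tail d` or end there, and both have been
      -- excluded.
      new-edge : ∀ {x} → x ∈ path → edge d ≢ edge x
      new-edge {x} x∈ eq with dart-cases d x eq
      ... | inj₁ refl = d∉ (Any.map (λ { refl → refl }) x∈)
      ... | inj₂ refl with walk-next walk x∈
      ...   | inj₁ hx≡v            = d≢v hx≡v
      ...   | inj₂ (y , y∈ , ty≡) = d∉ (Any.map (λ { refl → ty≡ }) y∈)
    ... | no d≢v | yes d∈ = shortcut sp (any-split d∈)
      where
      shortcut : (sp : SimplePath P (head d) v) →
                 ∃[ as ] ∃[ x ] ∃[ bs ] tail x ≡ tail d × SimplePath.path sp ≡ as ++ x ∷ bs →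
                 SimplePath P (tail d) v
      shortcut record { path = _ ; walk = w ; along = al ; distinctEdges = de ; distinctTails = dt ; avoidsEnd = ae }
               (as , x , bs , tx≡ , refl) = record
        { path          = x ∷ bs
        ; walk          = subst (λ u → Walk M u (x ∷ bs) v) tx≡ (x ∷ proj₂ (walk-split as w))
        ; along         = All.++⁻ʳ as al
        ; distinctEdges = proj₁ (proj₂ (allPairs-split as de))
        ; distinctTails = proj₁ (proj₂ (allPairs-split as dt))
        ; avoidsEnd     = All.++⁻ʳ as ae
        }

  path⇒cycle : ∀ {P} d → ¬ P (edge d) → SimplePath P (head d) (tail d) →
               ∃[ ds ] Cycle M (d ∷ ds) × All (P ∘ edge) ds
  path⇒cycle {P} d ¬Pd sp = path , record
    { nonEmpty         = λ ()
    ; basepoint        = tail d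
    ; closed           = d ∷ walk
    ; distinctEdges    = AllPairs.map⁺ {xs = d ∷ path} (All.map (λ {x} → new-edge {x}) along ∷ distinctEdges)
    ; distinctVertices = AllPairs.map⁺ (All.map (λ x≢ → x≢ ∘ sym) avoidsEnd ∷ distinctTails)
    } , along
    where
    open SimplePath sp
    new-edge : ∀ {x : Dart} → P (edge x) → edge d ≢ edge x
    new-edge Px eq = ¬Pd (subst P (sym eq) Px)

  cycle-remainder : ∀ {P ds d} → Cycle M ds → d ∈ ds → (∀ {x} → x ∈ ds → edge x ≢ edge d → P (edge x)) →
                    Conn P (head d) (tail d)
  cycle-remainder c d∈ f with as , bs , refl ← ∈-∃++ d∈
    with q , r ← walk-split as (Cycle.closed c)
    with _ , d≢ ∷ _ , as≢ ← allPairs-split as (AllPairs.map⁻ (Cycle.distinctEdges c)) =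
    _ , walk-++ r q , All.++⁺
      (All.tabulate λ x∈ → f (∈-++⁺ʳ as (there x∈)) (All.lookup d≢ x∈ ∘ sym))
      (All.tabulate λ x∈ → f (∈-++⁺ˡ x∈) (All.head (All.lookup as≢ x∈)))

  -- The union-find invariant: `label` is constant on the components of `fs` and tells them apart.
  record Forest (fs : List Edge) : Set where
    field
      label    : Vertex → Vertex
      sound    : ∀ {u v} → label u ≡ label v → Conn (_∈ fs) u v
      complete : ∀ d → edge d ∈ fs → label (tail d) ≡ label (head d)
      acyclic  : ∀ ds → Cycle M ds → ¬ All (λ d → edge d ∈ fs) ds

  discrete : Forest []
  discrete = record
    { label = λ v → v ; sound = λ { refl → [] , [] , [] } ; complete = λ _ () ; acyclic = no-cycle }
    where
    no-cycle : ∀ ds → Cycle M ds → ¬ All (λ d → edge d ∈ []) ds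
    no-cycle []      c _        = Cycle.nonEmpty c refl
    no-cycle (_ ∷ _) c (() ∷ _)

  addEdge : ∀ {fs} e (F : Forest fs) → let open Forest F in
            label (end e false) ≢ label (end e true) → Forest (e ∷ fs)
  addEdge {fs} e F a≢b = record { label = label′ ; sound = sound′ ; complete = complete′ ; acyclic = acyclic′ }
    where
    open Forest F
    a = end e false
    b = end e true

    label′ : Vertex → Vertex
    label′ v = if does (label v Fin.≟ label b) then label a else label v

    weaken : ∀ {u v} → Conn (_∈ fs) u v → Conn (_∈ e ∷ fs) u v
    weaken = conn-map there

    sound′ : ∀ {u v} → label′ u ≡ label′ v → Conn (_∈ e ∷ fs) u v
    sound′ {u} {v} eq with label u Fin.≟ label b | label v Fin.≟ label b
    ... | yes u≡b | yes v≡b = weaken (sound (trans u≡b (sym v≡b)))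
    ... | yes u≡b | no  _   = conn-trans (weaken (sound u≡b))
                                (conn-trans (conn-dart (e , true) (here refl)) (weaken (sound eq)))
    ... | no  _   | yes v≡b = conn-trans (weaken (sound eq))
                                (conn-trans (conn-dart (e , false) (here refl)) (weaken (sound (sym v≡b))))
    ... | no  _   | no  _   = weaken (sound eq)

    label′-b : ∀ {v} → label v ≡ label b → label′ v ≡ label a
    label′-b {v} eq with label v Fin.≟ label b
    ... | yes _  = refl
    ... | no v≢b = ⊥-elim (v≢b eq)

    label′-a : label′ a ≡ label a
    label′-a with label a Fin.≟ label b
    ... | yes eq = refl
    ... | no _   = refl

    complete′ : ∀ d → edge d ∈ e ∷ fs → label′ (tail d) ≡ label′ (head d)
    complete′ d           (there d∈)  = cong (λ l → if does (l Fin.≟ label b) then label a else l) (complete d d∈)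
    complete′ (e , false) (here refl) = trans label′-a (sym (label′-b refl))
    complete′ (e , true)  (here refl) = trans (label′-b refl) (sym label′-a)

    ends-≢ : ∀ d → edge d ≡ e → label (head d) ≢ label (tail d)
    ends-≢ (e , false) refl eq = a≢b (sym eq)
    ends-≢ (e , true)  refl eq = a≢b eq

    acyclic′ : ∀ ds → Cycle M ds → ¬ All (λ d → edge d ∈ e ∷ fs) ds
    acyclic′ ds c ds⊆ with any? (λ d → edge d Fin.≟ e) ds
    ... | no e∉ = acyclic ds c (All.tabulate λ x∈ → old x∈ (All.lookup ds⊆ x∈))
      where
      old : ∀ {x} → x ∈ ds → edge x ∈ e ∷ fs → edge x ∈ fs
      old x∈ (here eq)  = ⊥-elim (e∉ (Any.map (λ { refl → eq }) x∈))
      old x∈ (there x∈fs) = x∈fs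
    -- The rest of a cycle through `e` would join the ends of `e` within `fs`, where their labels
    -- differ.
    ... | yes e∈ with _ , d , _ , refl , refl ← any-split e∈ =
      ends-≢ d refl (conn-invariant (_∈ fs) label complete
        (cycle-remainder c (∈-++⁺ʳ _ (here refl)) λ x∈ x≢ → old x≢ (All.lookup ds⊆ x∈)))
      where
      old : ∀ {x} → x ≢ e → x ∈ e ∷ fs → x ∈ fs
      old x≢e (here eq)    = ⊥-elim (x≢e eq)
      old x≢e (there x∈fs) = x∈fs

  -- Kruskal's algorithm
  grow : ∀ es {fs} → Forest fs → ∃[ fs′ ] Σ[ F ∈ Forest fs′ ]
         (∀ {e} → e ∈ fs → e ∈ fs′) × (∀ {e} → e ∈ fs′ → e ∈ es ⊎ e ∈ fs) ×
         (∀ d → edge d ∈ es → Forest.label F (tail d) ≡ Forest.label F (head d))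
  grow []       {fs} F = fs , F , (λ e∈ → e∈) , inj₂ , λ _ ()
  grow (e ∷ es) {fs} F with Forest.label F (end e false) Fin.≟ Forest.label F (end e true)
  ... | yes eq with fs′ , F′ , fs⊆ , ⊆es , joined ← grow es F =
    fs′ , F′ , fs⊆ , (λ e∈ → there′ (⊆es e∈)) , joined′
    where
    there′ : ∀ {x} → x ∈ es ⊎ x ∈ fs → x ∈ e ∷ es ⊎ x ∈ fs
    there′ (inj₁ x∈) = inj₁ (there x∈)
    there′ (inj₂ x∈) = inj₂ x∈
    ends : Forest.label F′ (end e false) ≡ Forest.label F′ (end e true)
    ends = conn-invariant (_∈ fs′) (Forest.label F′) (Forest.complete F′) (conn-map fs⊆ (Forest.sound F eq))
    joined′ : ∀ d → edge d ∈ e ∷ es → Forest.label F′ (tail d) ≡ Forest.label F′ (head d)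
    joined′ (e , false) (here refl) = ends
    joined′ (e , true)  (here refl) = sym ends
    joined′ d           (there d∈)  = joined d d∈
  ... | no neq with fs′ , F′ , fs⊆ , ⊆es , joined ← grow es (addEdge e F neq) =
    fs′ , F′ , (λ e∈ → fs⊆ (there e∈)) , (λ e∈ → there′ (⊆es e∈)) , joined′
    where
    there′ : ∀ {x} → x ∈ es ⊎ x ∈ e ∷ fs → x ∈ e ∷ es ⊎ x ∈ fs
    there′ (inj₁ x∈)         = inj₁ (there x∈)
    there′ (inj₂ (here x≡))  = inj₁ (here x≡)
    there′ (inj₂ (there x∈)) = inj₂ x∈
    joined′ : ∀ d → edge d ∈ e ∷ es → Forest.label F′ (tail d) ≡ Forest.label F′ (head d)
    joined′ d (here refl) = Forest.complete F′ d (fs⊆ (here refl))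
    joined′ d (there d∈)  = joined d d∈

  module Cut (T : SpanningTree M) where
    open SpanningTree T

    Rest : Edge → Edge → Set
    Rest e f = f Subset.∈ edges × f ≢ e

    rest? : ∀ e f → Dec (Rest e f)
    rest? e f = (f ∈? edges) ×-dec ¬? (f Fin.≟ e)

    -- The fundamental cut of `e`: `side` labels the components of the tree without `e`. If the ends
    -- of `e` had the same label, a simple path between them would close up with `e` to a cycle in
    -- the tree.
    cut : ∀ e → e Subset.∈ edges → Σ[ side ∈ (Vertex → Vertex) ]
          (∀ d → edge d Subset.∈ edges → edge d ≢ e → side (tail d) ≡ side (head d)) ×
          (∀ d → edge d ≡ e → side (tail d) ≢ side (head d))
    cut e e∈ with fs , F , _ , ⊆es , joined ← grow (filter (rest? e) (allFin #E)) discrete =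
      Forest.label F ,
      (λ d d∈ d≢e → joined d (∈-filter⁺ (rest? e) {xs = allFin #E} (∈-allFin (edge d)) (d∈ , d≢e))) ,
      separates
      where
      rest : ∀ {f} → f ∈ fs → Rest e f
      rest f∈ with ⊆es f∈
      ... | inj₁ f∈es = proj₂ (∈-filter⁻ (rest? e) {xs = allFin #E} f∈es)
      separates : ∀ d → edge d ≡ e → Forest.label F (tail d) ≢ Forest.label F (head d)
      separates d refl eq
        with ds , c , ds⊆ ← path⇒cycle {Rest e} d (λ (_ , d≢d) → d≢d refl)
                              (simplify (conn-map rest (Forest.sound F (sym eq)))) =
        acyclic (d ∷ ds) c (e∈ ∷ All.map proj₁ ds⊆)

module _ (G : Graph) where
  open Graph G
  open Walks multigraph

  spanning-tree-through : ∀ e → Σ[ T ∈ SpanningTree multigraph ] e Subset.∈ SpanningTree.edges T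
  spanning-tree-through e with fs , F , fs⊆ , _ , joined ← grow (allFin #E) (addEdge e discrete (loopless e)) =
    record { edges = S ; connected = conn ; acyclic = λ ds c ds⊆ → Forest.acyclic F ds c (All.map ∈S⇒ ds⊆) } ,
    ⇒∈S (fs⊆ (here refl))
    where
    open DecMembership (Fin._≟_ {#E}) using () renaming (_∈?_ to _∈ˡ?_)
    S : Subset #E
    S = tabulate (λ f → does (f ∈ˡ? fs))
    ∈S⇒ : ∀ {f} → f Subset.∈ S → f ∈ fs
    ∈S⇒ {f} f∈ with f ∈ˡ? fs | trans (sym (lookup∘tabulate (λ f → does (f ∈ˡ? fs)) f)) ([]=⇒lookup f∈)
    ... | yes f∈fs | _ = f∈fs
    ⇒∈S : ∀ {f} → f ∈ fs → f Subset.∈ S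
    ⇒∈S {f} f∈fs = lookup⇒[]= f S (trans (lookup∘tabulate (λ f → does (f ∈ˡ? fs)) f) is-true)
      where
      is-true : does (f ∈ˡ? fs) ≡ true
      is-true with f ∈ˡ? fs
      ... | yes _   = refl
      ... | no f∉fs = ⊥-elim (f∉fs f∈fs)
    same-label : ∀ u v → Forest.label F u ≡ Forest.label F v
    same-label u v with ds , w ← connected u v =
      conn-invariant (_∈ allFin #E) (Forest.label F) joined (ds , w , All.tabulate (λ {x} _ → ∈-allFin (edge x)))
    conn : ∀ u v → ∃[ ds ] (Walk multigraph u ds v × All (λ d → edge d Subset.∈ S) ds)
    conn u v = conn-map ⇒∈S (Forest.sound F (same-label u v))

-- Injectivity on a cycle, and positions in a list

module _ {A : Set} {f : A → A} where

  arc-suffix : ∀ {x z} xs {ys} → Arc f x (xs ++ ys) z → ∃[ y ] Arc f y ys z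
  arc-suffix []       p       = _ , p
  arc-suffix (_ ∷ xs) (_ ∷ p) = arc-suffix xs p

  arc-start : ∀ {x xs z} → Arc f x xs z → x ∈ xs ⊎ x ≡ z
  arc-start []      = inj₂ refl
  arc-start (x ∷ _) = inj₁ (here refl)

  arc-closed-⊆ : ∀ {x xs z} (O : A → Set) → (∀ {y} → O y → O (f y)) → Arc f x xs z → O x → ∀ {y} → y ∈ xs → O y
  arc-closed-⊆ O cl (x ∷ p) Ox (here refl) = Ox
  arc-closed-⊆ O cl (x ∷ p) Ox (there y∈)  = arc-closed-⊆ O cl p (cl Ox) y∈

  -- If some `b` further along had the same image as `a`, the stretch from `f a` to `b` would close
  -- up to a cycle that misses `a`, although `a` is reached from `f a`.
  cycle-injective : ∀ {a xs b} → Arc f a (a ∷ xs) a → Unique (a ∷ xs) → b ∈ a ∷ xs → f a ≡ f b → a ≡ b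
  cycle-injective p       u          (here refl) eq = refl
  cycle-injective {a} (_ ∷ p) (a∉ ∷ _) (there b∈) eq with as , bs , refl ← ∈-∃++ b∈ =
    ⊥-elim (arc-avoids p (All.++⁺ (All.++⁻ˡ as a∉) (All.head (All.++⁻ʳ as a∉) ∷ [])) loop (start (arc-start loop)))
    where
    loop : Arc f (f a) (as ++ _ ∷ []) (f a)
    loop = arc-++ (proj₁ (arc-split as p)) (_ ∷ subst (λ y → Arc f y [] (f a)) eq [])
    start : f a ∈ as ++ _ ∷ [] ⊎ f a ≡ f a → f a ∈ as ++ _ ∷ []
    start (inj₁ q) = q
    start (inj₂ _) = nonempty as loop
      where
      nonempty : ∀ as {b y z} → Arc f y (as ++ b ∷ []) z → y ∈ as ++ b ∷ []
      nonempty []       (_ ∷ _) = here refl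
      nonempty (_ ∷ as) (_ ∷ _) = here refl

module Index {A : Set} (_≟_ : DecidableEquality A) where

  index : List A → A → ℕ
  index []       x = 0
  index (y ∷ ys) x with x ≟ y
  ... | yes _ = 0
  ... | no _  = suc (index ys x)

  index-injective : ∀ {xs x y} → x ∈ xs → y ∈ xs → index xs x ≡ index xs y → x ≡ y
  index-injective {z ∷ zs} {x} {y} x∈ y∈ eq with x ≟ z | y ≟ z
  ... | yes refl | yes refl = refl
  index-injective {z ∷ zs} (here refl) y∈ eq         | no x≢ | no y≢ = ⊥-elim (x≢ refl)
  index-injective {z ∷ zs} (there x∈) (here refl) eq | no x≢ | no y≢ = ⊥-elim (y≢ refl)
  index-injective {z ∷ zs} (there x∈) (there y∈) eq  | no x≢ | no y≢ = index-injective x∈ y∈ (ℕ.suc-injective eq)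

  index-≤ : ∀ xs x → index xs x ≤ length xs
  index-≤ []       x = z≤n
  index-≤ (y ∷ ys) x with x ≟ y
  ... | yes _ = z≤n
  ... | no _  = s≤s (index-≤ ys x)

  index-sorted : ∀ {xs} → Unique xs → AllPairs (λ x y → index xs x < index xs y) xs
  index-sorted []                   = []
  index-sorted {x ∷ xs} (x∉ ∷ xs!) = All.map first x∉ ∷ later x∉ (index-sorted xs!)
    where
    first : ∀ {y} → x ≢ y → index (x ∷ xs) x < index (x ∷ xs) y
    first {y} x≢y with x ≟ x | y ≟ x
    ... | _      | yes y≡x = ⊥-elim (x≢y (sym y≡x))
    ... | yes _  | no _    = z<s
    ... | no x≢x | no _    = ⊥-elim (x≢x refl)
    shift : ∀ {y z} → x ≢ y → x ≢ z → index xs y < index xs z → index (x ∷ xs) y < index (x ∷ xs) z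
    shift {y} {z} x≢y x≢z y<z with y ≟ x | z ≟ x
    ... | yes y≡x | _       = ⊥-elim (x≢y (sym y≡x))
    ... | no _    | yes z≡x = ⊥-elim (x≢z (sym z≡x))
    ... | no _    | no _    = s≤s y<z
    later : ∀ {ys} → All (x ≢_) ys → AllPairs (λ y z → index xs y < index xs z) ys →
            AllPairs (λ y z → index (x ∷ xs) y < index (x ∷ xs) z) ys
    later []         []       = []
    later (x≢y ∷ qs) (p ∷ ps) = All.zipWith (λ (x≢z , y<z) → shift x≢y x≢z y<z) (qs , p) ∷ later qs ps

find-last : ∀ {A : Set} {P : A → Set} (P? : Decidable P) {xs} → Any P xs →
            ∃[ as ] ∃[ y ] ∃[ bs ] xs ≡ as ++ y ∷ bs × P y × All (¬_ ∘ P) bs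
find-last P? {x ∷ xs} p with any? P? xs
find-last P? {x ∷ xs} (here Px) | no none = [] , x , xs , refl , Px , All.¬Any⇒All¬ xs none
find-last P? {x ∷ xs} (there p) | no none = ⊥-elim (none p)
find-last P? {x ∷ xs} _         | yes p with as , y , bs , refl , Py , none ← find-last P? p =
  x ∷ as , y , bs , refl , Py , none

find-first : ∀ {A : Set} {P : A → Set} (P? : Decidable P) {xs} → Any P xs →
             ∃[ as ] ∃[ x ] ∃[ bs ] xs ≡ as ++ x ∷ bs × List.find P? xs ≡ just x × P x × All (¬_ ∘ P) as
find-first P? {y ∷ ys} p with P? y
find-first P? {y ∷ ys} p           | yes Py = [] , y , ys , refl , refl , Py , []
find-first P? {y ∷ ys} (here Py)   | no ¬Py = ⊥-elim (¬Py Py)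
find-first P? {y ∷ ys} (there p)   | no ¬Py with as , x , bs , refl , eq , Px , none ← find-first P? p =
  y ∷ as , x , bs , refl , eq , Px , ¬Py ∷ none

-- The tour of a spanning tree

module Ribbon (R : RibbonGraph) where
  open RibbonGraph R
  open Darts multigraph public

  tail≢head : ∀ d → tail d ≢ head d
  tail≢head (e , false) = loopless e
  tail≢head (e , true)  = loopless e ∘ sym

  ∈-darts : ∀ d → d ∈ darts
  ∈-darts (e , false) = ∈-cartesianProduct⁺ (∈-allFin e) (here refl)
  ∈-darts (e , true)  = ∈-cartesianProduct⁺ (∈-allFin e) (there (here refl))

  length≤darts : ∀ {xs} → Unique xs → length xs ≤ length darts
  length≤darts u = relation⇒length≤ _≡_ darts (All.tabulate λ {x} _ → ∈-darts x)
                     (AllPairs.map (λ x≢x′ {y} x≡y x′≡y → x≢x′ (trans x≡y (sym x′≡y))) u)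

  code : Dart → Fin (#E ℕ.* 2)
  code (e , b) = Fin.combine e (if b then Fin.suc Fin.zero else Fin.zero)

  code-injective : ∀ {x y} → code x ≡ code y → x ≡ y
  code-injective {e , b} {e′ , b′} eq = cong₂ _,_ (Fin.combine-injectiveˡ _ _ _ _ eq) (bool b b′ (Fin.combine-injectiveʳ e _ e′ _ eq))
    where
    bool : ∀ b b′ → (if b then Fin.suc Fin.zero else Fin.zero {1}) ≡ (if b′ then Fin.suc Fin.zero else Fin.zero) → b ≡ b′
    bool false false _ = refl
    bool true  true  _ = refl

  -- Transitivity around the vertex makes the orbit of `x` return to `x` and pass through `y`, and
  -- `cycle-injective` applies to this orbit.
  next-injective : ∀ {x y} → next x ≡ next y → x ≡ y
  next-injective {x} {y} eq
    with k , eq′ ← cyclic (next x) x (next-tail x)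
    with xs , p , u ← ∃-orbit _≟ᴰ_ k eq′
    with j , refl ← cyclic x y (trans (sym (next-tail x)) (trans (cong tail eq) (next-tail y))) =
    cycle-injective p u (iterate-∈ p (here refl) j) eq

  orbit : ∀ {f : Dart → Dart} → (∀ {x y} → f x ≡ f y → x ≡ y) → ∀ d → ∃[ xs ] Arc f d (d ∷ xs) d × Unique (d ∷ xs)
  orbit inj d with k , eq ← periodic code code-injective inj d = ∃-orbit _≟ᴰ_ k eq

  module TreeStep (T : SpanningTree multigraph) where
    open SpanningTree T using (edges)
    open Walks multigraph
    open Cut T
    open Tour R T using (step) public

    Tree : Dart → Set
    Tree d = edge d Subset.∈ edges

    tree? : ∀ d → Dec (Tree d)
    tree? d = edge d ∈? edges

    step-tree : ∀ {d} → Tree d → step d ≡ next (flip d)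
    step-tree {d} t with edge d ∈? edges
    ... | yes _ = refl
    ... | no ¬t = ⊥-elim (¬t t)

    step-nontree : ∀ {d} → ¬ Tree d → step d ≡ next d
    step-nontree {d} ¬t with edge d ∈? edges
    ... | yes t = ⊥-elim (¬t t)
    ... | no _  = refl

    step-flip : ∀ {d} → Tree d → step (flip d) ≡ next d
    step-flip {d} t = trans (step-tree t) (cong next (flip-flip d))

    tail-step-tree : ∀ {d} → Tree d → tail (step d) ≡ head d
    tail-step-tree {d} t = trans (cong tail (step-tree t)) (next-tail (flip d))

    tail-step-nontree : ∀ {d} → ¬ Tree d → tail (step d) ≡ tail d
    tail-step-nontree {d} ¬t = trans (cong tail (step-nontree ¬t)) (next-tail d)

    flip-injective : ∀ {x y : Dart} → flip x ≡ flip y → x ≡ y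
    flip-injective {x} {y} eq = trans (sym (flip-flip x)) (trans (cong flip eq) (flip-flip y))

    step-injective : ∀ {x y} → step x ≡ step y → x ≡ y
    step-injective {x} {y} eq with edge x ∈? edges | edge y ∈? edges
    ... | yes _  | yes _  = flip-injective (next-injective eq)
    ... | no _   | no _   = next-injective eq
    ... | yes tx | no ¬ty = ⊥-elim (¬ty (subst (Subset._∈ edges) (cong proj₁ (next-injective eq)) tx))
    ... | no ¬tx | yes ty = ⊥-elim (¬tx (subst (Subset._∈ edges) (cong proj₁ (sym (next-injective eq))) ty))

    module Side (t : Dart) (t∈ : Tree t) where

      side : Vertex → Vertex
      side = proj₁ (cut (edge t) t∈)

      side-same : ∀ d → Tree d → edge d ≢ edge t → side (tail d) ≡ side (head d)
      side-same = proj₁ (proj₂ (cut (edge t) t∈))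

      side-≢ : side (tail t) ≢ side (head t)
      side-≢ = proj₂ (proj₂ (cut (edge t) t∈)) t refl

      side-step : ∀ x → edge x ≢ edge t → side (tail (step x)) ≡ side (tail x)
      side-step x x≢t = go (tree? x)
        where
        go : Dec (Tree x) → side (tail (step x)) ≡ side (tail x)
        go (yes tx) = trans (cong side (tail-step-tree {x} tx)) (sym (side-same x tx x≢t))
        go (no ¬tx) = cong side (tail-step-nontree {x} ¬tx)

      side-arc : ∀ {x xs z} → Arc step x xs z → (∀ {y} → y ∈ xs → edge y ≢ edge t) →
                 side (tail z) ≡ side (tail x)
      side-arc []      _     = refl
      side-arc (x ∷ p) avoid = trans (side-arc p (avoid ∘ there)) (side-step x (avoid (here refl)))

      -- From the side of `tail t`, only `t` crosses the cut: its reverse starts on the other side.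
      side-stays : ∀ {x xs z} → Arc step x xs z → t ∉ xs → side (tail x) ≡ side (tail t) →
                   side (tail z) ≡ side (tail t)
      side-stays []      t∉ eq = eq
      side-stays (x ∷ p) t∉ eq = side-stays p (t∉ ∘ there) (trans (side-step x x≢t) eq)
        where
        x≢t : edge x ≢ edge t
        x≢t e≡ with dart-cases x t e≡
        ... | inj₁ refl = t∉ (here refl)
        ... | inj₂ refl = side-≢ (sym eq)

    -- Walking along `d` leads beyond its cut, and only `flip d` leads back to the start.
    flip∈orbit : ∀ {d xs} → Tree d → Arc step d (d ∷ xs) d → flip d ∈ d ∷ xs
    flip∈orbit {d} {xs} t (_ ∷ p) with any? (flip d ≟ᴰ_) (d ∷ xs)
    ... | yes fd∈ = fd∈
    ... | no fd∉  = ⊥-elim (side-≢ (trans (sym stays) (cong (side ∘ tail) (sym (flip-flip d)))))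
      where
      open Side (flip d) t using (side-stays; side; side-≢)
      stays : side (tail d) ≡ side (head d)
      stays = side-stays p (fd∉ ∘ there) (cong side (tail-step-tree {d} t))

    -- One cycle of the tour, which turns out to contain all darts
    record Circuit (d₀ : Dart) : Set where
      field
        circle        : List Dart
        circle-arc    : Arc step d₀ circle d₀
        circle-unique : Unique circle
        start∈        : d₀ ∈ circle

    circuit : ∀ d₀ → Circuit d₀
    circuit d₀ = let xs , p , u = orbit step-injective d₀ in
      record { circle = d₀ ∷ xs ; circle-arc = p ; circle-unique = u ; start∈ = here refl }

    module Circle {d₀ : Dart} (C : Circuit d₀) where
      open Circuit C public

      private
        flip-closed : ∀ {x} → Tree x → x ∈ circle → flip x ∈ circle
        flip-closed {x} t x∈ = let xs , p , _ = orbit step-injective x in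
          arc-closed-⊆ (_∈ circle) (cycle-closed circle-arc) p x∈ (flip∈orbit {x} t p)

        next-closed : ∀ {x} → x ∈ circle → next x ∈ circle
        next-closed {x} x∈ = go (tree? x)
          where
          go : Dec (Tree x) → next x ∈ circle
          go (no ¬t) = subst (_∈ circle) (step-nontree {x} ¬t) (cycle-closed circle-arc x∈)
          go (yes t) = subst (_∈ circle) (step-flip {x} t) (cycle-closed circle-arc (flip-closed {x} t x∈))

        iterate-closed : ∀ k {x} → x ∈ circle → iterate next x k ∈ circle
        iterate-closed zero    x∈ = x∈
        iterate-closed (suc k) x∈ = iterate-closed k (next-closed x∈)

        at-vertex : ∀ {x y} → x ∈ circle → tail x ≡ tail y → y ∈ circle
        at-vertex {x} {y} x∈ eq with k , refl ← cyclic x y eq = iterate-closed k x∈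

        along-walk : ∀ {u v ds} → Walk multigraph u ds v → All Tree ds →
                     (∀ y → tail y ≡ u → y ∈ circle) → ∀ y → tail y ≡ v → y ∈ circle
        along-walk []      []       at-u = at-u
        along-walk (d ∷ w) (t ∷ ts) at-u =
          along-walk w ts (λ y eq → at-vertex (flip-closed {d} t (at-u d refl)) (sym eq))

      -- The circle is closed under `flip` on tree darts, hence under `next`, which at a tree dart
      -- is `step` after `flip`. So it fills each vertex that it meets and spreads along the tree to
      -- all of them.
      circle-complete : ∀ y → y ∈ circle
      circle-complete y with ds , w , ts ← SpanningTree.connected T (tail d₀) (tail y) =
        along-walk w ts (λ y eq → at-vertex start∈ (sym eq)) y refl

      open Index _≟ᴰ_

      pos : Dart → ℕ
      pos = index circle

      pos-injective : ∀ {x y} → pos x ≡ pos y → x ≡ y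
      pos-injective = index-injective (circle-complete _) (circle-complete _)

      pos-bounded : ∀ x → pos x < suc (length circle)
      pos-bounded x = s≤s (index-≤ circle x)

      open CyclicOrder pos pos-injective public

      circle-sorted : Sorted circle
      circle-sorted = index-sorted circle-unique

      record Rotation (d : Dart) : Set where
        field
          rest     : List Dart
          arc      : Arc step d (d ∷ rest) d
          ordered  : AllPairs [ d ,_,_] rest
          complete : ∀ x → x ≡ d ⊎ x ∈ rest
          short    : length (d ∷ rest) ≤ length darts
          d∉rest   : All (d ≢_) rest

      rotation : ∀ d → Rotation d
      rotation d = go (∈-∃++ (circle-complete d)) circle-arc circle-sorted circle-unique circle-complete
        where
        go : ∀ {xs} → ∃₂ (λ as bs → xs ≡ as ++ d ∷ bs) → Arc step d₀ xs d₀ → Sorted xs → Unique xs → (∀ x → x ∈ xs) →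
             Rotation d
        go {xs} (as , bs , refl) p s u c = record
          { rest     = bs ++ as
          ; arc      = arc-rotate as p
          ; ordered  = sorted-rotate as s
          ; complete = λ x → member (∈-++⁻ as (c x))
          ; short    = length≤darts (d∉ ∷ AllPairs.++⁺ bs! as! (All.tabulate λ x∈ → All.tabulate λ y∈ x≡y →
                         All.lookup (All.lookup as# y∈) (there x∈) (sym x≡y)))
          ; d∉rest   = d∉
          }
          where
          parts = allPairs-split as u
          as! = proj₁ parts
          as# = proj₂ (proj₂ parts)
          bs! = AllPairs.tail (proj₁ (proj₂ parts))
          d∉ : All (d ≢_) (bs ++ as)
          d∉ = All.++⁺ (AllPairs.head (proj₁ (proj₂ parts))) (All.map (λ x# → All.head x# ∘ sym) as#)
          member : ∀ {x} → x ∈ as ⊎ x ∈ d ∷ bs → x ≡ d ⊎ x ∈ bs ++ as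
          member (inj₁ x∈)         = inj₂ (∈-++⁺ʳ bs x∈)
          member (inj₂ (here x≡))  = inj₁ x≡
          member (inj₂ (there x∈)) = inj₂ (∈-++⁺ˡ x∈)

      ≢-rest : ∀ {a b} → a ≢ b → b ≡ a ⊎ b ∈ Rotation.rest (rotation a) → b ∈ Rotation.rest (rotation a)
      ≢-rest a≢b (inj₁ refl) = ⊥-elim (a≢b refl)
      ≢-rest a≢b (inj₂ b∈)   = b∈

      -- Translates the cyclic order into a stretch of the tour; `between` omits both ends, while
      -- the arc includes `a`.
      record Between (a b : Dart) : Set where
        field
          between  : List Dart
          arc      : Arc step a (a ∷ between) b
          sound    : ∀ {x} → x ∈ between → [ a , x , b ]
          complete : ∀ {x} → [ a , x , b ] → x ∈ between

      between : ∀ {a b} → a ≢ b → Between a b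
      between {a} {b} a≢b = go (∈-∃++ (≢-rest a≢b (complete b))) arc ordered complete
        where
        open Rotation (rotation a)
        go : ∀ {xs} → ∃₂ (λ as bs → xs ≡ as ++ b ∷ bs) → Arc step a (a ∷ xs) a → AllPairs [ a ,_,_] xs →
             (∀ x → x ≡ a ⊎ x ∈ xs) → Between a b
        go {xs} (as , bs , refl) p o c = record
          { between  = as
          ; arc      = proj₁ (arc-split (a ∷ as) p)
          ; sound    = λ x∈ → All.head (All.lookup (proj₂ (proj₂ (allPairs-split as o))) x∈)
          ; complete = λ {x} q → inside₁ q (c x)
          }
          where
          inside₂ : ∀ {x} → [ a , x , b ] → x ∈ as ⊎ x ∈ b ∷ bs → x ∈ as
          inside₂ q (inj₁ x∈)          = x∈
          inside₂ q (inj₂ (here refl)) = ⊥-elim (≢₂₃ q refl)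
          inside₂ q (inj₂ (there x∈))  =
            ⊥-elim (asym q (All.lookup (AllPairs.head (proj₁ (proj₂ (allPairs-split as o)))) x∈))
          inside₁ : ∀ {x} → [ a , x , b ] → x ≡ a ⊎ x ∈ as ++ b ∷ bs → x ∈ as
          inside₁ q (inj₁ refl) = ⊥-elim (≢₁₂ q refl)
          inside₁ q (inj₂ x∈)   = inside₂ q (∈-++⁻ as x∈)

      step-adjacent : ∀ {a y} → ¬ [ a , y , step a ]
      step-adjacent {a} {y} q with between (≢₁₃ q)
      ... | record { between = as ; arc = a ∷ p ; sound = sound ; complete = complete } with p | complete q
      ...   | []      | ()
      ...   | _ ∷ _   | _ = ≢₂₃ (sound (here refl)) refl

      module _ {d : Dart} (t : Tree d) where
        open Side d t

        -- Strictly between `d` and `flip d` the tour meets neither dart of `edge d`, so it remains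
        -- on the side to which `d` has led.
        between-side : ∀ {x} → [ d , x , flip d ] → side (tail x) ≡ side (head d)
        between-side {x} q with between (≢₁₃ q)
        ... | record { between = as ; arc = _ ∷ p ; sound = sound ; complete = complete }
          with ys , zs , refl ← ∈-∃++ (complete q) =
          trans (side-arc (proj₁ (arc-split ys p)) avoid) (cong side (tail-step-tree {d} t))
          where
          avoid : ∀ {y} → y ∈ ys → edge y ≢ edge d
          avoid {y} y∈ eq with dart-cases y d eq
          ... | inj₁ refl = ≢₁₂ (sound (∈-++⁺ˡ y∈)) refl
          ... | inj₂ refl = ≢₂₃ (sound (∈-++⁺ˡ y∈)) refl

      -- If tail a ≢ tail b, then the last dart t at tail a before b is a tree dart, and b and e lie beyond its cut,
      -- which the tour can enter only through t.
      tails-nonalternating : ∀ {a b c e} → [ a , b , c ] → [ c , e , a ] → tail a ≡ tail c → tail b ≡ tail e →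
                             tail a ≡ tail b
      tails-nonalternating {a} {b} {c} {e} abc cea a~c b~e with tail a Fin.≟ tail b
      ... | yes a~b = a~b
      ... | no a≁b with between (≢₁₂ abc) | between (≢₁₂ cea)
      ...   | record { between = A ; arc = p ; sound = soundA }
            | record { between = A′ ; arc = p′ ; sound = soundA′ }
            with as , t , bs , eqA , t~a , none ← find-last (λ x → tail x Fin.≟ tail a) {a ∷ A} (here refl)
            = ⊥-elim (side-≢ (trans (sym sideA) sideB))
        where
        q : Arc step (step t) bs b
        q = proj₂ (arc-split as (subst (λ xs → Arc step a xs b) eqA p))

        not-at-a : ∀ {x} → tail x ≡ tail a → x ∈ bs ⊎ x ≡ b → ⊥
        not-at-a x~a (inj₁ x∈)   = All.lookup none x∈ x~a
        not-at-a x~a (inj₂ refl) = a≁b (sym x~a)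

        -- Cutting through `t` would leave the tour at `tail a`, although `t` is the last dart there
        -- before `b`.
        t-tree : Tree t
        t-tree = go (tree? t)
          where
          go : Dec (Tree t) → Tree t
          go (yes tr) = tr
          go (no ¬tr) = ⊥-elim (not-at-a (trans (tail-step-nontree {t} ¬tr) t~a) (arc-start q))

        open Side t t-tree

        -- `t` is last, and `flip t` would be followed by `next t`, which is again at `tail a`.
        avoid : ∀ {y} → y ∈ bs → edge y ≢ edge t
        avoid {y} y∈ eq with dart-cases y t eq
        ... | inj₁ refl = All.lookup none y∈ t~a
        ... | inj₂ refl = not-at-a (trans (trans (cong tail (step-flip {t} t-tree)) (next-tail t)) t~a) (arc-closed q y∈)

        sideB : side (tail b) ≡ side (head t)
        sideB = trans (side-arc q avoid) (cong side (tail-step-tree {t} t-tree))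

        t∈A : t ∈ a ∷ A
        t∈A = subst (t ∈_) (sym eqA) (∈-++⁺ʳ as (here refl))

        t∉A′ : t ∉ c ∷ A′
        t∉A′ t∈A′ with t∈A | t∈A′
        ... | here refl | here refl = ≢₁₃ abc refl
        ... | here refl | there t∈  = asym cea (soundA′ t∈)
        ... | there t∈  | here refl = asym abc (soundA t∈)
        ... | there t∈  | there t∈′ = asym (abd (soundA t∈) abc) (rot (rot (abd (soundA′ t∈′) cea)))

        -- From `c` to `e` the tour leads from `tail a` to `tail b` without using `t`, hence without
        -- leaving the side of `tail t`.
        sideA : side (tail b) ≡ side (tail t)
        sideA = trans (cong side b~e) (side-stays p′ t∉A′ (cong side (trans (sym a~c) (sym t~a))))

      -- `ts` always consists of the tree darts still ahead on the circle. The tour stops when there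
      -- are none, so what it omits of the circle contains only darts outside the tree.
      tourFrom-prefix : ∀ k {ts x xs z} → Arc step x xs z → Unique xs → length xs ≤ k →
                        (∀ {t} → t ∈ ts → t ∈ xs) → (∀ {t} → t ∈ xs → Tree t → t ∈ ts) →
                        ∃[ ys ] xs ≡ Tour.tourFrom R T k ts x ++ ys × All (¬_ ∘ Tree) ys
      tourFrom-prefix zero    []      u l ts⊆ ⊆ts = [] , refl , []
      tourFrom-prefix (suc k) {[]}    {xs = xs} p u l ts⊆ ⊆ts = xs , refl , All.tabulate λ x∈ t → case (⊆ts x∈ t)
        where
        case : ∀ {x : Dart} → ¬ (x ∈ [])
        case ()
      tourFrom-prefix (suc k) {_ ∷ _} [] u l ts⊆ ⊆ts with () ← ts⊆ (here refl)
      tourFrom-prefix (suc k) {ts@(_ ∷ _)} (_∷_ x {xs} p) (x∉ ∷ u) (s≤s l) ts⊆ ⊆ts =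
        let ys , eq , nt = tourFrom-prefix k p u l
              (λ t∈ → drop (∈-filter⁻ (λ y → ¬? (y ≟ᴰ x)) {xs = ts} t∈))
              (λ t∈ tt → ∈-filter⁺ (λ y → ¬? (y ≟ᴰ x)) (⊆ts (there t∈) tt) (λ t≡x → All.lookup x∉ t∈ (sym t≡x)))
        in ys , cong (x ∷_) eq , nt
        where
        drop : ∀ {t} → t ∈ ts × t ≢ x → t ∈ xs
        drop (t∈ , t≢x) with ts⊆ t∈
        ... | here t≡x  = ⊥-elim (t≢x t≡x)
        ... | there t∈′ = t∈′

      same-tail : ∀ {x xs z} → Arc step x xs z → All (¬_ ∘ Tree) xs → ∀ {y} → y ∈ xs → tail y ≡ tail x
      same-tail (x ∷ p) (nt ∷ nts) (here refl) = refl
      same-tail (x ∷ p) (nt ∷ nts) (there y∈)  = trans (same-tail p nts y∈) (tail-step-nontree {x} nt)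

      -- The remainder of the circle after the last tree dart stays at one vertex, so no edge has both ends there.
      firstCut-first : ∀ d f → ¬ (f Subset.∈ SpanningTree.edges T) →
        ∃[ b ] Tour.firstCut R T d f ≡ just (f , b) × ((f , b) ≡ d ⊎ [ d , (f , b) , flip (f , b) ])
      firstCut-first d f f∉ = go (tourFrom-prefix (length darts) arc (d∉rest ∷ AllPairs.map ≢₂₃ ordered) short
                                (λ {t} _ → member t) (λ {t} _ tt → ∈-filter⁺ tree? (∈-darts t) tt))
        where
        open Rotation (rotation d)
        tour = Tour.tour R T d

        member : ∀ x → x ∈ d ∷ rest
        member x with complete x
        ... | inj₁ x≡d = here x≡d
        ... | inj₂ x∈  = there x∈

        Goal : Set
        Goal = ∃[ b ] Tour.firstCut R T d f ≡ just (f , b) × ((f , b) ≡ d ⊎ [ d , (f , b) , flip (f , b) ])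

        found : ∀ as x {bs} → d ∷ rest ≡ as ++ x ∷ bs → All (λ y → edge y ≢ edge x) as → x ≡ d ⊎ [ d , x , flip x ]
        found []       x refl none = inj₁ refl
        found (y ∷ as) x {bs} eq (y≢ ∷ none) = inj₂
          (All.lookup (AllPairs.head (proj₁ (proj₂ (allPairs-split as (subst (AllPairs [ d ,_,_]) rest≡ ordered)))))
                      (later (complete (flip x))))
          where
          rest≡ : rest ≡ as ++ x ∷ bs
          rest≡ = ∷-injectiveʳ eq
          later : flip x ≡ d ⊎ flip x ∈ rest → flip x ∈ bs
          later (inj₁ fx≡d) = ⊥-elim (y≢ (cong proj₁ (trans (sym (∷-injectiveˡ eq)) (sym fx≡d))))
          later (inj₂ fx∈) with ∈-++⁻ as (subst (flip x ∈_) rest≡ fx∈)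
          ... | inj₁ fx∈as         = ⊥-elim (All.lookup none fx∈as refl)
          ... | inj₂ (here fx≡x)   = ⊥-elim (flip-≢ fx≡x)
          ... | inj₂ (there fx∈bs) = fx∈bs

        go : ∃[ ys ] d ∷ rest ≡ tour ++ ys × All (¬_ ∘ Tree) ys → Goal
        go (ys , eq , nt) with any? (λ x → edge x Fin.≟ f) tour
        ... | no none = ⊥-elim (loopless f (trans (same-tail q nt (in-ys (f , false) refl))
                                                  (sym (same-tail q nt (in-ys (f , true) refl)))))
          where
          in-ys : ∀ x → edge x ≡ f → x ∈ ys
          in-ys x x≡f with ∈-++⁻ tour (subst (x ∈_) eq (member x))
          ... | inj₁ x∈ = ⊥-elim (none (Any.map (λ { refl → x≡f }) x∈))
          ... | inj₂ x∈ = x∈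
          q = proj₂ (arc-suffix tour (subst (λ xs → Arc step d xs d) eq arc))
        ... | yes some with as , x , bs , eq′ , fc , refl , none ← find-first (λ x → edge x Fin.≟ f) some =
          proj₂ x , fc , found as x (trans eq (trans (cong (_++ ys) eq′) (++-assoc as (x ∷ bs) ys))) none

-- Representatives, filters and disjoint lists

deduplicate-unrelated : ∀ {A : Set} {R : A → A → Set} (R? : Binary.Decidable R) xs →
                        AllPairs (λ x y → ¬ R x y) (deduplicate R? xs)
deduplicate-unrelated R? []       = []
deduplicate-unrelated R? (x ∷ xs) =
  All.all-filter _ (deduplicate R? xs) ∷ AllPairs.filter⁺ _ (deduplicate-unrelated R? xs)

length-filter+ : ∀ {A : Set} {P : A → Set} (P? : Decidable P) xs →
                 length (filter P? xs) ℕ.+ length (filter (¬? ∘ P?) xs) ≡ length xs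
length-filter+ P? []       = refl
length-filter+ P? (x ∷ xs) with does (P? x)
... | true  = cong suc (length-filter+ P? xs)
... | false = trans (ℕ.+-suc _ _) (cong suc (length-filter+ P? xs))

disjoint⇒≡ : ∀ {A : Set} {Cs : List (List A)} → AllPairs Disjoint Cs → ∀ {C D x} →
             C ∈ Cs → D ∈ Cs → x ∈ C → x ∈ D → C ≡ D
disjoint⇒≡ (_ ∷ _)  (here refl) (here refl) x∈C x∈D = refl
disjoint⇒≡ (p ∷ _)  (here refl) (there D∈)  x∈C x∈D = ⊥-elim (All.lookup p D∈ (x∈C , x∈D))
disjoint⇒≡ (p ∷ _)  (there C∈)  (here refl) x∈C x∈D = ⊥-elim (All.lookup p C∈ (x∈D , x∈C))
disjoint⇒≡ (_ ∷ ps) (there C∈)  (there D∈)  x∈C x∈D = disjoint⇒≡ ps C∈ D∈ x∈C x∈D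

-- Vertices and faces as cycles

module Counting (R : RibbonGraph) where
  open RibbonGraph R
  open Ribbon R

  record Cycles (f : Dart → Dart) (Cs : List (List Dart)) : Set where
    field
      cycles   : All (λ C → ∃[ x ] Arc f x C x × Unique C × ∃[ y ] y ∈ C) Cs
      complete : ∀ x → Any (x ∈_) Cs
      disjoint : AllPairs Disjoint Cs

  IsNextCycle : List Dart → Set
  IsNextCycle C = ∃[ x ] Arc next x C x × Unique C × ∃[ y ] y ∈ C

  next-cycle-tail : ∀ {x C y z} → Arc next x C z → y ∈ C → tail y ≡ tail x
  next-cycle-tail (x ∷ p) (here refl) = refl
  next-cycle-tail (x ∷ p) (there y∈)  = trans (next-cycle-tail p y∈) (next-tail x)

  dart-at : Dart → ∀ v → ∃[ x ] tail x ≡ v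
  dart-at d v with _ , w ← connected v (tail d) with Walks.walk-start multigraph w
  ... | inj₁ v≡         = d , sym v≡
  ... | inj₂ (x , _ , eq) = x , eq

  -- The cycles of `next` are the sets of darts at the single vertices. The dart `d₀` excludes the
  -- graph without edges, whose vertex would lie on no cycle; by connectedness every vertex then has
  -- a dart.
  #cycles-next : ∀ {Cs} → Dart → Cycles next Cs → length Cs ≡ #V
  #cycles-next {Cs} d₀ cs = trans (ℕ.≤-antisym
    (relation⇒length≤ (λ C v → IsNextCycle C × ∃[ x ] x ∈ C × tail x ≡ v) (allFin #V)
      (All.map (λ { c@(x , _ , _ , y , y∈) → lose (∈-allFin (tail y)) (c , y , y∈ , refl) }) cycles)
      (AllPairs.map {R = Disjoint} (λ dj {v} → separate dj) disjoint))
    (relation⇒length≤ (λ v C → IsNextCycle C × ∃[ x ] x ∈ C × tail x ≡ v) Cs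
      (All.tabulate λ {v} _ → serve v)
      (AllPairs.map (λ v≢v′ {C} → same-vertex v≢v′) (Unique.allFin⁺ #V))))
    (length-tabulate {n = #V} (λ x → x))
    where
    open Cycles cs
    separate : ∀ {C C′ v} → Disjoint C C′ → IsNextCycle C × (∃[ x ] x ∈ C × tail x ≡ v) →
               ¬ (IsNextCycle C′ × ∃[ x ] x ∈ C′ × tail x ≡ v)
    separate dj ((_ , p , _) , x , x∈ , x~v) (_ , y , y∈ , y~v) with k , refl ← cyclic x y (trans x~v (sym y~v)) =
      dj (iterate-∈ p x∈ k , y∈)
    serve : ∀ v → Any (λ C → IsNextCycle C × ∃[ x ] x ∈ C × tail x ≡ v) Cs
    serve v with x , eq ← dart-at d₀ v with C , C∈ , x∈ ← find (complete x) =
      lose C∈ (All.lookup cycles C∈ , x , x∈ , eq)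
    same-vertex : ∀ {v v′ C} → v ≢ v′ → IsNextCycle C × (∃[ x ] x ∈ C × tail x ≡ v) →
                  ¬ (IsNextCycle C × ∃[ x ] x ∈ C × tail x ≡ v′)
    same-vertex v≢v′ ((_ , p , _) , x , x∈ , refl) (_ , y , y∈ , refl) =
      v≢v′ (trans (next-cycle-tail p x∈) (sym (next-cycle-tail p y∈)))

  -- `deduplicate` leaves each cycle a representative, since the relation never leads out of a
  -- cycle, and only one, since `length darts` iterations exhaust a cycle.
  #cycles-face : ∀ {Cs} → Cycles (nextOnFace R) Cs → length Cs ≡ length (deduplicate (sameFace? R) darts)
  #cycles-face {Cs} cs = ℕ.≤-antisym
    (relation⇒length≤ (λ C x → x ∈ C) reps
      (All.tabulate λ C∈ → serve C∈ (All.lookup cycles C∈))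
      (AllPairs.map {R = Disjoint} (λ dj {x} x∈ x∈′ → dj (x∈ , x∈′)) disjoint))
    (relation⇒length≤ (λ x C → x ∈ C × ∃[ y ] Arc (nextOnFace R) y C y × Unique C) Cs
      (All.tabulate λ {x} _ → serve′ x)
      (AllPairs.map (λ ns {C} → unrelated ns) (deduplicate-unrelated (sameFace? R) darts)))
    where
    open Cycles cs
    reps = deduplicate (sameFace? R) darts
    back : ∀ {C} → C ∈ Cs → ∀ {x y} → x ∈ List.iterate (nextOnFace R) y (length darts) → x ∈ C → y ∈ C
    back {C} C∈ {x} {y} x∈it x∈ with D , D∈ , y∈ ← find (complete y) with _ , p , _ ← All.lookup cycles D∈ =
      subst (y ∈_) (disjoint⇒≡ disjoint D∈ C∈ (iterates-∈ p y∈ (length darts) x∈it) x∈) y∈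
    serve : ∀ {C} → C ∈ Cs → (∃[ x ] Arc (nextOnFace R) x C x × Unique C × ∃[ y ] y ∈ C) → Any (_∈ C) reps
    serve {C} C∈ (_ , _ , _ , y , y∈) = Any.deduplicate⁺ (sameFace? R) (λ r → back C∈ r) (lose (∈-darts y) y∈)
    serve′ : ∀ x → Any (λ C → x ∈ C × ∃[ y ] Arc (nextOnFace R) y C y × Unique C) Cs
    serve′ x with C , C∈ , x∈ ← find (complete x) with y , p , u , _ ← All.lookup cycles C∈ = lose C∈ (x∈ , y , p , u)
    unrelated : ∀ {x x′ C} → ¬ (x′ ∈ List.iterate (nextOnFace R) x (length darts)) →
                x ∈ C × (∃[ y ] Arc (nextOnFace R) y C y × Unique C) → ¬ (x′ ∈ C × ∃[ y ] Arc (nextOnFace R) y C y × Unique C)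
    unrelated {x} {x′} ns (x∈ , y , p , u) (x∈′ , _) with as , bs , refl ← ∈-∃++ x∈ =
      ns (arc⇒iterates (length darts) (arc-rotate as p) (ℕ.≤-trans (ℕ.≤-reflexive (length-rotate as)) (length≤darts u))
           (moved (∈-++⁻ as x∈′)))
      where
      length-rotate : ∀ as {x bs} → length (x ∷ bs ++ as) ≡ length (as ++ x ∷ bs)
      length-rotate as {x} {bs} = ↭-length (++-comm (x ∷ bs) as)
      moved : x′ ∈ as ⊎ x′ ∈ x ∷ bs → x′ ∈ x ∷ bs ++ as
      moved (inj₁ q)           = there (∈-++⁺ʳ bs q)
      moved (inj₂ (here q))    = here q
      moved (inj₂ (there q))   = there (∈-++⁺ˡ q)

  module _ (T : SpanningTree multigraph) {d₀ : Dart} (C : Ribbon.TreeStep.Circuit R T d₀) where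
    open SpanningTree T using (edges)
    open TreeStep T
    open Circle C
    open Splitting multigraph pos pos-injective
      using (NonCrossing; swaps; swaps-∈; swaps-∉; module Decomposition; Decomposition; decompose)

    treeEdges : List Edge
    treeEdges = filter (_∈? edges) (allFin #E)

    chords : List Edge
    chords = nonTreeEdges graph T

    #edges : length treeEdges ℕ.+ length chords ≡ #E
    #edges = trans (length-filter+ (_∈? edges) (allFin #E)) (length-tabulate {n = #E} (λ x → x))

    -- Starts from the single cycle of the tour. It is applied twice: swapping the tree edges turns
    -- `step` into `next`, whose cycles are counted by the vertices, and swapping the chords turns
    -- it into `nextOnFace`, whose cycles are the faces.
    split : ∀ {f} es → Unique es → NonCrossing es → (∀ x → swaps es step x ≡ f x) →
            ∃[ Cs ] Cycles f Cs × length Cs ≡ length es ℕ.+ 1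
    split {f} es es! nc eq = convert (decompose es single nc es!)
      where
      single : Decomposition step es (circle ∷ [])
      single = record
        { cycles   = (d₀ , circle-arc , d₀ , start∈) ∷ []
        ; sorted   = circle-sorted ∷ []
        ; complete = λ x → here (circle-complete x)
        ; disjoint = [] ∷ []
        ; paired   = λ {x} _ → (λ _ → circle-complete (flip x)) ∷ []
        }
      convert : ∃[ Cs ] Decomposition (swaps es step) [] Cs × length Cs ≡ length es ℕ.+ 1 →
                ∃[ Cs ] Cycles f Cs × length Cs ≡ length es ℕ.+ 1
      convert (Cs , D , l) = Cs , record
        { cycles   = All.zipWith (λ { ((x , p , y) , s) →
                       x , arc-cong (All.tabulate λ {z} _ → eq z) p , AllPairs.map (λ { z<z refl → ℕ.<-irrefl refl z<z }) s , y })
                       (Decomposition.cycles D , Decomposition.sorted D)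
        ; complete = Decomposition.complete D
        ; disjoint = Decomposition.disjoint D
        } , l

    -- A tree edge crossing `d` would have one end on each side of the cut of `d`, but within the
    -- tree only `edge d` joins the two sides.
    treeEdges-noncrossing : NonCrossing treeEdges
    treeEdges-noncrossing d x d∈ x∈ d≢x (p , q) =
      side-≢ (trans (sym (cong (side ∘ tail) (flip-flip d)))
               (trans (sym (between-side {flip d} td (subst (λ z → [ flip d , flip x , z ]) (sym (flip-flip d)) q)))
                 (trans (sym (side-same x tx (d≢x ∘ sym))) (between-side {d} td p))))
      where
      td : Tree d
      td = proj₂ (∈-filter⁻ (_∈? edges) {xs = allFin #E} d∈)
      tx : Tree x
      tx = proj₂ (∈-filter⁻ (_∈? edges) {xs = allFin #E} x∈)
      open Side d td

    #treeEdges : length treeEdges ℕ.+ 1 ≡ #V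
    #treeEdges =
      let _ , cs , l = split treeEdges treeEdges! treeEdges-noncrossing to-next in trans (sym l) (#cycles-next d₀ cs)
      where
      treeEdges! : Unique treeEdges
      treeEdges! = Unique.filter⁺ (_∈? edges) (Unique.allFin⁺ #E)
      to-next : ∀ x → swaps treeEdges step x ≡ next x
      to-next x = go (tree? x)
        where
        go : Dec (Tree x) → swaps treeEdges step x ≡ next x
        go (yes t) = trans (swaps-∈ treeEdges step treeEdges! (∈-filter⁺ (_∈? edges) (∈-allFin (edge x)) t))
                           (step-flip {x} t)
        go (no ¬t) = trans (swaps-∉ treeEdges step (λ x∈ → ¬t (proj₂ (∈-filter⁻ (_∈? edges) {xs = allFin #E} x∈))))
                           (step-nontree {x} ¬t)

    noncrossing⇒planar : NonCrossing chords → Planar R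
    noncrossing⇒planar nc = begin
      ℤ.+ #V ℤ.- ℤ.+ #E ℤ.+ ℤ.+ #F R
        ≡⟨ cong₂ ℤ._+_ (cong₂ (λ v e → ℤ.+ v ℤ.- ℤ.+ e) (sym #treeEdges) (sym #edges)) (cong ℤ.+_ faces) ⟩
      ℤ.+ (t ℕ.+ 1) ℤ.- ℤ.+ (t ℕ.+ c) ℤ.+ ℤ.+ (c ℕ.+ 1)
        ≡⟨ cong₂ ℤ._+_ (cong₂ ℤ._-_ (ℤ.pos-+ t 1) (ℤ.pos-+ t c)) (ℤ.pos-+ c 1) ⟩
      (ℤ.+ t ℤ.+ ℤ.+ 1) ℤ.- (ℤ.+ t ℤ.+ ℤ.+ c) ℤ.+ (ℤ.+ c ℤ.+ ℤ.+ 1)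
        ≡⟨ cancel (ℤ.+ t) (ℤ.+ c) ⟩
      ℤ.+ 2 ∎
      where
      open ≡-Reasoning
      chords! : Unique chords
      chords! = Unique.filter⁺ (λ e → ¬? (e ∈? edges)) (Unique.allFin⁺ #E)
      t = length treeEdges
      c = length chords
      cancel : ∀ a b → (a ℤ.+ ℤ.+ 1) ℤ.- (a ℤ.+ b) ℤ.+ (b ℤ.+ ℤ.+ 1) ≡ ℤ.+ 2
      cancel = solve-∀
      to-face : ∀ x → swaps chords step x ≡ nextOnFace R x
      to-face x = go (tree? x)
        where
        go : Dec (Tree x) → swaps chords step x ≡ nextOnFace R x
        go (no ¬t) = trans (swaps-∈ chords step chords! (∈-filter⁺ (λ e → ¬? (e ∈? edges)) (∈-allFin (edge x)) ¬t))
                           (step-nontree {flip x} ¬t)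
        go (yes t) = trans (swaps-∉ chords step (λ x∈ → proj₂ (∈-filter⁻ (λ e → ¬? (e ∈? edges)) {xs = allFin #E} x∈) t))
                           (step-tree {x} t)
      faces : #F R ≡ c ℕ.+ 1
      faces = let _ , cs , l = split chords chords! nc to-face in trans (cong (1 ⊔_) (trans (sym (#cycles-face cs)) l))
                    (ℕ.m≤n⇒m⊔n≡n (ℕ.m≤n+m 1 c))

-- Crossing chords

module Chords (R : RibbonGraph) (T : SpanningTree (RibbonGraph.multigraph R))
              {d₀ : RibbonGraph.Dart R} (C : Ribbon.TreeStep.Circuit R T d₀) where
  open RibbonGraph R
  open Ribbon R
  open TreeStep T
  open Circle C
  open Counting R

  Alternating : Dart → Dart → Dart → Dart → Set
  Alternating a b c e = [ a , b , c ] × [ c , e , a ]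

  alternating-rot : ∀ {a b c e} → Alternating a b c e → Alternating b c e a
  alternating-rot (abc , cea) = bcd abc (rot (rot cea)) , bcd cea (rot (rot abc))

  nonalternating : ∀ {a b c e} → Alternating a b c e → tail a ≡ tail c → tail b ≡ tail e → tail a ≡ tail b
  nonalternating (abc , cea) = tails-nonalternating abc cea

  Crossing : Dart → Dart → Set
  Crossing d x = Alternating d x (flip d) (flip x)

  -- A quarter turn of the four darts `d`, `x`, `flip d`, `flip x`; repeating it gives the crossing
  -- in every orientation.
  crossing-rot : ∀ {d x} → Crossing d x → Crossing x (flip d)
  crossing-rot {d} {x} c = subst (Alternating x (flip d) (flip x)) (sym (flip-flip d)) (alternating-rot c)

  -- x′ crosses d at the tail of x, but in the opposite direction.
  record Opposite (d x x′ : Dart) : Set where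
    constructor opposite
    field
      chord     : ¬ Tree x′
      tail≡ : tail x′ ≡ tail x
      behind    : [ flip d , x′ , d ]
      ahead     : [ d , flip x′ , flip d ]

  module Balanced (balance : ∀ d x → ¬ Tree d → ¬ Tree x → Crossing d x → ∃[ x′ ] Opposite d x x′) where

    -- Balance at (d , x), (x , flip d) and (flip x , d) yields z, y and w. Depending on the position of z, two darts
    -- at head d or two darts at tail d alternate with x and z.
    crossing-end : ∀ d x → ¬ Tree d → ¬ Tree x → Crossing d x → tail x ≡ tail d ⊎ tail x ≡ head d
    crossing-end d x ¬d ¬x c@(d-x-fd , fd-fx-d) with tail x Fin.≟ tail d | tail x Fin.≟ head d
    ... | yes eq | _      = inj₁ eq
    ... | no _   | yes eq = inj₂ eq
    ... | no x≁d | no x≁fd = ⊥-elim (go (total (≢₁₂ fd-z-d) z≢fx (≢₁₂ fd-fx-d)))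
      where
      c₁ : Crossing x (flip d)
      c₁ = crossing-rot c
      c₂ : Crossing (flip x) d
      c₂ = subst (Crossing (flip x)) (flip-flip d) (crossing-rot (crossing-rot c₁))
      op  = balance d x ¬d ¬x c
      op₁ = balance x (flip d) ¬x ¬d c₁
      op₂ = balance (flip x) d ¬x ¬d c₂
      z = proj₁ op
      y = proj₁ op₁
      w = proj₁ op₂
      z~x : tail z ≡ tail x
      z~x = Opposite.tail≡ (proj₂ op)
      fd-z-d : [ flip d , z , d ]
      fd-z-d = Opposite.behind (proj₂ op)
      y~fd : tail y ≡ head d
      y~fd = Opposite.tail≡ (proj₂ op₁)
      fx-y-x : [ flip x , y , x ]
      fx-y-x = Opposite.behind (proj₂ op₁)
      w~d : tail w ≡ tail d
      w~d = Opposite.tail≡ (proj₂ op₂)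
      x-w-fx : [ x , w , flip x ]
      x-w-fx = subst (λ v → [ v , w , flip x ]) (flip-flip x) (Opposite.behind (proj₂ op₂))
      z≢fx : z ≢ flip x
      z≢fx eq = tail≢head x (trans (sym z~x) (cong tail eq))
      fd-d-x : [ flip d , d , x ]
      fd-d-x = rot (rot d-x-fd)
      fd-z-x : [ flip d , z , x ]
      fd-z-x = abd fd-z-d fd-d-x
      x-z-d : [ x , z , d ]
      x-z-d = rot (rot (bcd fd-z-d fd-d-x))

      go : [ flip d , z , flip x ] ⊎ [ flip d , flip x , z ] → ⊥
      -- The cyclic order is `x`, `flip d`, `z`, `flip x`, `y`: here `y` and `flip d` at `head d`
      -- alternate with `x` and `z`.
      go (inj₁ fd-z-fx) = x≁fd (trans (sym (nonalternating (y-x-fd , fd-z-y) y~fd (sym z~x))) y~fd)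
        where
        x-fd-z : [ x , flip d , z ]
        x-fd-z = rot (rot fd-z-x)
        x-z-y : [ x , z , y ]
        x-z-y = abd (rot (rot (bcd fd-z-fx (abd fd-fx-d fd-d-x)))) (rot (rot fx-y-x))
        fd-z-y : [ flip d , z , y ]
        fd-z-y = bcd x-fd-z x-z-y
        y-x-fd : [ y , x , flip d ]
        y-x-fd = rot (rot (abd x-fd-z x-z-y))
      -- The cyclic order is `x`, `w`, `flip x`, `z`, `d`: here `d` and `w` at `tail d` alternate
      -- with `x` and `z`.
      go (inj₂ fd-fx-z) = x≁d (sym (nonalternating (rot (rot (abd x-w-z x-z-d)) , bcd x-w-z x-z-d) (sym w~d) (sym z~x)))
        where
        x-w-z : [ x , w , z ]
        x-w-z = abd x-w-fx (rot (rot (bcd fd-fx-z fd-z-x)))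

    -- Infinite descent: among parallel crossing chords, each has one before it at their common tail.
    module Parallel (y₀ : Dart) (X : Vertex) (X≢Y : X ≢ tail y₀) where

      record Crossed (d : Dart) : Set where
        field
          chord    : ¬ Tree d
          tail≡    : tail d ≡ X
          head≡    : head d ≡ tail y₀
          {other}  : Dart
          chord′   : ¬ Tree other
          crossing : Crossing d other

      module _ {d : Dart} (cr : Crossed d) where
        open Crossed cr

        earlier-behind : ∃[ d′ ] Crossed d′ × [ flip d , d′ , d ]
        earlier-behind with crossing-end d other chord chord′ crossing
        -- If `other` starts at `head d`, it runs against `d`, and its reverse is the new chord. If
        -- it starts at `tail d`, it lies on the wrong arc, and balance supplies a chord at the same
        -- vertex on the arc from `flip d` to `d`.
        ... | inj₂ x~fd = flip other , record
          { chord    = chord′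
          ; tail≡    = Sum.[ (λ eq → ⊥-elim (tail≢head other (trans x~fd (sym eq))))
                          , (λ eq → trans eq (trans (cong tail (flip-flip d)) tail≡)) ]′
                       (crossing-end (flip d) (flip other) chord chord′ (crossing-rot (crossing-rot crossing)))
          ; head≡    = trans (cong tail (flip-flip other)) (trans x~fd head≡)
          ; chord′   = chord
          ; crossing = subst (Crossing (flip other)) (flip-flip d) (crossing-rot (crossing-rot (crossing-rot crossing)))
          } , proj₂ crossing
        ... | inj₁ x~d with x , opposite ¬x x~ behind ahead ← balance d other chord chord′ crossing
          = x , record
          { chord    = ¬x
          ; tail≡    = trans x~ (trans x~d tail≡)
          ; head≡    = Sum.[ (λ eq → ⊥-elim (tail≢head x (trans x~ (trans x~d (sym eq))))) , (λ eq → trans eq head≡) ]′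
                      (crossing-end d (flip x) chord ¬x cross)
          ; chord′   = chord
          ; crossing = subst (Crossing x) (flip-flip d) (subst (λ v → Crossing v (flip (flip d))) (flip-flip x)
                         (crossing-rot (crossing-rot (crossing-rot cross))))
          } , behind
          where
          cross : Crossing d (flip x)
          cross = ahead , subst (λ v → [ flip d , v , d ]) (sym (flip-flip x)) behind

      -- `earlier-behind` measures from `flip d`, which varies; the descent requires the fixed
      -- origin `y₀`. Were `y₀` between `d′` and `d`, then `d` and `d′` at `X` would alternate with
      -- `flip d` and `y₀` at the other end.
      earlier : ∀ {d} → Crossed d → ∃[ d′ ] Crossed d′ × [ y₀ , d′ , d ]
      earlier {d} cr with d′ , cr′ , fd-d′-d ← earlier-behind cr = d′ , cr′ , before
        where
        open Crossed cr
        d≢y₀ : d ≢ y₀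
        d≢y₀ refl = X≢Y (sym tail≡)
        d′≢y₀ : d′ ≢ y₀
        d′≢y₀ refl = X≢Y (sym (Crossed.tail≡ cr′))
        before : [ y₀ , d′ , d ]
        before with flip d ≟ᴰ y₀
        ... | yes refl = fd-d′-d
        ... | no fd≢y₀ with total (≢₁₂ fd-d′-d) d′≢y₀ fd≢y₀ | total (≢₁₃ fd-d′-d) d≢y₀ fd≢y₀
        ...   | inj₂ fd-y-d′ | _           = bcd fd-y-d′ fd-d′-d
        ...   | inj₁ fd-d′-y | inj₁ fd-d-y = rot (rot (bcd fd-d′-d fd-d-y))
        ...   | inj₁ fd-d′-y | inj₂ fd-y-d = ⊥-elim (X≢Y (trans (sym tail≡)
          (trans (nonalternating (rot (rot fd-d′-d) , bcd fd-d′-y fd-y-d) (trans tail≡ (sym (Crossed.tail≡ cr′))) head≡) head≡)))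

      -- Position counted from `y₀`: darts not behind `y₀` in the list are moved past its end by an
      -- offset that exceeds every position, so that the cyclic order seen from `y₀` becomes `<`.
      rank : Dart → ℕ
      rank d = if does (pos y₀ ℕ.<? pos d) then pos d else suc (length circle) ℕ.+ pos d

      rank-above : ∀ {d} → pos y₀ < pos d → rank d ≡ pos d
      rank-above {d} p = cong (if_then pos d else (suc (length circle) ℕ.+ pos d)) (dec-true (pos y₀ ℕ.<? pos d) p)

      rank-below : ∀ {d} → pos d < pos y₀ → rank d ≡ suc (length circle) ℕ.+ pos d
      rank-below {d} p = cong (if_then pos d else (suc (length circle) ℕ.+ pos d))
                              (dec-false (pos y₀ ℕ.<? pos d) (ℕ.<-asym p))

      rank-< : ∀ {a b} → [ y₀ , a , b ] → rank a < rank b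
      rank-< {a} {b} (cyc p) = go p
        where
        go : Cyc (pos y₀) (pos a) (pos b) → rank a < rank b
        go (inj₁ (y<a , a<b)) =
          subst₂ _<_ (sym (rank-above {a} y<a)) (sym (rank-above {b} (ℕ.<-trans y<a a<b))) a<b
        go (inj₂ (inj₁ (a<b , b<y))) =
          subst₂ _<_ (sym (rank-below {a} (ℕ.<-trans a<b b<y))) (sym (rank-below {b} b<y))
                 (ℕ.+-monoʳ-< (suc (length circle)) a<b)
        go (inj₂ (inj₂ (b<y , y<a))) =
          subst₂ _<_ (sym (rank-above {a} y<a)) (sym (rank-below {b} b<y))
                 (ℕ.<-≤-trans (pos-bounded a) (ℕ.m≤m+n _ (pos b)))

      uncrossed : ∀ n {d} → rank d < n → ¬ Crossed d
      uncrossed (suc n) (s≤s r≤n) cr with d′ , cr′ , before ← earlier cr =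
        uncrossed n (ℕ.<-≤-trans (rank-< before) r≤n) cr′

    noncrossing : ∀ d x → ¬ Tree d → ¬ Tree x → ¬ Crossing d x
    noncrossing d x ¬d ¬x c = Parallel.uncrossed (flip d) (tail d) (tail≢head d) _ ℕ.≤-refl (record
      { chord = ¬d ; tail≡ = refl ; head≡ = refl ; chord′ = ¬x ; crossing = c })

  Unbalanced : Dart → Dart → Set
  Unbalanced d x = ¬ Tree d × ¬ Tree x × Crossing d x × ¬ Any (Opposite d x) darts

  crossing? : ∀ d x → Dec (Crossing d x)
  crossing? d x = [ d , x , flip d ]? ×-dec [ flip d , flip x , d ]?

  opposite? : ∀ d x x′ → Dec (Opposite d x x′)
  opposite? d x x′ with ¬? (tree? x′) ×-dec (tail x′ Fin.≟ tail x) ×-dec [ flip d , x′ , d ]? ×-dec [ d , flip x′ , flip d ]?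
  ... | yes (p , q , r , s) = yes (opposite p q r s)
  ... | no ¬o               = no λ { (opposite p q r s) → ¬o (p , q , r , s) }

  unbalanced? : ∀ d x → Dec (Unbalanced d x)
  unbalanced? d x = ¬? (tree? d) ×-dec ¬? (tree? x) ×-dec crossing? d x ×-dec ¬? (any? (opposite? d x) darts)

  -- A search through the finitely many pairs of darts; if it fails, every crossing is balanced, no
  -- chords cross, and `R` is planar.
  nonplanar⇒unbalanced : NonPlanar R → ∃[ d ] ∃[ x ] Unbalanced d x
  nonplanar⇒unbalanced np with any? (λ d → any? (unbalanced? d) darts) darts
  ... | yes some = let d , _ , q = find some ; x , _ , u = find q in d , x , u
  ... | no none  = ⊥-elim (np (noncrossing⇒planar T C λ d x d∈ x∈ _ →
                     Balanced.noncrossing balance d x (chord d d∈) (chord x x∈)))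
    where
    chord : ∀ d → edge d ∈ nonTreeEdges graph T → ¬ Tree d
    chord d d∈ = proj₂ (∈-filter⁻ (λ e → ¬? (e ∈? SpanningTree.edges T)) {xs = allFin #E} d∈)
    balance : ∀ d x → ¬ Tree d → ¬ Tree x → Crossing d x → ∃[ x′ ] Opposite d x x′
    balance d x ¬d ¬x c with any? (opposite? d x) darts
    ... | yes some = let x′ , _ , o = find some in x′ , o
    ... | no ¬some = ⊥-elim (none (lose (∈-darts d) (lose (∈-darts x) (¬d , ¬x , c , ¬some))))

-- Squares of integers

i≤i*i : ∀ i → i ℤ.≤ i * i
i≤i*i (ℤ.+ zero)    = ℤ.≤-refl
i≤i*i (ℤ.+ (suc n)) = subst (ℤ.+ (suc n) ℤ.≤_) (ℤ.pos-* (suc n) (suc n)) (ℤ.+≤+ (ℕ.m≤m*n (suc n) (suc n)))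
i≤i*i -[1+ n ]      = ℤ.-≤+

-i≤i*i : ∀ i → - i ℤ.≤ i * i
-i≤i*i i = subst (- i ℤ.≤_) (square i) (i≤i*i (- i))
  where
  square : ∀ i → (- i) * (- i) ≡ i * i
  square = solve-∀

0≤i*i : ∀ i → 0ℤ ℤ.≤ i * i
0≤i*i (ℤ.+ n)  = subst (0ℤ ℤ.≤_) (ℤ.pos-* n n) (ℤ.+≤+ z≤n)
0≤i*i -[1+ n ] = ℤ.+≤+ z≤n

0<i*i : ∀ {i} → i ≢ 0ℤ → 0ℤ ℤ.< i * i
0<i*i {ℤ.+ zero}    i≢0 = ⊥-elim (i≢0 refl)
0<i*i {ℤ.+ (suc n)} i≢0 = ℤ.+<+ (s≤s z≤n)
0<i*i { -[1+ n ]}   i≢0 = ℤ.+<+ (s≤s z≤n)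

-- Linear equivalence

module Laplacian (G : Graph) where
  open Graph G

  -- The contribution of `e` to `Δ h` at `u`, written as a product of two differences so that it is
  -- independent of the orientation of `e`.
  edgeTerm : (Vertex → ℤ) → Vertex → Edge → ℤ
  edgeTerm h u e = (h (end e false) - h (end e true)) * (δ (end e false) u - δ (end e true) u)

  edgeTerm-dart : ∀ h u d → edgeTerm h u (edge d) ≡ (h (tail d) - h (head d)) * (δ (tail d) u - δ (head d) u)
  edgeTerm-dart h u (e , false) = refl
  edgeTerm-dart h u (e , true)  = reverse (h (end e false)) (h (end e true)) (δ (end e false) u) (δ (end e true) u)
    where
    reverse : ∀ a b c d → (a - b) * (c - d) ≡ (b - a) * (d - c)
    reverse = solve-∀

  Δ-∑ : ∀ h u → Δ G h u ≡ ∑ (allFin #E) (edgeTerm h u)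
  Δ-∑ h u = begin
    Δ G h u
      ≡⟨ ∑-filter (λ d → tail d Fin.≟ u) (λ d → h u - h (head d)) darts ⟩
    ∑ darts (λ d → if does (tail d Fin.≟ u) then h u - h (head d) else 0ℤ)
      ≡⟨ ∑-cong darts at-tail ⟩
    ∑ darts (λ d → (h (tail d) - h (head d)) * δ (tail d) u)
      ≡⟨ ∑-× _ (allFin #E) ⟩
    ∑ (allFin #E) (λ e → (h (end e false) - h (end e true)) * δ (end e false) u + (h (end e true) - h (end e false)) * δ (end e true) u)
      ≡⟨ ∑-cong (allFin #E) (λ e → collect (h (end e false)) (h (end e true)) (δ (end e false) u) (δ (end e true) u)) ⟩
    ∑ (allFin #E) (edgeTerm h u) ∎
    where
    open ≡-Reasoning
    collect : ∀ a b c d → (a - b) * c + (b - a) * d ≡ (a - b) * (c - d)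
    collect = solve-∀
    at-tail : ∀ d → (if does (tail d Fin.≟ u) then h u - h (head d) else 0ℤ) ≡ (h (tail d) - h (head d)) * δ (tail d) u
    at-tail d with tail d Fin.≟ u
    ... | yes refl = sym (ℤ.*-identityʳ _)
    ... | no _     = sym (ℤ.*-zeroʳ (h (tail d) - h (head d)))

  pair-δ : ∀ (φ : Vertex → ℤ) v → ∑ (allFin #V) (λ u → φ u * δ v u) ≡ φ v
  pair-δ φ v = trans (∑-pick (Unique.allFin⁺ #V) (∈-allFin v) (λ u u≢v → trans (cong (φ u *_) (δ-≢ (u≢v ∘ sym))) (ℤ.*-zeroʳ (φ u))))
                     (trans (cong (φ v *_) (δ-≡ v)) (ℤ.*-identityʳ (φ v)))

  pair-δ-δ : ∀ (φ : Vertex → ℤ) v w → ∑ (allFin #V) (λ u → φ u * (δ v u - δ w u)) ≡ φ v - φ w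
  pair-δ-δ φ v w = begin
    ∑ (allFin #V) (λ u → φ u * (δ v u - δ w u))
      ≡⟨ ∑-cong (allFin #V) (λ u → distrib (φ u) (δ v u) (δ w u)) ⟩
    ∑ (allFin #V) (λ u → φ u * δ v u - φ u * δ w u)
      ≡⟨ ∑-- _ _ (allFin #V) ⟩
    ∑ (allFin #V) (λ u → φ u * δ v u) - ∑ (allFin #V) (λ u → φ u * δ w u)
      ≡⟨ cong₂ _-_ (pair-δ φ v) (pair-δ φ w) ⟩
    φ v - φ w ∎
    where
    open ≡-Reasoning
    distrib : ∀ a b c → a * (b - c) ≡ a * b - a * c
    distrib = solve-∀

  pair-∑ : ∀ (φ : Vertex → ℤ) (t : Edge → Vertex → ℤ) →
           ∑ (allFin #V) (λ u → φ u * ∑ (allFin #E) (λ e → t e u)) ≡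
           ∑ (allFin #E) (λ e → ∑ (allFin #V) (λ u → φ u * t e u))
  pair-∑ φ t = trans (∑-cong (allFin #V) (λ u → sym (∑-*ˡ (φ u) (λ e → t e u) (allFin #E))))
                     (∑-swap (λ u e → φ u * t e u) (allFin #V) (allFin #E))

  module _ (T : SpanningTree multigraph) where
    open SpanningTree T using (edges)

    -- Extension by zero to tree edges, so that sums over chords can be compared termwise with
    -- Laplacian sums over all edges.
    chordTerm : (Edge → ℤ) → Edge → ℤ
    chordTerm t e = if does (¬? (e ∈? edges)) then t e else 0ℤ

    chordTerm-chord : ∀ t {e} → ¬ e Subset.∈ edges → chordTerm t e ≡ t e
    chordTerm-chord t {e} e∉ = cong (if_then t e else 0ℤ) (dec-true (¬? (e ∈? edges)) e∉)

    chordTerm-tree : ∀ t {e} → e Subset.∈ edges → chordTerm t e ≡ 0ℤ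
    chordTerm-tree t {e} e∈ = cong (if_then t e else 0ℤ) (dec-false (¬? (e ∈? edges)) (λ e∉ → e∉ e∈))

    -- The `T`-break divisor with ends chosen by `s′` minus the one with ends chosen by `s`.
    moved : (Edge → Bool) → (Edge → Bool) → Vertex → ℤ
    moved s s′ u = ∑ (allFin #E) (chordTerm (λ e → δ (end e (s′ e)) u - δ (end e (s e)) u))

    -- Pairing the difference Δ h of two T-break divisors with h gives Σ dh² over all edges on one side, and at
    -- most Σ |dh| over the non-tree edges on the other; hence dh = 0 on T, and h is constant.
    break-unique : ∀ s s′ h → (∀ u → moved s s′ u ≡ Δ G h u) → ∀ u → moved s s′ u ≡ 0ℤ
    break-unique s s′ h eq u = trans (eq u) (trans (Δ-∑ h u) (∑-0 (allFin #E) λ {e} _ →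
      trans (cong (_* (δ (end e false) u - δ (end e true) u)) (dh≡0 e)) (ℤ.*-zeroˡ (δ (end e false) u - δ (end e true) u))))
      where
      dh : Edge → ℤ
      dh e = h (end e false) - h (end e true)

      rise : Edge → ℤ
      rise = chordTerm (λ e → h (end e (s′ e)) - h (end e (s e)))

      energy : ∑ (allFin #E) rise ≡ ∑ (allFin #E) (λ e → dh e * dh e)
      energy = begin
        ∑ (allFin #E) rise
          ≡⟨ ∑-cong (allFin #E) pair-rise ⟨
        ∑ (allFin #E) (λ e → ∑ (allFin #V) (λ u → h u * chordTerm (λ e → δ (end e (s′ e)) u - δ (end e (s e)) u) e))
          ≡⟨ pair-∑ h _ ⟨
        ∑ (allFin #V) (λ u → h u * moved s s′ u)
          ≡⟨ ∑-cong (allFin #V) (λ u → cong (h u *_) (trans (eq u) (Δ-∑ h u))) ⟩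
        ∑ (allFin #V) (λ u → h u * ∑ (allFin #E) (edgeTerm h u))
          ≡⟨ pair-∑ h _ ⟩
        ∑ (allFin #E) (λ e → ∑ (allFin #V) (λ u → h u * edgeTerm h u e))
          ≡⟨ ∑-cong (allFin #E) pair-term ⟩
        ∑ (allFin #E) (λ e → dh e * dh e) ∎
        where
        open ≡-Reasoning
        pair-rise : ∀ e → ∑ (allFin #V) (λ u → h u * chordTerm (λ e → δ (end e (s′ e)) u - δ (end e (s e)) u) e) ≡ rise e
        pair-rise e with does (¬? (e ∈? edges))
        ... | true  = pair-δ-δ h (end e (s′ e)) (end e (s e))
        ... | false = ∑-0 (allFin #V) (λ {u} _ → ℤ.*-zeroʳ (h u))
        commute : ∀ a b c → a * (b * c) ≡ b * (a * c)
        commute = solve-∀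
        pair-term : ∀ e → ∑ (allFin #V) (λ u → h u * edgeTerm h u e) ≡ dh e * dh e
        pair-term e = trans (∑-cong (allFin #V) (λ u → commute (h u) (dh e) (δ (end e false) u - δ (end e true) u)))
                            (trans (∑-*ˡ (dh e) _ (allFin #V)) (cong (dh e *_) (pair-δ-δ h (end e false) (end e true))))

      -- Along a chord `h` changes by 0, `dh e` or its negative, and an integer is at most its
      -- square.
      rise-≤ : ∀ e → rise e ℤ.≤ dh e * dh e
      rise-≤ e with does (¬? (e ∈? edges))
      ... | false = 0≤i*i (dh e)
      ... | true  = by-sides (s e) (s′ e)
        where
        negate : ∀ a b → - (a - b) ≡ b - a
        negate = solve-∀
        by-sides : ∀ b b′ → h (end e b′) - h (end e b) ℤ.≤ dh e * dh e
        by-sides false false = subst (ℤ._≤ dh e * dh e) (sym (ℤ.+-inverseʳ (h (end e false)))) (0≤i*i (dh e))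
        by-sides true  true  = subst (ℤ._≤ dh e * dh e) (sym (ℤ.+-inverseʳ (h (end e true)))) (0≤i*i (dh e))
        by-sides true  false = i≤i*i (dh e)
        by-sides false true  = subst (ℤ._≤ dh e * dh e) (negate (h (end e false)) (h (end e true))) (-i≤i*i (dh e))

      dh-tree : ∀ e → e Subset.∈ edges → dh e ≡ 0ℤ
      dh-tree e e∈ with dh e ℤ.≟ 0ℤ
      ... | yes dh≡0 = dh≡0
      ... | no dh≢0  = ⊥-elim (ℤ.<-irrefl energy (∑-mono-< rise-≤ (∈-allFin e)
              (subst (ℤ._< dh e * dh e) (sym (chordTerm-tree (λ e → h (end e (s′ e)) - h (end e (s e))) e∈)) (0<i*i dh≢0))))

      h-tree : ∀ d → edge d Subset.∈ edges → h (tail d) ≡ h (head d)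
      h-tree (e , false) e∈ = ℤ.i-j≡0⇒i≡j _ _ (dh-tree e e∈)
      h-tree (e , true)  e∈ = sym (ℤ.i-j≡0⇒i≡j _ _ (dh-tree e e∈))

      dh≡0 : ∀ e → dh e ≡ 0ℤ
      dh≡0 e = ℤ.i≡j⇒i-j≡0 (Walks.conn-invariant multigraph (Subset._∈ edges) h h-tree
                 (SpanningTree.connected T (end e false) (end e true)))

  formalSum-∑ : ∀ vs u → formalSum G vs u ≡ ∑ vs (λ v → δ v u)
  formalSum-∑ []       u = refl
  formalSum-∑ (v ∷ vs) u with does (v Fin.≟ u)
  ... | true  = cong (1ℤ +_) (formalSum-∑ vs u)
  ... | false = trans (formalSum-∑ vs u) (sym (ℤ.+-identityˡ _))

  deg-formalSum : ∀ vs → deg G (formalSum G vs) ≡ ℤ.+ length vs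
  deg-formalSum vs = begin
    deg G (formalSum G vs)                                 ≡⟨ ∑-cong (allFin #V) (formalSum-∑ vs) ⟩
    ∑ (allFin #V) (λ u → ∑ vs (λ v → δ v u))               ≡⟨ ∑-swap (λ u v → δ v u) (allFin #V) vs ⟩
    ∑ vs (λ v → ∑ (allFin #V) (λ u → δ v u))               ≡⟨ ∑-cong vs (λ v → trans (∑-cong (allFin #V) (λ u → sym (ℤ.*-identityˡ (δ v u)))) (pair-δ (λ _ → 1ℤ) v)) ⟩
    ∑ vs (λ v → 1ℤ)                                        ≡⟨ ∑-1 vs ⟩
    ℤ.+ length vs                                          ∎
    where open ≡-Reasoning

  -- Linear equivalence depends only on the difference of the divisors, so rearrangements reduce to
  -- ring identities.
  ∼-resp : ∀ {D D′ E E′} → (∀ u → D u - D′ u ≡ E u - E′ u) → _∼_ G E E′ → _∼_ G D D′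
  ∼-resp eq (h , p) = h , λ u → trans (eq u) (p u)

  module ∼ = IsEquivalence (∼-isEquivalence G)

  ∼-reflexive : ∀ {D D′} → (∀ u → D u ≡ D′ u) → _∼_ G D D′
  ∼-reflexive {D} {D′} eq = ∼-resp {D} {D′} {D} {D} (λ u → cong (λ z → D u - z) (sym (eq u))) (∼.refl {D})

-- Change of the starting dart

module Bernardi (R : RibbonGraph) where
  open RibbonGraph R
  open Ribbon R
  open Laplacian graph

  κ : Dart → Divisor graph
  κ d u = δ (head d) u - δ (tail d) u

  module Firsts (T : SpanningTree multigraph) where
    open TreeStep T

    -- On chords `firstCut` succeeds, by `firstCut-just`, so that the default `false` is never
    -- reached there.
    first : Dart → Edge → Bool
    first d f = maybe′ proj₂ false (Tour.firstCut R T d f)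

    sideTerm : Dart → Vertex → Edge → ℤ
    sideTerm d u e = δ (end e (first d e)) u

    module WithCircle {d₀ : Dart} (C : Circuit d₀) where
      open Circle C
      open Chords R T C using (Unbalanced; Opposite; opposite)

      firstCut-just : ∀ d {f} → ¬ f Subset.∈ SpanningTree.edges T → Tour.firstCut R T d f ≡ just (f , first d f)
      firstCut-just d {f} f∉ = let b , eq , _ = firstCut-first d f f∉ in
        trans eq (cong (λ m → just (f , maybe′ proj₂ false m)) (sym eq))

      first-spec : ∀ d {f} → ¬ f Subset.∈ SpanningTree.edges T →
                   (f , first d f) ≡ d ⊎ [ d , (f , first d f) , flip (f , first d f) ]
      first-spec d {f} f∉ = let b , eq , p = firstCut-first d f f∉ in
        subst (λ b → (f , b) ≡ d ⊎ [ d , (f , b) , flip (f , b) ]) (cong (maybe′ proj₂ false) (sym eq)) p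

      β-break : ∀ d u → β R d T u ≡ formalSum graph (map (λ e → end e (first d e)) (nonTreeEdges graph T)) u
      β-break d u = cong (λ vs → formalSum graph vs u) (ends (nonTreeEdges graph T) λ e∈ →
        proj₂ (∈-filter⁻ (λ e → ¬? (e ∈? SpanningTree.edges T)) {xs = allFin #E} e∈))
        where
        ends : ∀ es → (∀ {e} → e ∈ es → ¬ e Subset.∈ SpanningTree.edges T) →
               map tail (mapMaybe (Tour.firstCut R T d) es) ≡ map (λ e → end e (first d e)) es
        ends []       _  = refl
        ends (e ∷ es) ∉T = trans (cong (λ m → map tail (List.catMaybes (m ∷ map (Tour.firstCut R T d) es))) (firstCut-just d (∉T (here refl))))
                                 (cong (end e (first d e) ∷_) (ends es (∉T ∘ there)))

      β-∑ : ∀ d u → β R d T u ≡ ∑ (allFin #E) (chordTerm T (sideTerm d u))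
      β-∑ d u = begin
        β R d T u                                                                          ≡⟨ β-break d u ⟩
        formalSum graph (map (λ e → end e (first d e)) (nonTreeEdges graph T)) u           ≡⟨ formalSum-∑ (map (λ e → end e (first d e)) (nonTreeEdges graph T)) u ⟩
        ∑ (map (λ e → end e (first d e)) (nonTreeEdges graph T)) (λ v → δ v u)             ≡⟨ cong sumℤ (map-∘ (nonTreeEdges graph T)) ⟨
        ∑ (nonTreeEdges graph T) (sideTerm d u)                                            ≡⟨ ∑-filter (λ e → ¬? (e ∈? SpanningTree.edges T)) (sideTerm d u) (allFin #E) ⟩
        ∑ (allFin #E) (chordTerm T (sideTerm d u))                                         ∎
        where open ≡-Reasoning

      deg-β : ∀ d → deg graph (β R d T) ≡ ℤ.+ length (nonTreeEdges graph T)
      deg-β d = trans (∑-cong (allFin #V) (β-break d)) (trans (deg-formalSum (map (λ e → end e (first d e)) (nonTreeEdges graph T)))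
                  (cong ℤ.+_ (length-map (λ e → end e (first d e)) (nonTreeEdges graph T))))

      step-≢ : ∀ d → step d ≢ d
      step-≢ d eq with between (flip-≢ {d} ∘ sym)
      ... | record { between = as ; arc = _ ∷ p ; sound = sound } with arc-start p
      ...   | inj₁ sd∈  = ≢₁₂ (sound sd∈) (sym eq)
      ...   | inj₂ sd≡  = flip-≢ {d} (trans (sym sd≡) eq)

      first-unique : ∀ {a} x → ¬ Tree x → [ a , x , flip x ] → first a (edge x) ≡ proj₂ x
      first-unique {a} x ¬x a-x-fx with first-spec a ¬x
      ... | inj₁ eq with dart-cases (edge x , first a (edge x)) x refl
      ...   | inj₁ eq′ = cong proj₂ eq′
      ...   | inj₂ eq′ = ⊥-elim (≢₁₃ a-x-fx (trans (sym eq) eq′))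
      first-unique {a} x ¬x a-x-fx | inj₂ p with dart-cases (edge x , first a (edge x)) x refl
      ...   | inj₁ eq′ = cong proj₂ eq′
      ...   | inj₂ eq′ = ⊥-elim (asym a-x-fx (subst (λ v → [ a , flip x , v ]) (flip-flip x)
                           (subst (λ y → [ a , y , flip y ]) eq′ p)))

      first-self : ∀ d → ¬ Tree d → first d (edge d) ≡ proj₂ d
      first-self d ¬d with dart-cases (edge d , first d (edge d)) d refl
      ... | inj₁ eq = cong proj₂ eq
      ... | inj₂ eq with first-spec d ¬d
      ...   | inj₁ eq′ = cong proj₂ eq′
      ...   | inj₂ p   = ⊥-elim (≢₁₃ p (sym (trans (cong flip eq) (flip-flip d))))

      -- Seen from `step d`, the dart `d` comes last, hence after its reverse.
      first-step-self : ∀ d → ¬ Tree d → first (step d) (edge d) ≡ not (proj₂ d)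
      first-step-self d ¬d with dart-cases (edge d , first (step d) (edge d)) d refl
      ... | inj₂ eq = cong proj₂ eq
      ... | inj₁ eq with first-spec (step d) ¬d
      ...   | inj₁ eq′ = ⊥-elim (step-≢ d (trans (sym eq′) eq))
      ...   | inj₂ p   = ⊥-elim (step-adjacent (rot (subst (λ y → [ step d , y , flip y ]) eq p)))

      first-step : ∀ {a f} → ¬ f Subset.∈ SpanningTree.edges T → f ≢ edge a → first (step a) f ≡ first a f
      first-step {a} {f} f∉ f≢a = sym (first-unique x f∉ a-x-fx)
        where
        x = f , first (step a) f
        a≢x : a ≢ x
        a≢x eq = f≢a (sym (cong proj₁ eq))
        a≢fx : a ≢ flip x
        a≢fx eq = f≢a (sym (cong proj₁ eq))
        a-x-fx : [ a , x , flip x ]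
        a-x-fx with total a≢x (flip-≢ ∘ sym) a≢fx | first-spec (step a) f∉
        ... | inj₁ p | _      = p
        ... | inj₂ p | inj₁ eq = ⊥-elim (step-adjacent (subst (λ v → [ a , flip x , v ]) eq p))
        ... | inj₂ p | inj₂ q with total (step-≢ a ∘ sym) (≢₁₃ q) a≢fx
        ...   | inj₁ r = ⊥-elim (asym q (bcd r p))
        ...   | inj₂ r = ⊥-elim (step-adjacent r)

      -- A chord other than `edge d` crosses it or has both darts on one of the two arcs. Only a
      -- crossing chord is cut from its other end when the tour starts at `flip d`.
      data Compare (d : Dart) (f : Edge) : Set where
        crosses : let y = f , first d f in
                  [ d , y , flip d ] → [ flip d , flip y , d ] → first (flip d) f ≡ not (first d f) → Compare d f
        inside  : (∀ y → edge y ≡ f → [ d , y , flip d ]) → first (flip d) f ≡ first d f → Compare d f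
        outside : (∀ y → edge y ≡ f → [ flip d , y , d ]) → first (flip d) f ≡ first d f → Compare d f

      compare : ∀ d {f} → ¬ f Subset.∈ SpanningTree.edges T → f ≢ edge d → Compare d f
      compare d {f} f∉ f≢d = go (total (≢d y refl ∘ sym) (≢fd y refl) (flip-≢ ∘ sym))
                                (total (≢d (flip y) refl ∘ sym) (≢fd (flip y) refl) (flip-≢ ∘ sym))
        where
        y = f , first d f
        ≢d : ∀ y → edge y ≡ f → y ≢ d
        ≢d y refl eq = f≢d (cong proj₁ eq)
        ≢fd : ∀ y → edge y ≡ f → y ≢ flip d
        ≢fd y refl eq = f≢d (cong proj₁ eq)
        d-y-fy : [ d , y , flip y ]
        d-y-fy = Sum.[ (λ eq → ⊥-elim (≢d y refl eq)) , (λ p → p) ]′ (first-spec d f∉)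
        both : ∀ {P : Dart → Set} → P y → P (flip y) → ∀ x → edge x ≡ f → P x
        both {P} Py Pfy x eq with dart-cases x y eq
        ... | inj₁ refl = Py
        ... | inj₂ refl = Pfy
        go : [ d , y , flip d ] ⊎ [ d , flip d , y ] → [ d , flip y , flip d ] ⊎ [ d , flip d , flip y ] → Compare d f
        go (inj₁ p) (inj₁ q) = inside (both p q) (first-unique y f∉ (rot (rot (bcd d-y-fy q))))
        go (inj₁ p) (inj₂ q) = crosses p (rot q) (first-unique (flip y) f∉
                                 (subst (λ v → [ flip d , flip y , v ]) (sym (flip-flip y)) (rot (bcd p q))))
        go (inj₂ p) (inj₁ q) = ⊥-elim (asym d-y-fy (abd q p))
        go (inj₂ p) (inj₂ q) = outside (both (rot p) (rot q)) (first-unique y f∉ (bcd p d-y-fy))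

      -- Common frame of the three comparisons of starts that follow: `κ d` is split off at
      -- `edge d`, and `t` collects what remains.
      β-diff : ∀ {a b} (t : Edge → Vertex → ℤ) d u →
               (∀ e → chordTerm T (sideTerm b u) e - chordTerm T (sideTerm a u) e ≡
                      (if does (e Fin.≟ edge d) then κ d u else 0ℤ) + t e u) →
               β R b T u - β R a T u ≡ κ d u + ∑ (allFin #E) (λ e → t e u)
      β-diff {a} {b} t d u eq = begin
        β R b T u - β R a T u
          ≡⟨ cong₂ _-_ (β-∑ b u) (β-∑ a u) ⟩
        ∑ (allFin #E) (chordTerm T (sideTerm b u)) - ∑ (allFin #E) (chordTerm T (sideTerm a u))
          ≡⟨ ∑-- _ _ (allFin #E) ⟨
        ∑ (allFin #E) (λ e → chordTerm T (sideTerm b u) e - chordTerm T (sideTerm a u) e)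
          ≡⟨ ∑-cong (allFin #E) eq ⟩
        ∑ (allFin #E) (λ e → (if does (e Fin.≟ edge d) then κ d u else 0ℤ) + t e u)
          ≡⟨ ∑-+ (λ e → if does (e Fin.≟ edge d) then κ d u else 0ℤ) (λ e → t e u) (allFin #E) ⟩
        ∑ (allFin #E) (λ e → if does (e Fin.≟ edge d) then κ d u else 0ℤ) + ∑ (allFin #E) (λ e → t e u)
          ≡⟨ cong (λ s → s + ∑ (allFin #E) (λ e → t e u)) (trans (∑-pick (Unique.allFin⁺ #E) (∈-allFin (edge d)) at-other) at-d) ⟩
        κ d u + ∑ (allFin #E) (λ e → t e u) ∎
        where
        open ≡-Reasoning
        at-d : (if does (edge d Fin.≟ edge d) then κ d u else 0ℤ) ≡ κ d u
        at-d = cong (if_then κ d u else 0ℤ) (dec-true (edge d Fin.≟ edge d) refl)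
        at-other : ∀ e → e ≢ edge d → (if does (e Fin.≟ edge d) then κ d u else 0ℤ) ≡ 0ℤ
        at-other e e≢ = cong (if_then κ d u else 0ℤ) (dec-false (e Fin.≟ edge d) e≢)

      chord-cases : ∀ {t t′ s : Edge → ℤ} e → (¬ e Subset.∈ SpanningTree.edges T → t e - t′ e ≡ s e) →
                    chordTerm T t e - chordTerm T t′ e ≡ chordTerm T s e
      chord-cases e eq with e ∈? SpanningTree.edges T
      ... | yes _ = refl
      ... | no e∉ = eq e∉

      -- Moving the start by one step can alter the first end of `edge d` only, and this edge is no
      -- chord.
      β-step-tree : ∀ {d} → Tree d → ∀ u → β R (step d) T u ≡ β R d T u
      β-step-tree {d} td u = trans (β-∑ (step d) u) (trans (∑-cong (allFin #E) same) (sym (β-∑ d u)))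
        where
        same : ∀ e → chordTerm T (sideTerm (step d) u) e ≡ chordTerm T (sideTerm d u) e
        same e with e ∈? SpanningTree.edges T
        ... | yes _ = refl
        ... | no e∉ = cong (λ b → δ (end e b) u) (first-step {d} {e} e∉ (λ { refl → e∉ td }))

      -- The tour from flip d, except that edge d keeps its end: the change of that end is accounted for by κ d.
      first′ : Dart → Edge → Bool
      first′ d e = if does (e Fin.≟ edge d) then first d e else first (flip d) e

      first′-self : ∀ d → first′ d (edge d) ≡ first d (edge d)
      first′-self d = cong (if_then first d (edge d) else first (flip d) (edge d)) (dec-true (edge d Fin.≟ edge d) refl)

      first′-other : ∀ d {e} → e ≢ edge d → first′ d e ≡ first (flip d) e
      first′-other d {e} e≢ = cong (if_then first d e else first (flip d) e) (dec-false (e Fin.≟ edge d) e≢)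

      -- The end of `edge d` moves from `tail d` to `head d`, which accounts for `κ d`. The last
      -- summand is the divisor X of the overview, carried by the chords that cross `d`.
      β-flip-chord : ∀ d → ¬ Tree d → ∀ u → β R (flip d) T u - β R d T u ≡ κ d u + moved T (first d) (first′ d) u
      β-flip-chord d ¬d u = β-diff {d} {flip d} (λ e u → chordTerm T (λ e → δ (end e (first′ d e)) u - δ (end e (first d e)) u) e) d u term
        where
        Move : Edge → ℤ
        Move e = δ (end e (first′ d e)) u - δ (end e (first d e)) u
        term : ∀ e → chordTerm T (sideTerm (flip d) u) e - chordTerm T (sideTerm d u) e ≡
                     (if does (e Fin.≟ edge d) then κ d u else 0ℤ) + chordTerm T Move e
        term e = cases (e Fin.≟ edge d)
          where
          open ≡-Reasoning
          cases : (e≟d : Dec (e ≡ edge d)) → chordTerm T (sideTerm (flip d) u) e - chordTerm T (sideTerm d u) e ≡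
                  (if does e≟d then κ d u else 0ℤ) + chordTerm T Move e
          cases (yes refl) = begin
            chordTerm T (sideTerm (flip d) u) e - chordTerm T (sideTerm d u) e
              ≡⟨ cong₂ _-_ (chordTerm-chord T (sideTerm (flip d) u) ¬d) (chordTerm-chord T (sideTerm d u) ¬d) ⟩
            sideTerm (flip d) u e - sideTerm d u e
              ≡⟨ cong₂ (λ b b′ → δ (end e b) u - δ (end e b′) u) (first-self (flip d) ¬d) (first-self d ¬d) ⟩
            κ d u
              ≡⟨ ℤ.+-identityʳ (κ d u) ⟨
            κ d u + 0ℤ
              ≡⟨ cong (λ z → κ d u + z) (trans (chordTerm-chord T Move ¬d) (ℤ.i≡j⇒i-j≡0 (cong (λ b → δ (end e b) u) (first′-self d)))) ⟨
            κ d u + chordTerm T Move e ∎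
          cases (no e≢) = trans (chord-cases {sideTerm (flip d) u} {sideTerm d u} {Move} e
                                   (λ _ → cong (λ b → δ (end e b) u - δ (end e (first d e)) u) (sym (first′-other d e≢))))
                                (sym (ℤ.+-identityˡ (chordTerm T Move e)))

      -- The indicator of the side of tail d in its fundamental cut
      side-potential : ∀ {d} → Tree d → Vertex → ℤ
      side-potential {d} td v = δ (Side.side d td v) (Side.side d td (tail d))

      -- Firing the side of `tail d`. Since `next d` is `step (flip d)`, the start `flip d` can
      -- stand in for it; the chords that change their end between the starts `d` and `flip d` are
      -- those in the fundamental cut of `d`, and these are the chords on which `h` is not constant.
      shift-tree : ∀ {d} → Tree d → _∼_ graph (β R (next d) T) (_⊕_ graph (β R d T) (κ d))
      shift-tree {d} td = h , λ u → begin
        β R (next d) T u - (β R d T u + κ d u)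
          ≡⟨ regroup (β R (next d) T u) (β R d T u) (κ d u) ⟩
        (β R (next d) T u - β R d T u) - κ d u
          ≡⟨ cong (λ z → z - κ d u) (β-diff {d} {next d} (λ e u → edgeTerm h u e) d u (term u)) ⟩
        (κ d u + ∑ (allFin #E) (edgeTerm h u)) - κ d u
          ≡⟨ cancel (κ d u) (∑ (allFin #E) (edgeTerm h u)) ⟩
        ∑ (allFin #E) (edgeTerm h u)
          ≡⟨ Δ-∑ h u ⟨
        Δ graph h u ∎
        where
        open ≡-Reasoning
        open Side d td
        h : Vertex → ℤ
        h = side-potential td
        regroup : ∀ a b c → a - (b + c) ≡ (a - b) - c
        regroup = solve-∀
        cancel : ∀ a b → (a + b) - a ≡ b
        cancel = solve-∀
        opposite-cancel : ∀ a b → 0ℤ ≡ (a - b) + (1ℤ - 0ℤ) * (b - a)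
        opposite-cancel = solve-∀
        lower : ∀ a b → (0ℤ - 1ℤ) * (a - b) ≡ b - a
        lower = solve-∀

        h-near : ∀ {v} → side v ≡ side (tail d) → h v ≡ 1ℤ
        h-near {v} eq = trans (cong (λ w → δ w (side (tail d))) eq) (δ-≡ (side (tail d)))
        h-far : ∀ {v} → side v ≡ side (head d) → h v ≡ 0ℤ
        h-far {v} eq = δ-≢ (λ eq′ → side-≢ (trans (sym eq′) eq))
        inner : ∀ {x} → [ d , x , flip d ] → side (tail x) ≡ side (head d)
        inner = between-side td
        outer : ∀ {x} → [ flip d , x , d ] → side (tail x) ≡ side (tail d)
        outer {x} p = trans (between-side {flip d} td (subst (λ v → [ flip d , x , v ]) (sym (flip-flip d)) p))
                            (cong (side ∘ tail) (flip-flip d))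
        level : ∀ u x → h (tail x) ≡ h (head x) → edgeTerm h u (edge x) ≡ 0ℤ
        level u x eq = trans (edgeTerm-dart h u x) (trans (cong (λ z → z * (δ (tail x) u - δ (head x) u)) (ℤ.i≡j⇒i-j≡0 eq))
                                                      (ℤ.*-zeroˡ (δ (tail x) u - δ (head x) u)))

        chord : ∀ u e → ¬ e Subset.∈ SpanningTree.edges T → Compare d e →
                sideTerm (flip d) u e - sideTerm d u e ≡ edgeTerm h u e
        chord u e e∉ (crosses p q eq) = sym (begin
          edgeTerm h u e
            ≡⟨ edgeTerm-dart h u y ⟩
          (h (tail y) - h (head y)) * (δ (tail y) u - δ (head y) u)
            ≡⟨ cong₂ (λ a b → (a - b) * (δ (tail y) u - δ (head y) u)) (h-far (inner p)) (h-near (outer q)) ⟩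
          (0ℤ - 1ℤ) * (δ (tail y) u - δ (head y) u)
            ≡⟨ lower (δ (tail y) u) (δ (head y) u) ⟩
          δ (head y) u - δ (tail y) u
            ≡⟨ cong (λ b → δ (end e b) u - δ (tail y) u) eq ⟨
          sideTerm (flip d) u e - sideTerm d u e ∎)
          where y = e , first d e
        chord u e e∉ (inside p eq)  = trans (ℤ.i≡j⇒i-j≡0 (cong (λ b → δ (end e b) u) eq))
          (sym (level u (e , false) (trans (h-far (inner (p (e , false) refl))) (sym (h-far (inner (p (e , true) refl)))))))
        chord u e e∉ (outside p eq) = trans (ℤ.i≡j⇒i-j≡0 (cong (λ b → δ (end e b) u) eq))
          (sym (level u (e , false) (trans (h-near (outer (p (e , false) refl))) (sym (h-near (outer (p (e , true) refl)))))))

        term : ∀ u e → chordTerm T (sideTerm (next d) u) e - chordTerm T (sideTerm d u) e ≡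
                       (if does (e Fin.≟ edge d) then κ d u else 0ℤ) + edgeTerm h u e
        term u e = cases (e Fin.≟ edge d) (e ∈? SpanningTree.edges T)
          where
          goal : ℤ → Set
          goal k = chordTerm T (sideTerm (next d) u) e - chordTerm T (sideTerm d u) e ≡ k + edgeTerm h u e
          flat : e Subset.∈ SpanningTree.edges T → chordTerm T (sideTerm (next d) u) e - chordTerm T (sideTerm d u) e ≡ 0ℤ
          flat e∈ = cong₂ _-_ (chordTerm-tree T (sideTerm (next d) u) e∈) (chordTerm-tree T (sideTerm d u) e∈)
          cases : (e≟d : Dec (e ≡ edge d)) → Dec (e Subset.∈ SpanningTree.edges T) →
                  goal (if does e≟d then κ d u else 0ℤ)
          -- `edge d` is no chord, and its Laplacian term is the negative of `κ d`.
          cases (yes refl) _ = trans (flat td) (trans (opposite-cancel (δ (head d) u) (δ (tail d) u)) (cong (λ z → κ d u + z)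
            (sym (trans (edgeTerm-dart h u d)
              (cong₂ (λ a b → (a - b) * (δ (tail d) u - δ (head d) u)) (h-near refl) (h-far refl))))))
          cases (no e≢) (yes e∈) = trans (flat e∈) (sym (trans (ℤ.+-identityˡ (edgeTerm h u e))
            (level u (e , false) (cong (λ v → δ v (side (tail d))) (side-same (e , false) e∈ e≢)))))
          cases (no e≢) (no e∉)  = trans (cong₂ _-_ (chordTerm-chord T (sideTerm (next d) u) e∉) (chordTerm-chord T (sideTerm d u) e∉))
            (trans (cong (λ b → δ (end e b) u - sideTerm d u e)
                      (trans (cong (λ v → first v e) (sym (step-flip {d} td))) (first-step {flip d} {e} e∉ e≢)))
              (trans (chord u e e∉ (compare d e∉ e≢)) (sym (ℤ.+-identityˡ (edgeTerm h u e)))))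

      -- Here `next d` is `step d`, and only `edge d` changes its end, so the two divisors are even
      -- equal.
      shift-chord : ∀ {d} → ¬ Tree d → _∼_ graph (β R (next d) T) (_⊕_ graph (β R d T) (κ d))
      shift-chord {d} ¬d = ∼-reflexive λ u → trans (split (β R (next d) T u) (β R d T u))
        (cong (λ z → β R d T u + z) (trans (β-diff {d} {next d} (λ _ _ → 0ℤ) d u (term u))
          (trans (cong (λ z → κ d u + z) (∑-0 (allFin #E) (λ _ → refl))) (ℤ.+-identityʳ (κ d u)))))
        where
        split : ∀ a b → a ≡ b + (a - b)
        split = solve-∀
        next≡step : step d ≡ next d
        next≡step = step-nontree {d} ¬d
        term : ∀ u e → chordTerm T (sideTerm (next d) u) e - chordTerm T (sideTerm d u) e ≡
                       (if does (e Fin.≟ edge d) then κ d u else 0ℤ) + 0ℤ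
        term u e = trans (cases (e Fin.≟ edge d) (e ∈? SpanningTree.edges T)) (sym (ℤ.+-identityʳ _))
          where
          goal : ℤ → Set
          goal k = chordTerm T (sideTerm (next d) u) e - chordTerm T (sideTerm d u) e ≡ k
          terms : ¬ e Subset.∈ SpanningTree.edges T → chordTerm T (sideTerm (next d) u) e - chordTerm T (sideTerm d u) e ≡
                  sideTerm (next d) u e - sideTerm d u e
          terms e∉ = cong₂ _-_ (chordTerm-chord T (sideTerm (next d) u) e∉) (chordTerm-chord T (sideTerm d u) e∉)
          cases : (e≟d : Dec (e ≡ edge d)) → Dec (e Subset.∈ SpanningTree.edges T) →
                  goal (if does e≟d then κ d u else 0ℤ)
          cases (yes refl) _ = trans (terms ¬d) (cong₂ (λ b b′ → δ (end e b) u - δ (end e b′) u)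
            (trans (cong (λ v → first v e) (sym next≡step)) (first-step-self d ¬d)) (first-self d ¬d))
          cases (no e≢) (yes e∈) = cong₂ _-_ (chordTerm-tree T (sideTerm (next d) u) e∈) (chordTerm-tree T (sideTerm d u) e∈)
          cases (no e≢) (no e∉)  = trans (terms e∉) (ℤ.i≡j⇒i-j≡0 (cong (λ b → δ (end e b) u)
            (trans (cong (λ v → first v e) (sym next≡step)) (first-step {d} {e} e∉ e≢))))

      shift : ∀ d → _∼_ graph (β R (next d) T) (_⊕_ graph (β R d T) (κ d))
      shift d = cases (tree? d)
        where
        cases : Dec (Tree d) → _∼_ graph (β R (next d) T) (_⊕_ graph (β R d T) (κ d))
        cases (yes td) = shift-tree td
        cases (no ¬d)  = shift-chord ¬d

      -- At the tail of x, the chords crossing d only leave.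
      unbalanced⇒moved<0 : ∀ {d x} → Unbalanced d x → moved T (first d) (first′ d) (tail x) ℤ.< 0ℤ
      unbalanced⇒moved<0 {d} {x} (¬d , ¬x , (d-x-fd , fd-fx-d) , none) =
        subst (moved T (first d) (first′ d) w ℤ.<_) (∑-0 (allFin #E) (λ _ → refl))
          (∑-mono-< {f = term} {g = λ _ → 0ℤ} term≤0 (∈-allFin (edge x)) term<0)
        where
        w = tail x
        Move term : Edge → ℤ
        Move e = δ (end e (first′ d e)) w - δ (end e (first d e)) w
        term = chordTerm T Move
        same≤0 : ∀ {a b} → a ≡ b → a - b ℤ.≤ 0ℤ
        same≤0 {a} refl = ℤ.≤-reflexive (ℤ.+-inverseʳ a)
        leave≤0 : ∀ v → 0ℤ - δ v w ℤ.≤ 0ℤ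
        leave≤0 v with does (v Fin.≟ w)
        ... | true  = ℤ.-≤+
        ... | false = ℤ.≤-refl

        chord≤0 : ∀ e → ¬ e Subset.∈ SpanningTree.edges T → e ≢ edge d → Compare d e →
                  δ (end e (first′ d e)) w - δ (end e (first d e)) w ℤ.≤ 0ℤ
        chord≤0 e e∉ e≢ (inside _ eq)  = same≤0 (cong (λ b → δ (end e b) w) (trans (first′-other d e≢) eq))
        chord≤0 e e∉ e≢ (outside _ eq) = same≤0 (cong (λ b → δ (end e b) w) (trans (first′-other d e≢) eq))
        chord≤0 e e∉ e≢ (crosses p q eq) = subst (λ z → z - δ (end e (first d e)) w ℤ.≤ 0ℤ)
          (sym (trans (cong (λ b → δ (end e b) w) (trans (first′-other d e≢) eq)) (δ-≢ other)))
          (leave≤0 (end e (first d e)))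
          where
          y = e , first d e
          -- Otherwise `flip y` would cross `d` at `tail x` in the direction opposite to `x`.
          other : head y ≢ w
          other eq′ = none (lose (∈-darts (flip y)) (opposite e∉ eq′ q (subst (λ v → [ d , v , flip d ]) (sym (flip-flip y)) p)))

        term≤0 : ∀ e → term e ℤ.≤ 0ℤ
        term≤0 e = cases (e Fin.≟ edge d) (e ∈? SpanningTree.edges T)
          where
          cases : Dec (e ≡ edge d) → Dec (e Subset.∈ SpanningTree.edges T) → term e ℤ.≤ 0ℤ
          cases _          (yes e∈) = ℤ.≤-reflexive (chordTerm-tree T Move e∈)
          cases (yes refl) (no e∉)  = subst (ℤ._≤ 0ℤ) (sym (chordTerm-chord T Move e∉)) (same≤0 {δ (end e (first′ d e)) w} (cong (λ b → δ (end e b) w) (first′-self d)))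
          cases (no e≢)    (no e∉)  = subst (ℤ._≤ 0ℤ) (sym (chordTerm-chord T Move e∉)) (chord≤0 e e∉ e≢ (compare d e∉ e≢))

        x≢d : edge x ≢ edge d
        x≢d eq with dart-cases x d eq
        ... | inj₁ refl = ≢₁₂ d-x-fd refl
        ... | inj₂ refl = ≢₂₃ d-x-fd refl

        d-x-fx : [ d , x , flip x ]
        d-x-fx = abd d-x-fd (rot (rot fd-fx-d))
        fd-fx-x : [ flip d , flip x , flip (flip x) ]
        fd-fx-x = subst (λ v → [ flip d , flip x , v ]) (sym (flip-flip x)) (rot (bcd d-x-fd (rot (rot fd-fx-d))))

        term<0 : term (edge x) ℤ.< 0ℤ
        term<0 = subst (ℤ._< 0ℤ) (sym (begin
          term (edge x)
            ≡⟨ chordTerm-chord T Move ¬x ⟩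
          δ (end (edge x) (first′ d (edge x))) w - δ (end (edge x) (first d (edge x))) w
            ≡⟨ cong₂ (λ b b′ → δ (end (edge x) b) w - δ (end (edge x) b′) w)
                 (trans (first′-other d x≢d) (first-unique (flip x) ¬x fd-fx-x)) (first-unique x ¬x d-x-fx) ⟩
          δ (head x) w - δ (tail x) w
            ≡⟨ cong₂ _-_ (δ-≢ (tail≢head x ∘ sym)) (δ-≡ w) ⟩
          0ℤ - 1ℤ ∎)) ℤ.-<+
          where open ≡-Reasoning

  -- The accumulated shift does not depend on the tree.
  shifts : ℕ → Dart → Divisor graph
  shifts zero    d u = 0ℤ
  shifts (suc k) d u = shifts k (next d) u + κ d u

  module _ (T : SpanningTree multigraph) where
    open TreeStep T using (circuit)
    open Firsts T

    β-shift : ∀ d → _∼_ graph (β R (next d) T) (_⊕_ graph (β R d T) (κ d))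
    β-shift d = WithCircle.shift (circuit d) d

    β-shifts : ∀ k d → _∼_ graph (β R (iterate next d k) T) (_⊕_ graph (β R d T) (shifts k d))
    β-shifts zero    d = ∼-reflexive (λ u → sym (ℤ.+-identityʳ (β R d T u)))
    β-shifts (suc k) d = begin
      β R (iterate next (next d) k) T                  ≈⟨ β-shifts k (next d) ⟩
      _⊕_ graph (β R (next d) T) (shifts k (next d))   ≈⟨ shifted ⟩
      _⊕_ graph (β R d T) (shifts (suc k) d)           ∎
      where
      open SetoidReasoning (∼-setoid graph)
      rearrange : ∀ a b c e → (a + b) - (c + (b + e)) ≡ a - (c + e)
      rearrange = solve-∀
      shifted : _∼_ graph (_⊕_ graph (β R (next d) T) (shifts k (next d))) (_⊕_ graph (β R d T) (shifts (suc k) d))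
      shifted = ∼-resp {_⊕_ graph (β R (next d) T) (shifts k (next d))} {_⊕_ graph (β R d T) (shifts (suc k) d)}
                       {β R (next d) T} {_⊕_ graph (β R d T) (κ d)}
                       (λ u → rearrange (β R (next d) T u) (shifts k (next d) u) (β R d T u) (κ d u)) (β-shift d)

    β-isBreakDivisor : ∀ d → IsBreakDivisor graph (β R d T)
    β-isBreakDivisor d = T , first d , WithCircle.β-break (circuit d) d

    -- The genus, in a form free of `T`; it gives `γ`, a difference of divisors of two trees, degree
    -- 0.
    β-degree : ∀ d → deg graph (β R d T) ≡ (ℤ.+ #E + 1ℤ) - ℤ.+ #V
    β-degree d = trans (add-sub (deg graph (β R d T)) (ℤ.+ #V)) (cong (λ z → z - ℤ.+ #V) (begin
      deg graph (β R d T) + ℤ.+ #V          ≡⟨ cong₂ _+_ (WithCircle.deg-β (circuit d) d) (cong ℤ.+_ (sym (#treeEdges T (circuit d)))) ⟩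
      ℤ.+ c + ℤ.+ (t ℕ.+ 1)                 ≡⟨ cong (λ z → ℤ.+ c + z) (ℤ.pos-+ t 1) ⟩
      ℤ.+ c + (ℤ.+ t + 1ℤ)                  ≡⟨ rearrange (ℤ.+ c) (ℤ.+ t) 1ℤ ⟩
      (ℤ.+ t + ℤ.+ c) + 1ℤ                  ≡⟨ cong (λ z → z + 1ℤ) (ℤ.pos-+ t c) ⟨
      ℤ.+ (t ℕ.+ c) + 1ℤ                    ≡⟨ cong (λ n → ℤ.+ n + 1ℤ) (#edges T (circuit d)) ⟩
      ℤ.+ #E + 1ℤ                           ∎))
      where
      open ≡-Reasoning
      open Counting R
      t = length (treeEdges T (circuit d))
      c = length (nonTreeEdges graph T)
      rearrange : ∀ a b c → a + (b + c) ≡ (b + a) + c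
      rearrange = solve-∀
      add-sub : ∀ a b → a ≡ (a + b) - b
      add-sub = solve-∀

  -- Walking along `d` leads to `next (flip d)` without changing the divisor, while rotating the
  -- start from `flip d` to that dart adds `κ (flip d)`, the negative of `κ d`.
  β-flip-tree : ∀ T d → edge d Subset.∈ SpanningTree.edges T →
                _∼_ graph (β R (flip d) T) (_⊕_ graph (β R d T) (κ d))
  β-flip-tree T d td = ∼.sym {_⊕_ graph (β R d T) (κ d)} {β R (flip d) T} (∼-resp {_⊕_ graph (β R d T) (κ d)} {β R (flip d) T}
                                     {β R (next (flip d)) T} {_⊕_ graph (β R (flip d) T) (κ (flip d))}
                                     same (β-shift T (flip d)))
    where
    open TreeStep T
    rearrange : ∀ a b c e → (a + (b - c)) - e ≡ a - (e + (c - b))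
    rearrange = solve-∀
    κ-flip : ∀ u → κ (flip d) u ≡ δ (tail d) u - δ (head d) u
    κ-flip u = cong (λ v → δ (tail v) u - δ (head d) u) (flip-flip d)
    same : ∀ u → (β R d T u + κ d u) - β R (flip d) T u ≡ β R (next (flip d)) T u - (β R (flip d) T u + κ (flip d) u)
    same u = trans (rearrange (β R d T u) (δ (head d) u) (δ (tail d) u) (β R (flip d) T u))
      (cong₂ (λ a k → a - (β R (flip d) T u + k))
        (trans (sym (Firsts.WithCircle.β-step-tree T (circuit d) {d} td u)) (cong (λ v → β R v T u) (step-tree {d} td)))
        (sym (κ-flip u)))

  -- `γ` makes the action at `tail d` take `T` to `T′`. If the action at `head d` did the same,
  -- `β-flip-tree` for `T′` would yield the same relation for `T`, where X obstructs it.
  unbalanced⇒different : ∀ T {d₀} (C : TreeStep.Circuit T d₀) {d x} → Chords.Unbalanced R T C d x →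
                         DifferentActions R (tail d) (head d)
  unbalanced⇒different T C {d} {x} unb@(¬d , _) = (γ , γ-degree) , T , T′ , (d , refl , β-isBreakDivisor T′ d , acts) , different
    where
    open Firsts T
    open WithCircle C
    T′ = proj₁ (spanning-tree-through graph (edge d))
    d∈T′ = proj₂ (spanning-tree-through graph (edge d))

    γ : Divisor graph
    γ u = β R d T′ u - β R d T u

    γ-degree : deg graph γ ≡ 0ℤ
    γ-degree = trans (∑-- (β R d T′) (β R d T) (allFin #V)) (ℤ.i≡j⇒i-j≡0 (trans (β-degree T′ d) (sym (β-degree T d))))

    acts : _∼_ graph (β R d T′) (_⊕_ graph (β R d T) γ)
    acts = ∼-reflexive λ u → add-difference (β R d T′ u) (β R d T u)
      where
      add-difference : ∀ a b → a ≡ b + (a - b)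
      add-difference = solve-∀

    not-equivalent : ¬ _∼_ graph (β R (flip d) T) (_⊕_ graph (β R d T) (κ d))
    not-equivalent (h , eq) = ℤ.<-irrefl
      (break-unique T (first d) (first′ d) h (λ u → trans (moved≡ u) (eq u)) (tail x)) (unbalanced⇒moved<0 unb)
      where
      isolate : ∀ a b k m → a - b ≡ k + m → m ≡ a - (b + k)
      isolate a b k m eq = trans (solve₁ k m) (trans (cong (λ z → z - k) (sym eq)) (solve₂ a b k))
        where
        solve₁ : ∀ k m → m ≡ (k + m) - k
        solve₁ = solve-∀
        solve₂ : ∀ a b k → (a - b) - k ≡ a - (b + k)
        solve₂ = solve-∀
      moved≡ : ∀ u → moved T (first d) (first′ d) u ≡ β R (flip d) T u - (β R d T u + κ d u)
      moved≡ u = isolate (β R (flip d) T u) (β R d T u) (κ d u) _ (β-flip-chord d ¬d u)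

    different : ¬ BernardiAction R (head d) (γ , γ-degree) T T′
    -- The start `d′` arises from `flip d` by `k` rotations, which add the same divisor `K` for `T`
    -- and for `T′`.
    different (d′ , d′-at-head , _ , p) with k , refl ← cyclic (flip d) d′ (sym d′-at-head) =
      not-equivalent (∼-resp {B (flip d) T} {B d T ⊞ κ d} {B (flip d) T ⊞ K ⊞ γ} {B d T ⊞ γ ⊞ κ d ⊞ K} step₅ chain)
      where
      B : Dart → SpanningTree multigraph → Divisor graph
      B = β R
      infixl 6 _⊞_
      _⊞_ : Divisor graph → Divisor graph → Divisor graph
      _⊞_ = _⊕_ graph
      K = shifts k (flip d)
      add : ∀ {D D′} E → _∼_ graph D D′ → _∼_ graph (D ⊞ E) (D′ ⊞ E)
      add {D} {D′} E = ∼-resp {D ⊞ E} {D′ ⊞ E} {D} {D′} (λ u → cancel (D u) (D′ u) (E u))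
        where
        cancel : ∀ a b c → (a + c) - (b + c) ≡ a - b
        cancel = solve-∀
      chain : _∼_ graph (B (flip d) T ⊞ K ⊞ γ) (B d T ⊞ γ ⊞ κ d ⊞ K)
      chain = begin
        B (flip d) T ⊞ K ⊞ γ     ≈⟨ add {B d′ T} {B (flip d) T ⊞ K} γ (β-shifts T k (flip d)) ⟨
        B d′ T ⊞ γ               ≈⟨ p ⟨
        B d′ T′                  ≈⟨ β-shifts T′ k (flip d) ⟩
        B (flip d) T′ ⊞ K        ≈⟨ add {B (flip d) T′} {B d T′ ⊞ κ d} K (β-flip-tree T′ d d∈T′) ⟩
        B d T′ ⊞ κ d ⊞ K         ≈⟨ add {B d T′ ⊞ κ d} {B d T ⊞ γ ⊞ κ d} K (add {B d T′} {B d T ⊞ γ} (κ d) acts) ⟩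
        B d T ⊞ γ ⊞ κ d ⊞ K      ∎
        where open SetoidReasoning (∼-setoid graph)
      step₅ : ∀ u → B (flip d) T u - (B d T u + κ d u) ≡ (B (flip d) T u + K u + γ u) - (B d T u + γ u + κ d u + K u)
      step₅ u = cancel (B (flip d) T u) (B d T u) (κ d u) (K u) (γ u)
        where
        cancel : ∀ a b c k g → a - (b + c) ≡ (a + k + g) - (b + g + c + k)
        cancel = solve-∀

-- Graphs without edges, and the theorem

inhabited? : ∀ n → Fin n ⊎ n ≡ 0
inhabited? zero    = inj₂ refl
inhabited? (suc n) = inj₁ Fin.zero

subsingleton⇒1 : ∀ n .{{_ : ℕ.NonZero n}} → (∀ (i j : Fin n) → i ≡ j) → n ≡ 1
subsingleton⇒1 1             _     = refl
subsingleton⇒1 (suc (suc n)) equal with () ← equal Fin.zero (Fin.suc Fin.zero)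

-- Without edges there is no dart from which a tour could start. Connectedness leaves one vertex,
-- and `#F` is 1 by its convention.
edgeless⇒planar : (R : RibbonGraph) → RibbonGraph.#E R ≡ 0 → Planar R
edgeless⇒planar R #E≡0 = cong₂ (λ χ f → χ + ℤ.+ f) (cong₂ (λ v e → ℤ.+ v - ℤ.+ e) one-vertex #E≡0)
                               (cong (λ ds → 1 ℕ.⊔ length (List.deduplicate (sameFace? R) ds)) (empty darts))
  where
  open RibbonGraph R
  no-dart : ¬ Dart
  no-dart (e , _) with () ← subst Fin #E≡0 e
  empty : ∀ (ds : List Dart) → ds ≡ []
  empty []      = refl
  empty (d ∷ _) = ⊥-elim (no-dart d)
  same-vertex : ∀ u v → u ≡ v
  same-vertex u v with connected u v
  ... | _ , []    = refl
  ... | _ , d ∷ _ = ⊥-elim (no-dart d)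
  one-vertex : #V ≡ 1
  one-vertex = subsingleton⇒1 #V {{nonEmpty}} same-vertex

theorem5p2 : (R : RibbonGraph) → NonPlanar R →
    ∃[ v ] ∃[ v′ ] DifferentActions R v v′
theorem5p2 R np with inhabited? (RibbonGraph.#E R)
... | inj₂ #E≡0 = ⊥-elim (np (edgeless⇒planar R #E≡0))
... | inj₁ e =
  -- Any spanning tree serves as `T`; the edge `e` also supplies the dart at which its circuit
  -- begins.
  let T , _       = spanning-tree-through (RibbonGraph.graph R) e
      C           = Ribbon.TreeStep.circuit R T (e , false)
      d , x , unb = Chords.nonplanar⇒unbalanced R T C np
  in RibbonGraph.tail R d , RibbonGraph.head R d , Bernardi.unbalanced⇒different R T C unb
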